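{- Let $k \geq 2$ be an integer, let $G$ be a $2k$-edge-connected, locally finite graph, and let $A$ be a finite set of vertices of $G$ such that each connected component of $G-A$ is boundary-linked. Then there is a set of vertices $X \subseteq V(G)\setminus A$ containing at most one vertex from each component of $G-A$ such that $G$ contains an immersion, on $A \cup X$, of a finite, $3$-edge-connected multigraph $H$ with vertex set $A\cup X$ with the following properties: (i) $d_H(x) = 3$ for all $x \in X$; (ii) $\lambda_H(a,b) \geq 2k$ for all distinct $a,b \in A$; (iii) every edge of $G$ between two vertices of $A$ is also an edge of $H$ (i.e. it is an edge of $H$ whose corresponding path in the immersion is that edge itself).
   Context: For a set of vertices $B$, its boundary is the set of edges of $G$ with exactly one endvertex in $B$. Two rays of $G$ are equivalent if there are infinitely many pairwise vertex-disjoint paths between them in $G$. A set of vertices $B$ is boundary-linked if $G[B]$ together with the boundary edges of $B$ contains a collection of pairwise edge-disjoint, pairwise equivalent rays $R_1,R_2,\ldots$ such that each boundary edge of $B$ is the first edge of one of the $R_i$. If $H$ is a multigraph with vertices $x_1,\ldots,x_n$, an immersion of $H$ in $G$ on $\{y_1,\ldots,y_n\}$ is a subgraph of $G$ consisting of $n$ distinct distinguished vertices $y_1,\ldots,y_n$ (with $y_i$ corresponding to $x_i$) and a collection of pairwise edge-disjoint paths in $G$ such that for each edge $x_ix_j$ of $H$ (counted with multiplicity) there is a corresponding path in the collection from $y_i$ to $y_j$. $d_H(x)$ denotes the degree of $x$ in $H$ and $\lambda_H(a,b)$ the maximum number of pairwise edge-disjoint $a$–$b$ paths in $H$. -}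

module Defs where

open import Data.Fin using (Fin)
open import Data.Fin.Properties using (_≟_)
open import Data.List using (List; []; _∷_; length; filter; allFin)
open import Data.List.Membership.Propositional using () renaming (_∈_ to _∈ˡ_)
open import Data.List.Relation.Unary.All using (All)
open import Data.List.Relation.Unary.Unique.Propositional using (Unique)
open import Data.List.Relation.Binary.Disjoint.Propositional using (Disjoint)
open import Data.Nat using (ℕ; suc; _≤_; _<_)
open import Data.Product using (∃; ∃₂; _×_; _,_)
open import Data.Sum using (_⊎_)
open import Function.Bundles using (_↣_)
open import Function.Definitions using (Injective)
open import Level using (0ℓ)
open import Relation.Binary.PropositionalEquality using (_≡_; _≢_)
open import Relation.Nullary using (Dec)
open import Relation.Nullary.Decidable using (_⊎-dec_)
open import Relation.Unary using (Pred; _∈_; _∉_; _≐_)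

Finite : {S : Set} → Pred S 0ℓ → Set
Finite {S} P = ∃ λ (xs : List S) → P ≐ (_∈ˡ xs)

-- Undirected, with parallel edges but no loops: which end is called end₁ is
-- an artefact of the encoding, and Joins below is symmetric in the two ends.
record Multigraph (V E : Set) : Set where
  field
    end₁ end₂ : E → V
    loopless  : ∀ e → end₁ e ≢ end₂ e

module _ {V E : Set} (G : Multigraph V E) where
  open Multigraph G

  Joins : E → V → V → Set
  Joins e u v = (end₁ e ≡ u × end₂ e ≡ v) ⊎ (end₁ e ≡ v × end₂ e ≡ u)

  Incident : V → E → Set
  Incident v e = end₁ e ≡ v ⊎ end₂ e ≡ v

  LocallyFinite : Set
  LocallyFinite = ∀ v → Finite (Incident v)

  Inside : Pred V 0ℓ → Pred E 0ℓ
  Inside B e = end₁ e ∈ B × end₂ e ∈ B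

  Boundary : Pred V 0ℓ → Pred E 0ℓ
  Boundary B e = (end₁ e ∈ B × end₂ e ∉ B) ⊎ (end₁ e ∉ B × end₂ e ∈ B)

  data Walk : V → V → Set where
    stop : ∀ {v} → Walk v v
    step : ∀ {u v w} (e : E) → Joins e u v → Walk v w → Walk u w

  walkVertices : ∀ {u v} → Walk u v → List V
  walkVertices {u} stop         = u ∷ []
  walkVertices {u} (step _ _ p) = u ∷ walkVertices p

  walkEdges : ∀ {u v} → Walk u v → List E
  walkEdges stop         = []
  walkEdges (step e _ p) = e ∷ walkEdges p

  record Path (u v : V) : Set where
    field
      walk   : Walk u v
      simple : Unique (walkVertices walk)

    vertices : List V
    vertices = walkVertices walk

    edges : List E
    edges = walkEdges walk

  open Path

  -- Deleting fewer than ℓ edges never separates two vertices. Graphs with at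
  -- most one vertex are ℓ-edge-connected for every ℓ.
  EdgeConnected : ℕ → Set
  EdgeConnected ℓ = ∀ (F : List E) → length F < ℓ →
    ∀ u v → ∃ λ (p : Path u v) → Disjoint (edges p) F

  EdgeDisjointPaths : V → V → ℕ → Set
  EdgeDisjointPaths a b m = ∃ λ (P : Fin m → Path a b) →
    ∀ i j → i ≢ j → Disjoint (edges (P i)) (edges (P j))

  -- ℓ is the maximum number of pairwise edge-disjoint a–b paths.
  IsLocalEdgeConnectivity : V → V → ℕ → Set
  IsLocalEdgeConnectivity a b ℓ =
    EdgeDisjointPaths a b ℓ × (∀ m → EdgeDisjointPaths a b m → m ≤ ℓ)

  -- u and v lie in the same component of G - A; uninhabited if either is in A.
  SameComponent : Pred V 0ℓ → V → V → Set
  SameComponent A u v = ∃ λ (p : Path u v) → All (_∉ A) (vertices p)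

  record Ray : Set where
    field
      vertex    : ℕ → V
      edge      : ℕ → E
      joins     : ∀ i → Joins (edge i) (vertex i) (vertex (suc i))
      injective : Injective _≡_ _≡_ vertex

  open Ray

  RaysEdgeDisjoint : Ray → Ray → Set
  RaysEdgeDisjoint R S = ∀ i j → edge R i ≢ edge S j

  PathBetween : Ray → Ray → Set
  PathBetween R S = ∃₂ λ i j → Path (vertex R i) (vertex S j)

  betweenVertices : ∀ {R S} → PathBetween R S → List V
  betweenVertices (_ , _ , p) = vertices p

  Equivalent : Ray → Ray → Set
  Equivalent R S = ∃ λ (P : ℕ → PathBetween R S) →
    ∀ i j → i ≢ j →
      Disjoint (betweenVertices {R} {S} (P i)) (betweenVertices {R} {S} (P j))

  -- The rays R₁, R₂, … form a finite or countably infinite family, indexed by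
  -- a type that embeds in ℕ. They lie in G[B] plus the boundary edges of B,
  -- while the paths witnessing their equivalence may use all of G.
  record BoundaryLinked (B : Pred V 0ℓ) : Set₁ where
    field
      Index        : Set
      countable    : Index ↣ ℕ
      ray          : Index → Ray
      within       : ∀ i n → Inside B (edge (ray i) n) ⊎ Boundary B (edge (ray i) n)
      edgeDisjoint : ∀ i j → i ≢ j → RaysEdgeDisjoint (ray i) (ray j)
      equivalent   : ∀ i j → i ≢ j → Equivalent (ray i) (ray j)
      covers       : ∀ e → e ∈ Boundary B → ∃ λ i → edge (ray i) 0 ≡ e

module _ {n m : ℕ} (H : Multigraph (Fin n) (Fin m)) where
  open Multigraph H

  incident? : ∀ x e → Dec (Incident H x e)
  incident? x e = (end₁ e ≟ x) ⊎-dec (end₂ e ≟ x)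

  degree : Fin n → ℕ
  degree x = length (filter (incident? x) (allFin m))

module _ {V E W D : Set} (H : Multigraph W D) (G : Multigraph V E) where
  open Multigraph H

  -- The routes may pass through branch vertices other than their own ends.
  record Immersion : Set where
    field
      branch       : W → V
      distinct     : Injective _≡_ _≡_ branch
      route        : ∀ f → Path G (branch (end₁ f)) (branch (end₂ f))
      edgeDisjoint : ∀ f g → f ≢ g →
                     Disjoint (Path.edges (route f)) (Path.edges (route g))

    BranchSet : Pred V 0ℓ
    BranchSet v = ∃ λ x → branch x ≡ v

{-# OPTIONS --safe #-}

-- Contract every component of G - A to a vertex; the result has all cuts
-- separating A of size at least 2k, and this is the only condition kept.
-- At a contracted vertex s delete edges as long as this condition survives.
-- Then every edge at s lies in a tight cut, and uncrossing (with 2k even)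
-- gives one of two pictures. Either the edges at s split into two classes all
-- of whose cross pairs can be split off, or s has one exceptional edge e and
-- two classes of equal size n inside two tight sets, whose cross pairs can be
-- split off while n ≥ 2. The rays of the component realise what is needed:
-- equivalence yields, for any bipartition of the remaining rays, a path between
-- the two sides that avoids all remaining rays and everything already used. So
-- in the first picture a splittable pair is linked; in the second either a
-- cross pair is linked, or both classes reach the ray of e, which gives a
-- tripod, and the remaining pairs can be linked afterwards. Each component ends
-- with no vertex or with one vertex of degree 3 all of whose edges go to A, so
-- cuts not separating A have at least 3 edges. The 2k edge-disjoint paths come
-- from the same splitting lemma with terminal set {a, b}, where the second
-- picture cannot occur because it needs three terminals.

module Submission where

open import Axiom.ExcludedMiddle using (ExcludedMiddle)
open import Data.Bool using (Bool; T; _xor_; _∧_; _∨_; false; not; true)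
open import Data.Bool.Properties using (T-∧; not-involutive; xor-comm; xor-identityʳ)
open import Data.Empty using (⊥; ⊥-elim)
open import Data.Fin using (Fin; inject≤; suc; zero)
open import Data.Fin.Properties using (_≟_; injective⇒≤; inject≤-injective)
open import Data.List using (List; []; _++_; _∷_; allFin; concatMap; filter; length; lookup; map)
open import Data.List.Membership.Propositional using (lose) renaming (_∈_ to _∈ˡ_; _∉_ to _∉ˡ_)
open import Data.List.Membership.Propositional.Properties using (∈-++⁺ʳ; ∈-++⁺ˡ; ∈-++⁻; ∈-allFin; ∈-concatMap⁺; ∈-lookup; ∈-map⁺; ∈-map⁻)
open import Data.List.Properties using (++-assoc; length-tabulate; map-++; map-tabulate; map-∘; tabulate-lookup)
open import Data.List.Relation.Binary.Disjoint.Propositional using (Disjoint)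
open import Data.List.Relation.Binary.Permutation.Propositional using (_↭_; prep; refl; swap; ↭-refl; ↭-reflexive; ↭-sym; ↭-trans)
open import Data.List.Relation.Binary.Permutation.Propositional.Properties using (++⁺ʳ; All-resp-↭; map⁺; shift; shifts; ↭-length; ∈-resp-↭)
open import Data.List.Relation.Binary.Subset.Propositional using () renaming (_⊆_ to _⊆ˡ_)
open import Data.List.Relation.Unary.All as All using (All; []; _∷_)
open import Data.List.Relation.Unary.All.Properties using () renaming (++⁺ to All-++⁺; map⁺ to All-map⁺)
open import Data.List.Relation.Unary.AllPairs as AllPairs using (AllPairs; []; _∷_; tail)
open import Data.List.Relation.Unary.AllPairs.Properties using () renaming (++⁺ to AllPairs-++⁺; map⁺ to AllPairs-map⁺)
open import Data.List.Relation.Unary.Any using (here; index; there)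
open import Data.List.Relation.Unary.Any.Properties using (lookup-index)
open import Data.List.Relation.Unary.Unique.Propositional using (Unique)
open import Data.List.Relation.Unary.Unique.Propositional.Properties using (Unique[x∷xs]⇒x∉xs; allFin⁺) renaming (++⁺ to Unique-++⁺)
open import Data.Nat using (_*_; _+_; _<_; _≡ᵇ_; _≤_; _≤ᵇ_; _≤′_; suc; s≤s; zero; z≤n; ℕ; ≤′-refl; ≤′-step)
open import Data.Nat.Properties using (+-assoc; +-cancelʳ-≤; +-cancelˡ-≡; +-cancelˡ-≤; +-comm; +-identityʳ; +-mono-≤; +-monoʳ-≤; +-monoˡ-≤; +-suc; <-irrefl; <-trans; <-≤-trans; <⇒≤; <⇒≱; even≢odd; m≤n+m; n<1+n; n≤1+n; suc-injective; z≤′n; ≡ᵇ⇒≡; ≤-antisym; ≤-pred; ≤-refl; ≤-reflexive; ≤-total; ≤-trans; ≤ᵇ⇒≤; ≤′⇒≤; ≤⇒≤′; ≮⇒≥; ≰⇒>)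
open import Data.Nat.Solver using (module +-*-Solver)
open import Data.Product using (_,_; _×_; proj₁; proj₂; Σ-syntax; ∃; ∃-syntax; ∃₂)
open import Data.Sum using (_⊎_; inj₁; inj₂)
open import Data.Unit using (tt)
open import Defs
open import Function using (Equivalence; _∘_; const; id)
open import Function.Bundles using (mk⇔)
open import Function.Definitions using (Injective)
open import Level using (0ℓ)
open import Relation.Binary.PropositionalEquality using (_≡_; _≢_; cong; cong₂; refl; subst; subst₂; sym; trans)
open import Relation.Nullary using (Dec; does; no; yes; ¬_)
open import Relation.Nullary.Decidable using (dec-false; dec-true; does-⇔)
open import Relation.Unary using (Pred; _∈_; _∉_; _∪_; _≐_; _⊆_; ∁)

-- Counting and Boolean identities

-- The rays never allow a pair to be prescribed: a path between two of them may run into a third, so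
-- only a bipartition of the remaining rays can be asked for and any pair across it may be returned.
-- One splittable pair is therefore useless, and the splitting lemma must release all pairs across
-- some bipartition at once. The candidate is a set `Y` with cut value at most 2k+1 that holds as
-- many edges at s as possible. Only a set of value at most 2k+1 containing both ends can obstruct a
-- pair, so an obstruction to a pair across `Y` must itself cross `Y`. Such a set Z, chosen maximal
-- as well, shares exactly one edge e with `Y`, and the differences of `Y` and Z are the two tight
-- sets. The edge e then lies in both obstructions, so no pair containing it can be split: its ray
-- must meet two others in a vertex, which is where degree 3 comes from. Rays still waiting are kept
-- completely untouched, and only finitely many edges are used at any time, so the infinitely many
-- disjoint paths behind equivalence remain available for every later request.

every : (Bool → Bool) → Bool
every f = f true ∧ f false

every-elim : ∀ f → T (every f) → ∀ b → T (f b)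
every-elim f t true  = proj₁ (Equivalence.to (T-∧ {f true}) t)
every-elim f t false = proj₂ (Equivalence.to (T-∧ {f true}) t)

every₂ : (Bool → Bool → Bool) → Bool
every₂ f = every λ a → every (f a)

every₂-elim : ∀ f → T (every₂ f) → ∀ a b → T (f a b)
every₂-elim f t a = every-elim (f a) (every-elim (λ a → every (f a)) t a)

every₄ : (Bool → Bool → Bool → Bool → Bool) → Bool
every₄ f = every₂ λ a b → every₂ (f a b)

every₄-elim : ∀ f → T (every₄ f) → ∀ a b c d → T (f a b c d)
every₄-elim f t a b = every₂-elim (f a b) (every₂-elim (λ a b → every₂ (f a b)) t a b)

true≢false : ∀ {b} → b ≡ true → b ≡ false → ⊥
true≢false refl ()

cancel-≤ : ∀ {a b c d} → a + b ≤ c + d → c ≤ a → b ≤ d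
cancel-≤ {a} {b} {c} {d} p q = +-cancelˡ-≤ c b d (≤-trans (+-monoˡ-≤ b q) p)

cancel-≤′ : ∀ {a b c d} → a + b ≤ c + d → d ≤ b → a ≤ c
cancel-≤′ {a} {b} {c} {d} p q = cancel-≤ (subst₂ _≤_ (+-comm a b) (+-comm c d) p) q

b2n : Bool → ℕ
b2n true  = 1
b2n false = 0

module _ {X : Set} where

  count : (X → Bool) → List X → ℕ
  count p []       = 0
  count p (x ∷ xs) = b2n (p x) + count p xs

  b2n≤1 : ∀ b → b2n b ≤ 1
  b2n≤1 true  = ≤-refl
  b2n≤1 false = z≤n

  count≤length : ∀ p xs → count p xs ≤ length xs
  count≤length p []       = z≤n
  count≤length p (x ∷ xs) = +-mono-≤ (b2n≤1 (p x)) (count≤length p xs)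

  count-cong : ∀ {p q} xs → (∀ {x} → x ∈ˡ xs → p x ≡ q x) → count p xs ≡ count q xs
  count-cong []       e = refl
  count-cong (x ∷ xs) e = cong₂ _+_ (cong b2n (e (here refl))) (count-cong xs (e ∘ there))

  count-++ : ∀ p xs ys → count p (xs ++ ys) ≡ count p xs + count p ys
  count-++ p []       ys = refl
  count-++ p (x ∷ xs) ys = trans (cong (b2n (p x) +_) (count-++ p xs ys)) (sym (+-assoc (b2n (p x)) _ _))

  count-↭ : ∀ p {xs ys} → xs ↭ ys → count p xs ≡ count p ys
  count-↭ p refl = refl
  count-↭ p (prep x σ) = cong (b2n (p x) +_) (count-↭ p σ)
  count-↭ p (swap {xs} x y σ) = trans
    (solve 3 (λ a b c → a :+ (b :+ c) := b :+ (a :+ c)) refl (b2n (p x)) (b2n (p y)) (count p xs))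
    (cong (λ n → b2n (p y) + (b2n (p x) + n)) (count-↭ p σ))
    where open +-*-Solver
  count-↭ p (_↭_.trans σ τ) = trans (count-↭ p σ) (count-↭ p τ)

  count-≥1 : ∀ p {x xs} → x ∈ˡ xs → p x ≡ true → 1 ≤ count p xs
  count-≥1 p (here refl) e rewrite e = s≤s z≤n
  count-≥1 p {xs = y ∷ _} (there i) e = ≤-trans (count-≥1 p i e) (m≤n+m _ (b2n (p y)))

  count-exists : ∀ p xs → 1 ≤ count p xs → ∃ λ x → x ∈ˡ xs × p x ≡ true
  count-exists p (x ∷ xs) c with p x in eq
  ... | true  = x , here refl , eq
  ... | false with count-exists p xs c
  ...   | y , i , e = y , there i , e

  count-zero : ∀ p {xs} → count p xs ≤ 0 → ∀ {x} → x ∈ˡ xs → p x ≡ false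
  count-zero p c {x} i with p x in eq
  ... | false = refl
  ... | true with ≤-trans (count-≥1 p i eq) c
  ...   | ()

  count-full : ∀ p xs → (∀ {x} → x ∈ˡ xs → p x ≡ true) → count p xs ≡ length xs
  count-full p []       e = refl
  count-full p (x ∷ xs) e rewrite e (here refl) = cong suc (count-full p xs (e ∘ there))

  count-none : ∀ p xs → (∀ {x} → x ∈ˡ xs → p x ≡ false) → count p xs ≡ 0
  count-none p []       e = refl
  count-none p (x ∷ xs) e rewrite e (here refl) = count-none p xs (e ∘ there)

  count-mono-∈ : ∀ p q {xs} → (∀ {x} → x ∈ˡ xs → p x ≡ true → q x ≡ true) → count p xs ≤ count q xs
  count-mono-∈ p q {[]}     h = z≤n
  count-mono-∈ p q {x ∷ xs} h with p x in eq
  ... | false = ≤-trans (count-mono-∈ p q (h ∘ there)) (m≤n+m _ (b2n (q x)))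
  ... | true rewrite h (here refl) eq = s≤s (count-mono-∈ p q (h ∘ there))

  count-mono : ∀ p q xs → (∀ x → p x ≡ true → q x ≡ true) → count p xs ≤ count q xs
  count-mono p q xs h = count-mono-∈ p q {xs} λ {x} _ → h x

  count-strict : ∀ p q {xs} → (∀ x → p x ≡ true → q x ≡ true) →
    ∀ {x} → x ∈ˡ xs → p x ≡ false → q x ≡ true → count p xs < count q xs
  count-strict p q {x ∷ xs} h (here refl) e e′ rewrite e | e′ = s≤s (count-mono p q xs h)
  count-strict p q {y ∷ xs} h (there i) e e′ with p y in eq
  ... | false = ≤-trans (count-strict p q h i e e′) (m≤n+m _ (b2n (q y)))
  ... | true rewrite h y eq = s≤s (count-strict p q h i e e′)

  count-sub : ∀ (p q r s : X → Bool) xs →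
    (∀ x → b2n (p x) + b2n (q x) ≤ b2n (r x) + b2n (s x)) →
    count p xs + count q xs ≤ count r xs + count s xs
  count-sub p q r s []       h = z≤n
  count-sub p q r s (x ∷ xs) h = subst₂ _≤_
    (lem (b2n (p x)) (b2n (q x)) (count p xs) (count q xs))
    (lem (b2n (r x)) (b2n (s x)) (count r xs) (count s xs))
    (+-mono-≤ (h x) (count-sub p q r s xs h))
    where
    open +-*-Solver
    lem : ∀ a b c d → (a + b) + (c + d) ≡ (a + c) + (b + d)
    lem = solve 4 (λ a b c d → (a :+ b) :+ (c :+ d) := (a :+ c) :+ (b :+ d)) refl

  count-eq : ∀ (p q r t : X → Bool) xs →
    (∀ x → b2n (p x) + b2n (q x) ≡ b2n (r x) + (b2n (t x) + b2n (t x))) →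
    count p xs + count q xs ≡ count r xs + (count t xs + count t xs)
  count-eq p q r t []       h = refl
  count-eq p q r t (x ∷ xs) h = trans
    (lem (b2n (p x)) (b2n (q x)) (count p xs) (count q xs))
    (trans (cong₂ _+_ (h x) (count-eq p q r t xs h))
           (lem′ (b2n (r x)) (b2n (t x)) (count r xs) (count t xs)))
    where
    open +-*-Solver
    lem : ∀ a b c d → (a + c) + (b + d) ≡ (a + b) + (c + d)
    lem = solve 4 (λ a b c d → (a :+ c) :+ (b :+ d) := (a :+ b) :+ (c :+ d)) refl
    lem′ : ∀ a b c d → (a + (b + b)) + (c + (d + d)) ≡ (a + c) + ((b + d) + (b + d))
    lem′ = solve 4 (λ a b c d → (a :+ (b :+ b)) :+ (c :+ (d :+ d)) := (a :+ c) :+ ((b :+ d) :+ (b :+ d))) refl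

count-map : ∀ {X Y : Set} (f : X → Y) (p : Y → Bool) xs → count p (map f xs) ≡ count (p ∘ f) xs
count-map f p []       = refl
count-map f p (x ∷ xs) = cong (b2n (p (f x)) +_) (count-map f p xs)

∈⇒↭ : ∀ {X : Set} {x : X} {xs} → x ∈ˡ xs → ∃ λ ys → xs ↭ x ∷ ys
∈⇒↭ {xs = x ∷ xs} (here refl) = xs , ↭-refl
∈⇒↭ {xs = y ∷ xs} (there i) with ∈⇒↭ i
... | ys , σ = y ∷ ys , ↭-trans (prep y σ) (swap y _ ↭-refl)

∈∈⇒↭ : ∀ {X : Set} {x y : X} {xs} → x ∈ˡ xs → y ∈ˡ xs → x ≢ y → ∃ λ zs → xs ↭ x ∷ y ∷ zs
∈∈⇒↭ i j ne with ∈⇒↭ i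
... | ys , σ with ∈-resp-↭ σ j
...   | here refl = ⊥-elim (ne refl)
...   | there j′ with ∈⇒↭ j′
...     | zs , τ = zs , ↭-trans σ (prep _ τ)

count≤cover : ∀ {X : Set} (p : X → Bool) {xs} (F : List X) → Unique xs → (∀ {x} → x ∈ˡ xs → p x ≡ true → x ∈ˡ F) →
  count p xs ≤ length F
count≤cover p {[]} F u h = z≤n
count≤cover p {x ∷ xs} F (x# ∷ u) h with p x in eq
... | false = count≤cover p F u (h ∘ there)
... | true with ∈⇒↭ (h (here refl) eq)
...   | F′ , σ = ≤-trans (s≤s (count≤cover p F′ u rest)) (≤-reflexive (sym (↭-length σ)))
  where
  rest : ∀ {y} → y ∈ˡ xs → p y ≡ true → y ∈ˡ F′
  rest y∈ py with ∈-resp-↭ σ (h (there y∈) py)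
  ... | here refl = ⊥-elim (All.lookup x# y∈ refl)
  ... | there i   = i

length-filter : ∀ {X : Set} {P : X → Set} (P? : ∀ x → Dec (P x)) xs → length (filter P? xs) ≡ count (does ∘ P?) xs
length-filter P? []       = refl
length-filter P? (x ∷ xs) with does (P? x)
... | true  = cong suc (length-filter P? xs)
... | false = length-filter P? xs

count-lookup : ∀ {X : Set} (q : X → Bool) xs → count (q ∘ lookup xs) (allFin (length xs)) ≡ count q xs
count-lookup q xs = trans (sym (count-map (lookup xs) q (allFin (length xs)))) (cong (count q)
  (trans (map-tabulate id (lookup xs)) (tabulate-lookup xs)))

∧-true : ∀ {a b} → a ≡ true → b ≡ true → a ∧ b ≡ true
∧-true refl refl = refl

∧-true⁻ : ∀ a {b} → a ∧ b ≡ true → a ≡ true × b ≡ true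
∧-true⁻ true e = refl , e

∧-falseˡ : ∀ {a b} → a ≡ false → a ∧ b ≡ false
∧-falseˡ refl = refl

∧-falseʳ : ∀ a {b} → b ≡ false → a ∧ b ≡ false
∧-falseʳ true  e = e
∧-falseʳ false e = refl

∨-trueˡ : ∀ {a b} → a ≡ true → a ∨ b ≡ true
∨-trueˡ refl = refl

∨-trueʳ : ∀ a {b} → b ≡ true → a ∨ b ≡ true
∨-trueʳ true  e = refl
∨-trueʳ false e = e

∨-false : ∀ {a b} → a ≡ false → b ≡ false → a ∨ b ≡ false
∨-false refl refl = refl

∨-false⁻ : ∀ a {b} → a ∨ b ≡ false → a ≡ false × b ≡ false
∨-false⁻ false e = refl , e

not-true : ∀ {a} → a ≡ false → not a ≡ true
not-true refl = refl

not-true⁻ : ∀ a → not a ≡ true → a ≡ false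
not-true⁻ false e = refl

not-false : ∀ {a} → a ≡ true → not a ≡ false
not-false refl = refl

≢true : ∀ {b} → ¬ (b ≡ true) → b ≡ false
≢true {true}  n = ⊥-elim (n refl)
≢true {false} n = refl

k+k≢1+x+x : ∀ k x → k + k ≢ suc (x + x)
k+k≢1+x+x k x e = even≢odd k x (trans (double k) (trans e (cong suc (sym (double x)))))
  where
  double : ∀ n → 2 * n ≡ n + n
  double n = cong (n +_) (+-identityʳ n)

module _ (em : ExcludedMiddle 0ℓ) where

  -- The recursion argument `n` is the room that `m x` still has below `bound`; every strict
  -- improvement uses up one unit of it.
  maximum : {X : Set} (Φ : X → Set) (m : X → ℕ) (bound : ℕ) → (∀ x → Φ x → m x ≤ bound) →
    ∀ x → Φ x → ∃ λ y → Φ y × (∀ z → Φ z → m z ≤ m y)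
  maximum {X} Φ m bound le x φ = go bound x φ (m≤n+m bound (m x))
    where
    go : ∀ n x → Φ x → bound ≤ m x + n → ∃ λ y → Φ y × (∀ z → Φ z → m z ≤ m y)
    go zero x φ b = x , φ , λ z φz → ≤-trans (le z φz) (≤-trans b (≤-reflexive (+-identityʳ (m x))))
    go (suc n) x φ b with em {∃ λ z → Φ z × m x < m z}
    ... | yes (z , φz , lt) = go n z φz (≤-trans b (≤-trans (≤-reflexive (+-suc (m x) n)) (+-monoˡ-≤ n lt)))
    ... | no none = x , φ , λ z φz → ≮⇒≥ (λ lt → none (z , φz , lt))

-- Cuts and splitting off

module Sets (W : Set) where

  infixr 6 _∪ᵇ_ _∩ᵇ_ _∖ᵇ_

  _∪ᵇ_ _∩ᵇ_ _∖ᵇ_ : (W → Bool) → (W → Bool) → W → Bool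
  (S ∪ᵇ T) x = S x ∨ T x
  (S ∩ᵇ T) x = S x ∧ T x
  (S ∖ᵇ T) x = S x ∧ not (T x)

  co : (W → Bool) → W → Bool
  co S x = not (S x)

  crosses : (W → Bool) → W × W → Bool
  crosses S (u , v) = S u xor S v

  -- Submodularity of cuts, one edge at a time. Only the memberships of the two ends in the two sets
  -- matter, so sixteen cases are checked by evaluation.
  crosses-∪∩ : ∀ S T e → b2n (crosses (S ∪ᵇ T) e) + b2n (crosses (S ∩ᵇ T) e) ≤ b2n (crosses S e) + b2n (crosses T e)
  crosses-∪∩ S T (u , v) = ≤ᵇ⇒≤ _ _ (every₄-elim
    (λ a b c d → (b2n ((a ∨ c) xor (b ∨ d)) + b2n ((a ∧ c) xor (b ∧ d))) ≤ᵇ (b2n (a xor b) + b2n (c xor d)))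
    tt (S u) (S v) (T u) (T v))

  crosses-∖∖ : ∀ S T e → b2n (crosses (S ∖ᵇ T) e) + b2n (crosses (T ∖ᵇ S) e) ≤ b2n (crosses S e) + b2n (crosses T e)
  crosses-∖∖ S T (u , v) = ≤ᵇ⇒≤ _ _ (every₄-elim
    (λ a b c d → (b2n ((a ∧ not c) xor (b ∧ not d)) + b2n ((c ∧ not a) xor (d ∧ not b))) ≤ᵇ (b2n (a xor b) + b2n (c xor d)))
    tt (S u) (S v) (T u) (T v))

  between : (W → Bool) → (W → Bool) → W × W → Bool
  between S T (u , v) = ((S ∖ᵇ T) u ∧ (S ∩ᵇ T) v) ∨ ((S ∩ᵇ T) u ∧ (S ∖ᵇ T) v)

  crosses-split : ∀ S T e → b2n (crosses (S ∖ᵇ T) e) + b2n (crosses (S ∩ᵇ T) e)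
    ≡ b2n (crosses S e) + (b2n (between S T e) + b2n (between S T e))
  crosses-split S T (u , v) = ≡ᵇ⇒≡ _ _ (every₄-elim
    (λ a b c d → (b2n ((a ∧ not c) xor (b ∧ not d)) + b2n ((a ∧ c) xor (b ∧ d))) ≡ᵇ
      (b2n (a xor b) + (b2n (((a ∧ not c) ∧ (b ∧ d)) ∨ ((a ∧ c) ∧ (b ∧ not d)))
                      + b2n (((a ∧ not c) ∧ (b ∧ d)) ∨ ((a ∧ c) ∧ (b ∧ not d))))))
    tt (S u) (S v) (T u) (T v))

  crosses-co : ∀ S e → crosses (co S) e ≡ crosses S e
  crosses-co S (u , v) with S u | S v
  ... | true  | true  = refl
  ... | true  | false = refl
  ... | false | true  = refl
  ... | false | false = refl

module Cuts (em : ExcludedMiddle 0ℓ) (W : Set) (A : W → Set) (K : ℕ) where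

  open Sets W

  Sep : (W → Bool) → Set
  Sep S = (∃ λ a → A a × S a ≡ true) × (∃ λ b → A b × S b ≡ false)

  sep : ∀ {S a b} → A a → S a ≡ true → A b → S b ≡ false → Sep S
  sep α p β q = (_ , α , p) , (_ , β , q)

  Sep-co : ∀ {S} → Sep S → Sep (co S)
  Sep-co ((a , α , p) , (b , β , q)) = sep β (not-true q) α (not-false p)

  -- `S` and `T` cut the terminals into four regions. If each of the two pairs of opposite regions
  -- had an empty member, these two empty regions would be adjacent and would make up `S`, `T` or a
  -- complement of one of them; but each of those contains a terminal.
  uncross : ∀ S T → Sep S → Sep T → (Sep (S ∩ᵇ T) × Sep (S ∪ᵇ T)) ⊎ (Sep (S ∖ᵇ T) × Sep (T ∖ᵇ S))
  uncross S T ((a , αa , pa) , (b , αb , pb)) ((c , αc , pc) , (d , αd , pd))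
    with T a in ta | S d in sd | T b in tb | S c in sc
  ... | true  | false | _     | _     = inj₁ (sep αa (∧-true pa ta) αd (∧-falseˡ sd) , sep αa (∨-trueˡ pa) αd (∨-false sd pd))
  ... | true  | true  | true  | _     = inj₂ (sep αd (∧-true sd (not-true pd)) αb (∧-falseˡ pb) , sep αb (∧-true tb (not-true pb)) αd (∧-falseˡ pd))
  ... | true  | true  | false | _     = inj₁ (sep αa (∧-true pa ta) αb (∧-falseˡ pb) , sep αa (∨-trueˡ pa) αb (∨-false pb tb))
  ... | false | _     | _     | false = inj₂ (sep αa (∧-true pa (not-true ta)) αc (∧-falseˡ sc) , sep αc (∧-true pc (not-true sc)) αa (∧-falseˡ ta))
  ... | false | false | _     | true  = inj₁ (sep αc (∧-true sc pc) αd (∧-falseˡ sd) , sep αc (∨-trueˡ sc) αd (∨-false sd pd))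
  ... | false | true  | true  | true  = inj₂ (sep αa (∧-true pa (not-true ta)) αb (∧-falseˡ pb) , sep αb (∧-true tb (not-true pb)) αa (∧-falseˡ ta))
  ... | false | true  | false | true  = inj₁ (sep αc (∧-true sc pc) αb (∧-falseˡ pb) , sep αc (∨-trueˡ sc) αb (∨-false pb tb))

  -- M lists the edges at one further vertex s by their other ends. Only sets S
  -- avoiding s are measured: complements account for the others.
  module Half (I : Set) (end : I → W) where

    cut : List (W × W) → (W → Bool) → ℕ
    cut L S = count (crosses S) L

    μ : List I → (W → Bool) → ℕ
    μ M S = count (S ∘ end) M

    h : List (W × W) → List I → (W → Bool) → ℕ
    h L M S = cut L S + μ M S

    Good : List (W × W) → List I → Set
    Good L M = ∀ S → Sep S → K ≤ h L M S

    -- Under `Good`, tight sets have value exactly `K`. Deleting an edge at s costs a set at most 1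
    -- and splitting off a pair at most 2, so tight sets obstruct deletions and dangerous sets
    -- obstruct splittings.
    Tight Dangerous : List (W × W) → List I → (W → Bool) → Set
    Tight     L M S = Sep S × h L M S ≤ K
    Dangerous L M S = Sep S × h L M S ≤ suc K

    h-↭ : ∀ {L L′ M M′} → L ↭ L′ → M ↭ M′ → ∀ S → h L M S ≡ h L′ M′ S
    h-↭ σ τ S = cong₂ _+_ (count-↭ _ σ) (count-↭ _ τ)

    Good-↭ : ∀ {L L′ M M′} → L ↭ L′ → M ↭ M′ → Good L M → Good L′ M′
    Good-↭ σ τ g S s = ≤-trans (g S s) (≤-reflexive (h-↭ σ τ S))

    delete : ∀ {L M} i → Good L (i ∷ M) → Good L M ⊎ ∃ λ S → Tight L (i ∷ M) S × S (end i) ≡ true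
    delete {L} {M} i g with em {∃ λ S → Sep S × h L M S < K}
    ... | no none = inj₁ λ S s → ≮⇒≥ (λ lt → none (S , s , lt))
    ... | yes (S , s , lt) with S (end i) in eq | g S s
    ...   | false | le = ⊥-elim (<-irrefl refl (<-≤-trans lt le))
    ...   | true  | _  = inj₂ (S , (s , bound) , eq)
      where
      bound : h L (i ∷ M) S ≤ K
      bound rewrite eq | +-suc (cut L S) (μ M S) = lt

    -- A set containing just one of the two ends trades a half-edge for a crossing edge and keeps
    -- its value; one containing neither is unaffected. Only a set around both ends loses, and it
    -- loses exactly 2.
    lift : ∀ {L M} i j → Good L (i ∷ j ∷ M) →
      Good ((end i , end j) ∷ L) M ⊎
      ∃ λ S → Dangerous L (i ∷ j ∷ M) S × S (end i) ≡ true × S (end j) ≡ true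
    lift {L} {M} i j g with em {∃ λ S → Sep S × h ((end i , end j) ∷ L) M S < K}
    ... | no none = inj₁ λ S s → ≮⇒≥ (λ lt → none (S , s , lt))
    ... | yes (S , s , lt) with S (end i) in ei | S (end j) in ej | g S s
    ...   | false | false | le = ⊥-elim (<-irrefl refl (<-≤-trans lt le))
    ...   | true  | false | le = ⊥-elim (<-irrefl refl (<-≤-trans lt (≤-trans le (≤-reflexive (+-suc (cut L S) _)))))
    ...   | false | true  | le = ⊥-elim (<-irrefl refl (<-≤-trans lt (≤-trans le (≤-reflexive (+-suc (cut L S) _)))))
    ...   | true  | true  | _  = inj₂ (S , (s , bound) , ei , ej)
      where
      bound : h L (i ∷ j ∷ M) S ≤ suc K
      bound rewrite ei | ej | +-suc (cut L S) (suc (μ M S)) | +-suc (cut L S) (μ M S) = s≤s lt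

    h-∪∩ : ∀ L M S T → h L M (S ∪ᵇ T) + h L M (S ∩ᵇ T) ≤ h L M S + h L M T
    h-∪∩ L M S T = subst₂ _≤_ (lem (cut L (S ∪ᵇ T)) (cut L (S ∩ᵇ T)) _ _) (lem (cut L S) (cut L T) _ _)
      (+-mono-≤ (count-sub _ _ _ _ L (crosses-∪∩ S T))
                (count-sub _ _ _ _ M λ i → ≤ᵇ⇒≤ _ _ (every₂-elim
                  (λ a b → (b2n (a ∨ b) + b2n (a ∧ b)) ≤ᵇ (b2n a + b2n b)) tt (S (end i)) (T (end i)))))
      where
      open +-*-Solver
      lem : ∀ a b c d → (a + b) + (c + d) ≡ (a + c) + (b + d)
      lem = solve 4 (λ a b c d → (a :+ b) :+ (c :+ d) := (a :+ c) :+ (b :+ d)) refl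

    μ-split : ∀ M S T → μ M S ≡ μ M (S ∖ᵇ T) + μ M (S ∩ᵇ T)
    μ-split M S T = sym (trans
      (count-eq _ _ (S ∘ end) (const false) M λ i → ≡ᵇ⇒≡ _ _ (every₂-elim
        (λ a b → (b2n (a ∧ not b) + b2n (a ∧ b)) ≡ᵇ (b2n a + 0)) tt (S (end i)) (T (end i))))
      (trans (cong (λ n → μ M S + (n + n)) (count-none (const false) M (λ _ → refl))) (+-identityʳ (μ M S))))

    ∩-comm-μ : ∀ M S T → μ M (S ∩ᵇ T) ≡ μ M (T ∩ᵇ S)
    ∩-comm-μ M S T = count-cong M λ {i} _ → ∧-comm′ (S (end i)) (T (end i))
      where
      ∧-comm′ : ∀ a b → a ∧ b ≡ b ∧ a
      ∧-comm′ true  true  = refl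
      ∧-comm′ true  false = refl
      ∧-comm′ false true  = refl
      ∧-comm′ false false = refl

    -- Posimodularity with its surplus: since s lies outside both sets, a half-edge ending in
    -- `S ∩ᵇ T` is counted twice on the right and in neither difference.
    h-∖∖ : ∀ L M S T → (h L M (S ∖ᵇ T) + h L M (T ∖ᵇ S)) + (μ M (S ∩ᵇ T) + μ M (S ∩ᵇ T)) ≤ h L M S + h L M T
    h-∖∖ L M S T = subst₂ _≤_
      (lem (cut L (S ∖ᵇ T)) (cut L (T ∖ᵇ S)) (μ M (S ∖ᵇ T)) (μ M (T ∖ᵇ S)) (μ M (S ∩ᵇ T)))
      (trans (cong ((cut L S + cut L T) +_) (cong₂ _+_ (sym (μ-split M S T))
               (trans (cong (μ M (T ∖ᵇ S) +_) (∩-comm-μ M S T)) (sym (μ-split M T S)))))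
             (lem′ (cut L S) (cut L T) (μ M S) (μ M T)))
      (+-monoˡ-≤ ((μ M (S ∖ᵇ T) + μ M (S ∩ᵇ T)) + (μ M (T ∖ᵇ S) + μ M (S ∩ᵇ T)))
        (count-sub _ _ _ _ L (crosses-∖∖ S T)))
      where
      open +-*-Solver
      lem : ∀ a b c d q → (a + b) + ((c + q) + (d + q)) ≡ ((a + c) + (b + d)) + (q + q)
      lem = solve 5 (λ a b c d q → (a :+ b) :+ ((c :+ q) :+ (d :+ q)) := ((a :+ c) :+ (b :+ d)) :+ (q :+ q)) refl
      lem′ : ∀ a b c d → (a + b) + (c + d) ≡ (a + c) + (b + d)
      lem′ = solve 4 (λ a b c d → (a :+ b) :+ (c :+ d) := (a :+ c) :+ (b :+ d)) refl

    -- The two parts partition `S`, and only the `x` edges running between them are counted in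
    -- excess, each twice.
    h-parity : ∀ L M S T → ∃ λ x → h L M (S ∖ᵇ T) + h L M (S ∩ᵇ T) ≡ h L M S + (x + x)
    h-parity L M S T = count (between S T) L , trans
      (lem (cut L (S ∖ᵇ T)) (μ M (S ∖ᵇ T)) (cut L (S ∩ᵇ T)) (μ M (S ∩ᵇ T)))
      (trans (cong₂ _+_ (count-eq _ _ _ _ L (crosses-split S T)) (sym (μ-split M S T)))
             (lem′ (cut L S) (count (between S T) L) (μ M S)))
      where
      open +-*-Solver
      lem : ∀ a b c d → (a + b) + (c + d) ≡ (a + c) + (b + d)
      lem = solve 4 (λ a b c d → (a :+ b) :+ (c :+ d) := (a :+ c) :+ (b :+ d)) refl
      lem′ : ∀ a b c → (a + (b + b)) + c ≡ (a + c) + (b + b)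
      lem′ = solve 3 (λ a b c → (a :+ (b :+ b)) :+ c := (a :+ c) :+ (b :+ b)) refl

    cut-co : ∀ L S → cut L (co S) ≡ cut L S
    cut-co L S = count-cong L (λ {e} _ → crosses-co S e)

    μ-co : ∀ M S → μ M S + μ M (co S) ≡ length M
    μ-co [] S = refl
    μ-co (i ∷ M) S with S (end i)
    ... | true  = cong suc (μ-co M S)
    ... | false = trans (+-suc (μ M S) _) (cong suc (μ-co M S))

    -- The complement of `S` also separates, so `Good` bounds it too; this is the cut of `S` with s
    -- moved to its side. Consequently a tight set holds at most half of the half-edges, and a
    -- dangerous one at most half rounded up.
    half-bound : ∀ {L M} → Good L M → ∀ S → Sep S → K + (μ M S + μ M S) ≤ h L M S + length M
    half-bound {L} {M} g S s = ≤-trans (+-monoˡ-≤ (μ M S + μ M S) (g (co S) (Sep-co s))) (≤-reflexive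
      (trans (cong (λ c → (c + μ M (co S)) + (μ M S + μ M S)) (cut-co L S))
      (trans (lem (cut L S) (μ M (co S)) (μ M S)) (cong (h L M S +_) (μ-co M S)))))
      where
      open +-*-Solver
      lem : ∀ a b c → (a + b) + (c + c) ≡ (a + c) + (c + b)
      lem = solve 3 (λ a b c → (a :+ b) :+ (c :+ c) := (a :+ c) :+ (c :+ b)) refl

-- The dichotomy for a vertex all of whose edges lie in tight sets

module Splitting (em : ExcludedMiddle 0ℓ) (W : Set) (A : W → Set) (k : ℕ) (I : Set) (end : I → W) where

  K : ℕ
  K = k + k

  open Sets W
  open Cuts em W A K
  open Half I end

  -- There are 2n+1 half-edges in all, so the complement of the tight set `R` has value `K`+1 and
  -- contains the end of `e` and the whole class of `P`; symmetrically for `P`. This is why `e`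
  -- belongs to no splittable pair.
  record Star (L : List (W × W)) (e : I) (M : List I) (n : ℕ) : Set where
    field
      good     : Good L (e ∷ M)
      P R      : W → Bool
      tightP   : Tight L (e ∷ M) P
      tightR   : Tight L (e ∷ M) R
      e∉P      : P (end e) ≡ false
      e∉R      : R (end e) ≡ false
      opposite : ∀ {i} → i ∈ˡ M → R (end i) ≡ not (P (end i))
      sizeP    : μ M P ≡ n
      sizeR    : μ M R ≡ n

  -- In the first case every pair across `Y` must be splittable, because the rays decide which one
  -- is linked. The terminals recorded in the second case lie in `P` only, in `R` only and in
  -- neither, so they are three distinct ones.
  data Split (L : List (W × W)) (M : List I) : Set where
    cross : (Y : W → Bool) →
      (∃ λ i → i ∈ˡ M × Y (end i) ≡ true) → (∃ λ j → j ∈ˡ M × Y (end j) ≡ false) →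
      (∀ {i j M′} → M ↭ i ∷ j ∷ M′ → Y (end i) ≡ true → Y (end j) ≡ false → Good ((end i , end j) ∷ L) M′) →
      Split L M
    star : ∀ {e M′ n} → M ↭ e ∷ M′ → (s : Star L e M′ (suc n)) →
      (∃ λ p → A p × Star.P s p ≡ true × Star.R s p ≡ false) →
      (∃ λ r → A r × Star.P s r ≡ false × Star.R s r ≡ true) →
      (∃ λ q → A q × Star.P s q ≡ false × Star.R s q ≡ false) → Split L M

  Crosses : List I → (W → Bool) → (W → Bool) → Set
  Crosses M Y Z = (∃ λ i → i ∈ˡ M × Y (end i) ≡ true × Z (end i) ≡ true)
                 × (∃ λ j → j ∈ˡ M × Y (end j) ≡ false × Z (end j) ≡ true)

  module _ {L : List (W × W)} {M : List I} (good : Good L M) where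

    private
      H : (W → Bool) → ℕ
      H = h L M

      m : (W → Bool) → ℕ
      m = μ M

    -- If both differences separated, the common half-edge would raise the right side of
    -- posimodularity to at least 2`K`+2, beyond the assumed 2`K`+1. So the intersection and the
    -- union separate, and submodularity applies.
    shared : ∀ {X Y c} → Sep X → Sep Y → H X + H Y ≤ K + c → c ≤ suc K → ∀ {i} → i ∈ˡ M → X (end i) ≡ true → Y (end i) ≡ true →
      Sep (X ∩ᵇ Y) × Sep (X ∪ᵇ Y) × H (X ∪ᵇ Y) + H (X ∩ᵇ Y) ≤ K + c
    shared {X} {Y} {c} sX sY le cK i∈ x y with uncross X Y sX sY
    ... | inj₁ (sQ , sU) = sQ , sU , ≤-trans (h-∪∩ L M X Y) le
    ... | inj₂ (sP , sR) = ⊥-elim (<-irrefl refl (≤-trans lower (≤-trans (h-∖∖ L M X Y) (≤-trans le (+-monoʳ-≤ K cK)))))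
      where
      one : 1 ≤ m (X ∩ᵇ Y)
      one = count-≥1 _ i∈ (∧-true x y)
      lower : suc (K + suc K) ≤ (H (X ∖ᵇ Y) + H (Y ∖ᵇ X)) + (m (X ∩ᵇ Y) + m (X ∩ᵇ Y))
      lower = ≤-trans (≤-reflexive (trans (cong suc (+-suc K K)) (+-comm 2 (K + K))))
        (+-mono-≤ (+-mono-≤ (good _ sP) (good _ sR)) (+-mono-≤ one one))

    dangerous-∪ : ∀ {X Y i} → Tight L M X → Dangerous L M Y → i ∈ˡ M → X (end i) ≡ true → Y (end i) ≡ true →
      Sep (X ∩ᵇ Y) × Dangerous L M (X ∪ᵇ Y) × H (X ∪ᵇ Y) + H (X ∩ᵇ Y) ≤ suc K + K
    dangerous-∪ (sX , tX) (sY , dY) i∈ x y with shared sX sY (+-mono-≤ tX dY) ≤-refl i∈ x y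
    ... | sQ , sU , le = sQ , (sU , cancel-≤′ le′ (good _ sQ)) , le′
      where le′ = ≤-trans le (≤-reflexive (+-comm K (suc K)))

    tight-∪ : ∀ {X Y} → Tight L M X → Tight L M Y → Sep (X ∩ᵇ Y) → Sep (X ∪ᵇ Y) → Tight L M (X ∪ᵇ Y)
    tight-∪ {X} {Y} (_ , tX) (_ , tY) sQ sU = sU , cancel-≤′ (≤-trans (h-∪∩ L M X Y) (+-mono-≤ tX tY)) (good _ sQ)

    module _ (tight : ∀ {i} → i ∈ˡ M → ∃ λ S → Tight L M S × S (end i) ≡ true)
             (Y : W → Bool) (dY : Dangerous L M Y) (maxY : ∀ Z → Dangerous L M Z → m Z ≤ m Y) where

      grows : ∀ {Z} → Dangerous L M Z → (∀ x → Y x ≡ true → Z x ≡ true) →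
        ∀ {j} → j ∈ˡ M → Y (end j) ≡ false → Z (end j) ≡ true → ⊥
      grows dZ sub j∈ y z = <⇒≱ (count-strict _ _ (λ x → sub (end x)) j∈ y z) (maxY _ dZ)

      -- Both ways of uncrossing give the same bound: the union outgrows the maximal set and so has
      -- value at least `K`+2, or the shared half-edge adds 2 to the differences. Two dangerous sets
      -- in this position thus both have value exactly `K`+1. The maximal set is an argument because
      -- it is also taken to be a union `X ∪ᵇ Y`.
      crossing-odd : ∀ Y′ → Dangerous L M Y′ → (∀ Z → Dangerous L M Z → m Z ≤ m Y′) →
        ∀ Z → Dangerous L M Z → Crosses M Y′ Z → suc K + suc K ≤ H Y′ + H Z
      crossing-odd Y′ (sY , _) max Z (sZ , _) ((i , i∈ , yi , zi) , (j , j∈ , yj , zj)) with uncross Y′ Z sY sZ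
      ... | inj₁ (sQ , sU) = ≤-trans (≤-trans (≤-reflexive (cong suc (+-suc K K))) (+-mono-≤ big (good _ sQ))) (h-∪∩ L M Y′ Z)
        where
        big : suc (suc K) ≤ H (Y′ ∪ᵇ Z)
        big = ≰⇒> λ le → <⇒≱ (count-strict _ _ (λ x → ∨-trueˡ) j∈ yj (∨-trueʳ (Y′ (end j)) zj)) (max _ (sU , le))
      ... | inj₂ (sP , sR) = ≤-trans (≤-trans (≤-reflexive (trans (cong suc (+-suc K K)) (+-comm 2 (K + K))))
            (+-mono-≤ (+-mono-≤ (good _ sP) (good _ sR)) (+-mono-≤ one one))) (h-∖∖ L M Y′ Z)
        where
        one : 1 ≤ m (Y′ ∩ᵇ Z)
        one = count-≥1 _ i∈ (∧-true yi zi)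

      -- The dangerous union `X ∪ᵇ Z` still crosses `Y`, so `crossing-odd` gives it value at least
      -- `K`+1. This leaves at most `K` for the intersection.
      tight-∩-crossing : ∀ {X Z i} → Tight L M X → Dangerous L M Z → Crosses M Y Z →
        i ∈ˡ M → X (end i) ≡ true → Z (end i) ≡ true → Tight L M (X ∩ᵇ Z)
      tight-∩-crossing {X} {Z} tX dZ ((a , a∈ , ya , za) , (b , b∈ , yb , zb)) i∈ x z with dangerous-∪ tX dZ i∈ x z
      ... | sQ , dU , le = sQ , cancel-≤ le (cancel-≤
        (crossing-odd Y dY maxY (X ∪ᵇ Z) dU
          ((a , a∈ , ya , ∨-trueʳ (X (end a)) za) , (b , b∈ , yb , ∨-trueʳ (X (end b)) zb))) (proj₂ dY))

      -- The dangerous union `X ∪ᵇ Y` contains no half-edge outside `Y`, by maximality. So it is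
      -- maximal too and still crossed by `Z`, has value at least `K`+1, and leaves at most `K` for
      -- the intersection.
      tight-∩-max : ∀ {X Z i} → Tight L M X → Dangerous L M Z → Crosses M Y Z →
        i ∈ˡ M → X (end i) ≡ true → Y (end i) ≡ true → Tight L M (X ∩ᵇ Y)
      tight-∩-max {X} {Z} tX dZ ((a , a∈ , ya , za) , (b , b∈ , yb , zb)) i∈ x y with dangerous-∪ tX dY i∈ x y
      ... | sQ , dU , le = sQ , cancel-≤ {H (X ∪ᵇ Y)} {H (X ∩ᵇ Y)} {suc K} {K} le (cancel-≤′ {suc K} {suc K} {H (X ∪ᵇ Y)} {H Z}
        (crossing-odd (X ∪ᵇ Y) dU
          (λ Z′ dZ′ → ≤-trans (maxY Z′ dZ′) (count-mono _ _ M (λ c → ∨-trueʳ (X (end c)))))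
          Z dZ
          ((a , a∈ , ∨-trueʳ (X (end a)) ya , za) , (b , b∈ , ≢true (λ u → grows dU (λ c → ∨-trueʳ (X c)) b∈ yb u) , zb)))
        (proj₂ dZ))

      module _ (Z : W → Bool) (dZ : Dangerous L M Z) (cZ : Crosses M Y Z)
               (maxZ : ∀ Z′ → Dangerous L M Z′ × Crosses M Y Z′ → m Z′ ≤ m Z) where

        private
          P R Q U : W → Bool
          P = Y ∖ᵇ Z
          R = Z ∖ᵇ Y
          Q = Y ∩ᵇ Z
          U = Y ∪ᵇ Z

          e : I
          e = proj₁ (proj₁ cZ)
          e∈ : e ∈ˡ M
          e∈ = proj₁ (proj₂ (proj₁ cZ))
          ye : Y (end e) ≡ true
          ye = proj₁ (proj₂ (proj₂ (proj₁ cZ)))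
          ze : Z (end e) ≡ true
          ze = proj₂ (proj₂ (proj₂ (proj₁ cZ)))
          j : I
          j = proj₁ (proj₂ cZ)
          j∈ : j ∈ˡ M
          j∈ = proj₁ (proj₂ (proj₂ cZ))
          yj : Y (end j) ≡ false
          yj = proj₁ (proj₂ (proj₂ (proj₂ cZ)))
          zj : Z (end j) ≡ true
          zj = proj₂ (proj₂ (proj₂ (proj₂ cZ)))

        growsZ : ∀ {Z′} → Dangerous L M Z′ → (∀ x → Z x ≡ true → Z′ x ≡ true) →
          ∀ {c} → c ∈ˡ M → Z (end c) ≡ false → Z′ (end c) ≡ true → ⊥
        growsZ dZ′ sub c∈ z z′ = <⇒≱ (count-strict _ _ (λ x → sub (end x)) c∈ z z′)
          (maxZ _ (dZ′ , (e , e∈ , ye , sub _ ze) , (j , j∈ , yj , sub _ zj)))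

        sumYZ : H Y + H Z ≤ suc K + suc K
        sumYZ = +-mono-≤ (proj₂ dY) (proj₂ dZ)

        mR≤mP : m R ≤ m P
        mR≤mP = +-cancelʳ-≤ (m Q) _ _ (subst₂ _≤_
          (trans (μ-split M Z Y) (cong (m R +_) (∩-comm-μ M Z Y))) (μ-split M Y Z) (maxY Z dZ))

        mR≥1 : 1 ≤ m R
        mR≥1 = count-≥1 _ j∈ (∧-true zj (not-true yj))

        someP : ∃ λ p → p ∈ˡ M × P (end p) ≡ true
        someP = count-exists _ M (≤-trans mR≥1 mR≤mP)

        -- The piece `X ∩ᵇ B` separates, so it has a terminal, which lies in `Q` by assumption;
        -- hence the two tight sets meet in a terminal and both miss the one outside `U`. The result
        -- is a tight set reaching from `Q` to a half-edge in a region without terminals of its own.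
        merge : ∀ {B X} → (∀ x → B x ≡ true → U x ≡ true) → Tight L M Q → Sep U →
          (∀ {a} → A a → B a ≡ true → Q a ≡ true) → Tight L M (X ∩ᵇ B) → Tight L M ((X ∩ᵇ B) ∪ᵇ Q)
        merge {B} {X} B⊆U tQ (_ , (z , αz , uz)) inQ tX@(((a , αa , xa) , _) , _) =
          tight-∪ tX tQ
            (sep αa (∧-true xa qa) αz (∧-falseʳ (X z ∧ B z) qz))
            (sep αa (∨-trueˡ xa) αz (∨-false (∧-falseʳ (X z) (≢true λ b → true≢false (B⊆U z b) uz)) qz))
          where
          qa : Q a ≡ true
          qa = inQ αa (proj₂ (∧-true⁻ (X a) xa))
          qz : Q z ≡ false
          qz = ∧-falseˡ (proj₁ (∨-false⁻ (Y z) uz))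

        -- If P and R both separate terminals then h P = h Q = K and h Y = K + 1,
        -- against the parity of h P + h Q - h Y; otherwise Y or Z could be enlarged.
        ¬both : Sep Q → Sep U → ⊥
        ¬both sQ sU = contra (em {∃ λ a → A a × P a ≡ true}) (em {∃ λ a → A a × R a ≡ true})
          where
          bigU : suc (suc K) ≤ H U
          bigU = ≰⇒> λ le → grows (sU , le) (λ x → ∨-trueˡ) j∈ yj (∨-trueʳ (Y (end j)) zj)
          sumUQ : H U + H Q ≤ suc (suc K) + K
          sumUQ = ≤-trans (h-∪∩ L M Y Z) (≤-trans sumYZ (≤-reflexive (cong suc (+-suc K K))))
          tQ : Tight L M Q
          tQ = sQ , cancel-≤ sumUQ bigU
          hY≡ : H Y ≡ suc K
          hY≡ = ≤-antisym (proj₂ dY) (cancel-≤′ (crossing-odd Y dY maxY Z dZ cZ) (proj₂ dZ))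
          z∉U : ∃ λ z → A z × U z ≡ false
          z∉U = proj₂ sU
          contra : Dec (∃ λ a → A a × P a ≡ true) → Dec (∃ λ a → A a × R a ≡ true) → ⊥
          contra (yes (p , αp , pp)) (yes (r , αr , rr)) with z∉U
          ... | z , αz , uz with ∨-false⁻ (Y z) uz
          ...   | yz , zz with h-parity L M Y Z
          ...     | x , par = k+k≢1+x+x k x (+-cancelˡ-≡ K K (suc (x + x)) (trans (sym (cong₂ _+_ hP hQ)) (trans par (trans (cong (_+ (x + x)) hY≡) (sym (+-suc K (x + x)))))))
            where
            sP : Sep P
            sP = sep αp pp αz (∧-falseˡ yz)
            sR : Sep R
            sR = sep αr rr αz (∧-falseˡ zz)
            one : 1 ≤ m Q
            one = count-≥1 _ e∈ (∧-true ye ze)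
            hPR : H P + H R ≤ K + K
            hPR = cancel-≤′ (≤-trans (h-∖∖ L M Y Z) (≤-trans sumYZ (≤-reflexive (trans (cong suc (+-suc K K)) (+-comm 2 (K + K)))))) (+-mono-≤ one one)
            hP : H P ≡ K
            hP = ≤-antisym (cancel-≤′ hPR (good _ sR)) (good _ sP)
            hQ : H Q ≡ K
            hQ = ≤-antisym (proj₂ tQ) (good _ sQ)
          -- The terminals of `Y` now all lie in `Q`, so `merge` yields a tight set containing both
          -- p and e. It shares e with `Z`, and adding it to `Z` gains p, against maximality of `Z`.
          -- The case without terminals in `R` enlarges `Y` in the same way.
          contra (no noP) _ with someP
          ... | p , p∈ , pp with ∧-true⁻ (Y (end p)) pp
          ...   | yp , nzp with tight p∈
          ...     | X , tX , xp = growsZ (proj₁ (proj₂ (dangerous-∪ tT dZ e∈ (∨-trueʳ (X (end e) ∧ Y (end e)) (∧-true ye ze)) ze)))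
              (λ x → ∨-trueʳ ((((X ∩ᵇ Y) ∪ᵇ Q)) x)) p∈ (not-true⁻ (Z (end p)) nzp)
              (∨-trueˡ (∨-trueˡ (∧-true xp yp)))
            where
            tT : Tight L M ((X ∩ᵇ Y) ∪ᵇ Q)
            tT = merge (λ x → ∨-trueˡ) tQ sU inQ (tight-∩-max tX dZ cZ p∈ xp yp)
              where
              inQ : ∀ {a} → A a → Y a ≡ true → Q a ≡ true
              inQ {a} αa ya with Z a in za
              ... | true  = ∧-true ya refl
              ... | false = ⊥-elim (noP (a , αa , ∧-true ya (not-true za)))
          contra (yes _) (no noR) with tight j∈
          ... | X , tX , xj = grows (proj₁ (proj₂ (dangerous-∪ tT dY e∈ (∨-trueʳ (X (end e) ∧ Z (end e)) (∧-true ye ze)) ye)))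
              (λ x → ∨-trueʳ ((((X ∩ᵇ Z) ∪ᵇ Q)) x)) j∈ yj (∨-trueˡ (∨-trueˡ (∧-true xj zj)))
            where
            tT : Tight L M ((X ∩ᵇ Z) ∪ᵇ Q)
            tT = merge (λ x → ∨-trueʳ (Y x)) tQ sU inQ (tight-∩-crossing tX dZ cZ j∈ xj zj)
              where
              inQ : ∀ {a} → A a → Z a ≡ true → Q a ≡ true
              inQ {a} αa za with Y a in ya
              ... | true  = za
              ... | false = ⊥-elim (noR (a , αa , ∧-true za (not-true ya)))

        -- With `¬both`, the two differences are what separates. The values of `Y` and `Z` add up to
        -- at most 2`K`+2, those of `P` and `R` to at least 2`K`, and the half-edges in `Q` count
        -- twice: all of this is equality, so `P` and `R` are tight and e is the only half-edge in
        -- `Q`.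
        starOf : Split L M
        starOf with uncross Y Z (proj₁ dY) (proj₁ dZ)
        ... | inj₁ (sQ , sU) = ⊥-elim (¬both sQ sU)
        ... | inj₂ (sP , sR) = result
          where
          one : 1 ≤ m Q
          one = count-≥1 _ e∈ (∧-true ye ze)
          all≤ : (H P + H R) + (m Q + m Q) ≤ (K + K) + 2
          all≤ = ≤-trans (h-∖∖ L M Y Z) (≤-trans sumYZ (≤-reflexive (trans (cong suc (+-suc K K)) (+-comm 2 (K + K)))))
          hPR : H P + H R ≤ K + K
          hPR = cancel-≤′ all≤ (+-mono-≤ one one)
          tP : Tight L M P
          tP = sP , cancel-≤′ hPR (good _ sR)
          tR : Tight L M R
          tR = sR , cancel-≤ hPR (good _ sP)
          mQ≡1 : m Q ≡ 1
          mQ≡1 = ≤-antisym (≮⇒≥ (λ two → <⇒≱ (+-mono-≤ two one) (cancel-≤ all≤ (+-mono-≤ (good _ sP) (good _ sR))))) one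
          -- A tight set around e remains tight after intersecting with `Y` and then with `Z`. Being
          -- separating, what remains has a terminal, and it lies inside `Q`.
          hubSet : ∃ λ q → A q × Q q ≡ true
          hubSet with tight e∈
          ... | X , tX , xe with tight-∩-crossing (tight-∩-max tX dZ cZ e∈ xe ye) dZ cZ e∈ (∧-true xe ye) ze
          ...   | ((q , αq , xq) , _) , _ with ∧-true⁻ (X q ∧ Y q) xq
          ...     | xyq , zq = q , αq , ∧-true (proj₂ (∧-true⁻ (X q) xyq)) zq
          -- A terminal outside `U` together with the one in `Q` would make `Q` and `U` both
          -- separating.
          covered : ∀ {a} → A a → U a ≡ true
          covered {z} αz with U z in uz | hubSet
          ... | true  | _ = refl
          ... | false | q , αq , qq = ⊥-elim (¬both (sep αq qq αz (∧-falseˡ (proj₁ (∨-false⁻ (Y z) uz))))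
                                                (sep αq (∨-trueˡ (proj₁ (∧-true⁻ (Y q) qq))) αz uz))
          full : ∀ {c} → c ∈ˡ M → U (end c) ≡ true
          full {c} c∈ with U (end c) in uc
          ... | true  = refl
          ... | false = ⊥-elim (contra (tight c∈))
            where
            yc : Y (end c) ≡ false
            yc = proj₁ (∨-false⁻ (Y (end c)) uc)
            zc : Z (end c) ≡ false
            zc = proj₂ (∨-false⁻ (Y (end c)) uc)
            contra : (∃ λ S → Tight L M S × S (end c) ≡ true) → ⊥
            contra (X , tX@(sX , hX) , xc) with uncross X Y sX (proj₁ dY) | uncross X Z sX (proj₁ dZ)
            ... | inj₁ (s∩ , s∪) | _ = noY s∩ s∪
              where
              noY : Sep (X ∩ᵇ Y) → Sep (X ∪ᵇ Y) → ⊥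
              noY s∩ s∪ = grows (s∪ , cancel-≤′ (≤-trans (h-∪∩ L M X Y) (≤-trans (+-mono-≤ hX (proj₂ dY)) (≤-reflexive (+-comm K (suc K))))) (good _ s∩))
                (λ x → ∨-trueʳ (X x)) c∈ yc (∨-trueˡ xc)
            ... | inj₂ _ | inj₁ (s∩ , s∪) = noZ s∩ s∪
              where
              noZ : Sep (X ∩ᵇ Z) → Sep (X ∪ᵇ Z) → ⊥
              noZ s∩ s∪ = growsZ (s∪ , cancel-≤′ (≤-trans (h-∪∩ L M X Z) (≤-trans (+-mono-≤ hX (proj₂ dZ)) (≤-reflexive (+-comm K (suc K))))) (good _ s∩))
                (λ x → ∨-trueʳ (X x)) c∈ zc (∨-trueˡ xc)
            -- Here `X` has a terminal a₁ in `R` and a terminal a₂ in `P`. A terminal b outside `X`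
            -- cannot lie in `P`, or `Z` could be enlarged by `X`. So `X ∪ᵇ P` is tight; it shares p
            -- with `Y`, and `Y` could be enlarged by c.
            ... | inj₂ (((a₁ , α₁ , x₁) , _) , _) | inj₂ (((a₂ , α₂ , x₂) , _) , _) with ∧-true⁻ (X a₁) x₁ | ∧-true⁻ (X a₂) x₂ | proj₂ sX | someP
            ...   | xa₁ , nya₁ | xa₂ , nza₂ | b , αb , xb | p , p∈ , pp = grows (proj₁ (proj₂ (dangerous-∪ tXP dY p∈ (∨-trueʳ (X (end p)) pp) (proj₁ (∧-true⁻ (Y (end p)) pp)))))
                    (λ x → ∨-trueʳ ((X ∪ᵇ P) x)) c∈ yc (∨-trueˡ (∨-trueˡ xc))
              where
              ya₁ : Y a₁ ≡ false
              ya₁ = not-true⁻ (Y a₁) nya₁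
              za₂ : Z a₂ ≡ false
              za₂ = not-true⁻ (Z a₂) nza₂
              za₁ : Z a₁ ≡ true
              za₁ with Y a₁ | ya₁ | covered α₁
              ... | false | refl | u = u
              ya₂ : Y a₂ ≡ true
              ya₂ with Y a₂ | Z a₂ | za₂ | covered α₂
              ... | true | false | refl | u = refl
              noZ : Sep (X ∩ᵇ Z) → Sep (X ∪ᵇ Z) → ⊥
              noZ s∩ s∪ = growsZ (s∪ , cancel-≤′ (≤-trans (h-∪∩ L M X Z) (≤-trans (+-mono-≤ hX (proj₂ dZ)) (≤-reflexive (+-comm K (suc K))))) (good _ s∩))
                (λ x → ∨-trueʳ (X x)) c∈ zc (∨-trueˡ xc)
              Pb : P b ≡ false
              Pb with Y b in yb | Z b in zb
              ... | false | _     = refl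
              ... | true  | true  = refl
              ... | true  | false = ⊥-elim (noZ (sep α₁ (∧-true xa₁ za₁) αb (∧-falseˡ xb)) (sep α₁ (∨-trueˡ xa₁) αb (∨-false xb zb)))
              tXP : Tight L M (X ∪ᵇ P)
              tXP = tight-∪ tX tP
                (sep α₂ (∧-true xa₂ (∧-true ya₂ (not-true za₂))) α₁ (∧-falseʳ (X a₁) (∧-falseˡ ya₁)))
                (sep α₂ (∨-trueˡ xa₂) αb (∨-false xb Pb))
          mY : m Y ≡ m P + 1
          mY = trans (μ-split M Y Z) (cong (m P +_) mQ≡1)
          total : (m P + 1) + m R ≡ length M
          total = trans (cong (_+ m R) (sym mY)) (trans
            (count-eq (Y ∘ end) (R ∘ end) (U ∘ end) (const false) M λ i → ≡ᵇ⇒≡ _ _ (every₂-elim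
              (λ a b → (b2n a + b2n (b ∧ not a)) ≡ᵇ (b2n (a ∨ b) + 0)) tt (Y (end i)) (Z (end i))))
            (trans (cong (λ n → m U + (n + n)) (count-none (const false) M (λ _ → refl)))
            (trans (+-identityʳ (m U)) (count-full (U ∘ end) M full))))
          -- This is `half-bound` for `Y`, which holds `m P + 1` of the `(m P + 1) + m R` half-edges
          -- and has value at most `K`+1. The opposite inequality came from maximality of `Y`.
          mP≤mR : m P ≤ m R
          mP≤mR = +-cancelˡ-≤ (m P + 2) (m P) (m R) (≤-trans (≤-reflexive (lem (m P))) (≤-trans
            (≤-trans (cancel-≤ {K} {(m P + 1) + (m P + 1)} {K} {1 + length M}
              (≤-trans (≤-reflexive (cong (λ n → K + (n + n)) (sym mY))) (≤-trans (half-bound {L} {M} good Y (proj₁ dY))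
                (≤-trans (+-monoˡ-≤ (length M) (proj₂ dY)) (≤-reflexive (sym (+-suc K (length M))))))) ≤-refl)
              (≤-reflexive (cong suc (sym total)))) (≤-reflexive (lem′ (m P) (m R)))))
            where
            open +-*-Solver
            lem : ∀ a → (a + 2) + a ≡ (a + 1) + (a + 1)
            lem = solve 1 (λ a → (a :+ con 2) :+ a := (a :+ con 1) :+ (a :+ con 1)) refl
            lem′ : ∀ a b → 1 + ((a + 1) + b) ≡ (a + 2) + b
            lem′ = solve 2 (λ a b → con 1 :+ ((a :+ con 1) :+ b) := (a :+ con 2) :+ b) refl
          mP≡mR : m P ≡ m R
          mP≡mR = ≤-antisym mP≤mR mR≤mP
          pRemoved : ∀ {M′} S → M ↭ e ∷ M′ → S (end e) ≡ false → m S ≡ μ M′ S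
          pRemoved {M′} S σ se = trans (count-↭ _ σ) (cong (λ b → b2n b + μ M′ S) se)
          Pe : P (end e) ≡ false
          Pe = ∧-falseʳ (Y (end e)) (not-false ze)
          Re : R (end e) ≡ false
          Re = ∧-falseʳ (Z (end e)) (not-false ye)
          result : Split L M
          result with ∈⇒↭ e∈ | hubSet | m R in eqR | mR≥1
          ... | M′ , σ | q , αq , qq | suc n | _ = star σ
            (record
              { good = Good-↭ {L} {L} ↭-refl σ good
              ; P = P ; R = R
              ; tightP = proj₁ tP , subst (_≤ K) (h-↭ {L} ↭-refl σ P) (proj₂ tP)
              ; tightR = proj₁ tR , subst (_≤ K) (h-↭ {L} ↭-refl σ R) (proj₂ tR)
              ; e∉P = Pe ; e∉R = Re
              ; opposite = λ {i} i∈ → opposite (Y (end i)) (Z (end i)) (full (∈-resp-↭ (↭-sym σ) (there i∈))) (offQ i∈)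
              ; sizeP = trans (sym (pRemoved P σ Pe)) (trans mP≡mR eqR)
              ; sizeR = trans (sym (pRemoved R σ Re)) eqR })
            (inP (proj₁ sP)) (inR (proj₁ sR)) (q , αq , outP , outR)
            where
            opposite : ∀ a b → a ∨ b ≡ true → a ∧ b ≡ false → b ∧ not a ≡ not (a ∧ not b)
            opposite true  false _ _ = refl
            opposite false true  _ _ = refl
            offQ : ∀ {i} → i ∈ˡ M′ → Q (end i) ≡ false
            offQ = count-zero (Q ∘ end) (≤-reflexive (suc-injective (trans
              (cong (λ b → b2n b + μ M′ Q) (sym (∧-true ye ze))) (trans (sym (count-↭ _ σ)) mQ≡1))))
            outP : P q ≡ false
            outP = ∧-falseʳ (Y q) (not-false (proj₂ (∧-true⁻ (Y q) qq)))
            outR : R q ≡ false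
            outR = ∧-falseʳ (Z q) (not-false (proj₁ (∧-true⁻ (Y q) qq)))
            inP : (∃ λ p → A p × P p ≡ true) → ∃ λ p → A p × P p ≡ true × R p ≡ false
            inP (p , αp , pp) = p , αp , pp , ∧-falseʳ (Z p) (not-false (proj₁ (∧-true⁻ (Y p) pp)))
            inR : (∃ λ r → A r × R r ≡ true) → ∃ λ r → A r × P r ≡ false × R r ≡ true
            inR (r , αr , rr) = r , αr , ∧-falseʳ (Y r) (not-false (proj₁ (∧-true⁻ (Z r) rr))) , rr

  -- Take a dangerous `Y` with the most half-edges. If no dangerous set crosses it, `lift` cannot
  -- fail on a pair across `Y`, since the obstruction would contain one half-edge from each side.
  -- Otherwise a crossing set with the most half-edges leads to the star.
  split : ∀ {L M} → Good L M → (∀ {i} → i ∈ˡ M → ∃ λ S → Tight L M S × S (end i) ≡ true) →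
    (∃ λ i → i ∈ˡ M) → Split L M
  split {L} {M} good tight (i , i∈)
    with tight i∈
  ... | X , (sX , tX) , xi with maximum em (Dangerous L M) (μ M) (length M) (λ S _ → count≤length _ M) X (sX , ≤-trans tX (n≤1+n K))
  ...   | Y , dY , maxY with em {∃ λ Z → Dangerous L M Z × Crosses M Y Z}
  ...     | yes (Z₀ , z₀) with maximum em (λ Z → Dangerous L M Z × Crosses M Y Z) (μ M) (length M) (λ S _ → count≤length _ M) Z₀ z₀
  ...       | Z , (dZ , cZ) , maxZ = starOf good tight Y dY maxY Z dZ cZ maxZ
  split {L} {M} good tight (i , i∈) | X , (sX , tX) , xi | Y , dY , maxY | no none =
    cross Y (count-exists _ M 1≤mY) outside liftable
    where
    1≤mX : 1 ≤ μ M X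
    1≤mX = count-≥1 _ i∈ xi
    1≤mY : 1 ≤ μ M Y
    1≤mY = ≤-trans 1≤mX (maxY X (sX , ≤-trans tX (n≤1+n K)))
    2≤d : 2 ≤ length M
    2≤d = cancel-≤ {K} {2} {K} (≤-trans (+-monoʳ-≤ K (+-mono-≤ 1≤mX 1≤mX)) (≤-trans (half-bound {L} {M} good X sX) (+-monoˡ-≤ (length M) tX))) ≤-refl
    outside : ∃ λ j → j ∈ˡ M × Y (end j) ≡ false
    outside with em {∃ λ j → j ∈ˡ M × Y (end j) ≡ false}
    -- If `Y` held all d half-edges, `half-bound` would give 2d ≤ d+1, whereas d ≥ 2 because a tight
    -- set with one half-edge holds at most half of them.
    ... | yes o = o
    ... | no out = ⊥-elim (<⇒≱ 2≤d (cancel-≤ {K + length M} {length M} {K + length M} {1} bound ≤-refl))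
      where
      full : μ M Y ≡ length M
      full = count-full _ M λ {j} j∈ → in′ j∈
        where
        in′ : ∀ {j} → j ∈ˡ M → Y (end j) ≡ true
        in′ {j} j∈ with Y (end j) in yj
        ... | true  = refl
        ... | false = ⊥-elim (out (j , j∈ , yj))
      bound : (K + length M) + length M ≤ (K + length M) + 1
      bound = ≤-trans (≤-reflexive (trans (+-assoc K (length M) (length M)) (cong (λ n → K + (n + n)) (sym full))))
        (≤-trans (half-bound {L} {M} good Y (proj₁ dY)) (≤-trans (+-monoˡ-≤ (length M) (proj₂ dY)) (≤-reflexive (+-comm 1 (K + length M)))))
    liftable : ∀ {i j M′} → M ↭ i ∷ j ∷ M′ → Y (end i) ≡ true → Y (end j) ≡ false → Good ((end i , end j) ∷ L) M′
    liftable {i} {j} {M′} σ yi yj with lift {L} {M′} i j (Good-↭ {L} {L} ↭-refl σ good)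
    ... | inj₁ g = g
    ... | inj₂ (Z , (sZ , hZ) , zi , zj) = ⊥-elim (none (Z , (sZ , subst (_≤ suc K) (sym (h-↭ {L} ↭-refl σ Z)) hZ) ,
        (i , ∈-resp-↭ (↭-sym σ) (here refl) , yi , zi) , (j , ∈-resp-↭ (↭-sym σ) (there (here refl)) , yj , zj)))

  reduce : ∀ {L M} → Good L M →
    (∃₂ λ i M′ → M ↭ i ∷ M′ × Good L M′) ⊎ (∀ {i} → i ∈ˡ M → ∃ λ S → Tight L M S × S (end i) ≡ true)
  reduce {L} {M} good with em {∃₂ λ i M′ → M ↭ i ∷ M′ × Good L M′}
  ... | yes d = inj₁ d
  ... | no none = inj₂ tight
    where
    tight : ∀ {i} → i ∈ˡ M → ∃ λ S → Tight L M S × S (end i) ≡ true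
    tight {i} i∈ with ∈⇒↭ i∈
    ... | M′ , σ with delete {L} {M′} i (Good-↭ {L} {L} ↭-refl σ good)
    ...   | inj₁ g = ⊥-elim (none (i , M′ , σ , g))
    ...   | inj₂ (S , (s , t) , si) = S , (s , subst (_≤ K) (sym (h-↭ {L} ↭-refl σ S)) t) , si

  h-lift : ∀ L M p r S → S (end p) xor S (end r) ≡ true → h ((end p , end r) ∷ L) M S ≡ h L (p ∷ r ∷ M) S
  h-lift L M p r S e with S (end p) | S (end r)
  ... | true  | false = sym (+-suc (cut L S) (μ M S))
  ... | false | true  = sym (+-suc (cut L S) (μ M S))

  -- Otherwise P, R and a dangerous set containing p and r would have a dangerous union holding all half-edges but one.
  lift-star : ∀ {L e M n p r M′} → (s : Star L e M (suc (suc n))) → M ↭ p ∷ r ∷ M′ →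
    Star.P s (end p) ≡ true → Star.P s (end r) ≡ false → Star ((end p , end r) ∷ L) e M′ (suc n)
  lift-star {L} {e} {M} {n} {p} {r} {M′} s σ pp pr = record
    { good = good′
    ; P = P ; R = R
    ; tightP = proj₁ tightP , ≤-trans (≤-reflexive (lifted P (cong₂ _xor_ pp pr))) (proj₂ tightP)
    ; tightR = proj₁ tightR , ≤-trans (≤-reflexive (lifted R (cong₂ _xor_ rp rr))) (proj₂ tightR)
    ; e∉P = e∉P ; e∉R = e∉R
    ; opposite = λ i∈ → opposite (∈-resp-↭ (↭-sym σ) (there (there i∈)))
    ; sizeP = suc-injective (trans (sym (trans (count-↭ _ σ) (cong₂ (λ a b → b2n a + (b2n b + μ M′ P)) pp pr))) sizeP)
    ; sizeR = suc-injective (trans (sym (trans (count-↭ _ σ) (cong₂ (λ a b → b2n a + (b2n b + μ M′ R)) rp rr))) sizeR)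
    }
    where
    open Star s
    p∈ : p ∈ˡ M
    p∈ = ∈-resp-↭ (↭-sym σ) (here refl)
    r∈ : r ∈ˡ M
    r∈ = ∈-resp-↭ (↭-sym σ) (there (here refl))
    rp : R (end p) ≡ false
    rp = trans (opposite p∈) (cong not pp)
    rr : R (end r) ≡ true
    rr = trans (opposite r∈) (cong not pr)
    τ : e ∷ M ↭ p ∷ r ∷ e ∷ M′
    τ = ↭-trans (prep e σ) (↭-trans (swap e p ↭-refl) (prep p (swap e r ↭-refl)))
    lifted : ∀ S → S (end p) xor S (end r) ≡ true → h ((end p , end r) ∷ L) (e ∷ M′) S ≡ h L (e ∷ M) S
    lifted S x = trans (h-lift L (e ∷ M′) p r S x) (sym (h-↭ {L} ↭-refl τ S))
    size : length M ≡ suc (suc n) + suc (suc n)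
    size = trans (sym (μ-co M P)) (cong₂ _+_ sizeP (trans (count-cong M (λ i∈ → sym (opposite i∈))) sizeR))
    good′ : Good ((end p , end r) ∷ L) (e ∷ M′)
    good′ with lift {L} {e ∷ M′} p r (Good-↭ {L} {L} ↭-refl τ good)
    ... | inj₁ g = g
    ... | inj₂ (Y , (sY , hY) , yp , yr) = ⊥-elim (contra (proj₁ (proj₂ (dangerous-∪ {L} {e ∷ M} good tightR
        (proj₁ (proj₂ (dangerous-∪ {L} {e ∷ M} good tightP (sY , subst (_≤ suc K) (sym (h-↭ {L} ↭-refl τ Y)) hY) (there p∈) pp yp)))
        (there r∈) rr (∨-trueʳ (P (end r)) yr)))))
      where
      contra : Dangerous L (e ∷ M) (R ∪ᵇ (P ∪ᵇ Y)) → ⊥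
      contra (sU , hU) = <⇒≱ 2<len (cancel-≤ {K + length M} {length M} {K + length M} {2} bound ≤-refl)
        where
        inU : ∀ {i} → i ∈ˡ M → (R ∪ᵇ (P ∪ᵇ Y)) (end i) ≡ true
        inU {i} i∈ with P (end i) | R (end i) | opposite i∈
        ... | true  | false | _ = refl
        ... | false | true  | _ = refl
        len≤ : length M ≤ μ (e ∷ M) (R ∪ᵇ (P ∪ᵇ Y))
        len≤ = ≤-trans (≤-reflexive (sym (count-full _ M inU))) (m≤n+m _ (b2n ((R ∪ᵇ (P ∪ᵇ Y)) (end e))))
        bound : (K + length M) + length M ≤ (K + length M) + 2
        bound = ≤-trans (≤-reflexive (+-assoc K (length M) (length M)))
          (≤-trans (+-monoʳ-≤ K (+-mono-≤ len≤ len≤))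
          (≤-trans (half-bound {L} {e ∷ M} good (R ∪ᵇ (P ∪ᵇ Y)) sU)
          (≤-trans (+-monoˡ-≤ (suc (length M)) hU) (≤-reflexive (trans (cong suc (+-suc K (length M))) (+-comm 2 (K + length M)))))))
        2<len : 2 < length M
        2<len = ≤-trans (s≤s (s≤s (≤-trans (s≤s z≤n) (m≤n+m (suc (suc n)) n)))) (≤-reflexive (sym size))

  star-swap : ∀ {L e M n} → Star L e M n → Star L e M n
  star-swap s = record
    { good = good ; P = R ; R = P ; tightP = tightR ; tightR = tightP ; e∉P = e∉R ; e∉R = e∉P
    ; opposite = λ i∈ → trans (sym (not-involutive _)) (cong not (sym (opposite i∈)))
    ; sizeP = sizeR ; sizeR = sizeP }
    where open Star s

  star-pair : ∀ {L e p r M} → (s : Star L e (p ∷ r ∷ M) 1) → Star.P s (end p) ≡ true → Star.P s (end r) ≡ false → M ≡ []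
  star-pair {M = []} s pp pr = refl
  star-pair {p = p} {r} {M = i ∷ M} s pp pr
    with P (end p) | P (end r) | R (end p) | R (end r) | P (end i) | R (end i)
       | opposite (here refl) | opposite (there (here refl)) | opposite (there (there (here refl))) | sizeP | sizeR
    where open Star s
  star-pair s refl refl | _ | _ | _ | _ | true  | _    | _    | _    | _ | () | _
  star-pair s refl refl | _ | _ | _ | _ | false | true | refl | refl | _ | _  | ()

  -- Turning half-edges into edges at a named vertex brings back the sets that contain it; their
  -- complements avoid it and have the same crossing edges.
  attach : ∀ {L M} → Good L M → ∀ x S → Sep S → K ≤ count (crosses S) (map (λ i → end i , x) M ++ L)
  attach {L} {M} good x S s = ≤-trans (both (S x) refl) (≤-reflexive (sym (trans (count-++ (crosses S) (map (λ i → end i , x) M) L)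
      (cong (_+ cut L S) (count-map _ _ M)))))
    where
    both : ∀ b → S x ≡ b → K ≤ count (λ i → S (end i) xor S x) M + cut L S
    both false e = ≤-trans (good S s) (≤-reflexive (trans (+-comm (cut L S) (μ M S)) (cong (_+ cut L S)
      (count-cong M λ {i} _ → sym (trans (cong (S (end i) xor_) e) (xor-identityʳ _))))))
    both true e = ≤-trans (good (co S) (Sep-co s)) (≤-reflexive (trans (+-comm (cut L (co S)) (μ M (co S))) (cong₂ _+_
      (count-cong M λ {i} _ → sym (trans (cong (S (end i) xor_) e) (xor-true (S (end i)))))
      (cut-co L S))))
      where
      xor-true : ∀ b → b xor true ≡ not b
      xor-true true  = refl
      xor-true false = refl

  star-↭ : ∀ {L e M M′ n} → M ↭ M′ → Star L e M n → Star L e M′ n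
  star-↭ {L} {e} σ s = record
    { good = Good-↭ {L} {L} ↭-refl (prep e σ) good ; P = P ; R = R
    ; tightP = proj₁ tightP , subst (_≤ K) (h-↭ {L} ↭-refl (prep e σ) P) (proj₂ tightP)
    ; tightR = proj₁ tightR , subst (_≤ K) (h-↭ {L} ↭-refl (prep e σ) R) (proj₂ tightR)
    ; e∉P = e∉P ; e∉R = e∉R ; opposite = λ i∈ → opposite (∈-resp-↭ (↭-sym σ) i∈)
    ; sizeP = trans (sym (count-↭ _ σ)) sizeP ; sizeR = trans (sym (count-↭ _ σ)) sizeR }
    where open Star s

-- Walks and routes

module Walks {V E : Set} (G : Multigraph V E) where
  open Multigraph G

  private
    _⟶_ : V → V → Set
    _⟶_ = Walk G
    ve : ∀ {u v} → u ⟶ v → List V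
    ve = walkVertices G
    ed : ∀ {u v} → u ⟶ v → List E
    ed = walkEdges G

  Joins-sym : ∀ {e u v} → Joins G e u v → Joins G e v u
  Joins-sym (inj₁ x) = inj₂ x
  Joins-sym (inj₂ x) = inj₁ x

  infixr 5 _⊙_

  _⊙_ : ∀ {u v w} → u ⟶ v → v ⟶ w → u ⟶ w
  stop       ⊙ q = q
  step e j p ⊙ q = step e j (p ⊙ q)

  ⊙-edges : ∀ {u v w} (p : u ⟶ v) (q : v ⟶ w) {e} → e ∈ˡ ed (p ⊙ q) → e ∈ˡ ed p ⊎ e ∈ˡ ed q
  ⊙-edges stop         q i = inj₂ i
  ⊙-edges (step e j p) q (here refl) = inj₁ (here refl)
  ⊙-edges (step e j p) q (there i) with ⊙-edges p q i
  ... | inj₁ k = inj₁ (there k)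
  ... | inj₂ k = inj₂ k

  reverse : ∀ {u v} → u ⟶ v → v ⟶ u
  reverse stop         = stop
  reverse (step e j p) = reverse p ⊙ step e (Joins-sym j) stop

  reverse-edges : ∀ {u v} (p : u ⟶ v) → ed (reverse p) ⊆ˡ ed p
  reverse-edges (step e j p) i with ⊙-edges (reverse p) (step e (Joins-sym j) stop) i
  ... | inj₁ k = there (reverse-edges p k)
  ... | inj₂ (here refl) = here refl

  first∈ : ∀ {u v} (p : u ⟶ v) → u ∈ˡ ve p
  first∈ stop         = here refl
  first∈ (step e j p) = here refl

  last∈ : ∀ {u v} (p : u ⟶ v) → v ∈ˡ ve p
  last∈ stop         = here refl
  last∈ (step e j p) = there (last∈ p)

  edge-ends : ∀ {u v} (p : u ⟶ v) {e} → e ∈ˡ ed p → end₁ e ∈ˡ ve p × end₂ e ∈ˡ ve p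
  edge-ends (step e (inj₁ (refl , refl)) p) (here refl) = here refl , there (first∈ p)
  edge-ends (step e (inj₂ (refl , refl)) p) (here refl) = there (first∈ p) , here refl
  edge-ends (step e j p) (there i) with edge-ends p i
  ... | a , b = there a , there b

  ⊙-vertices : ∀ {u v w} (p : u ⟶ v) (q : v ⟶ w) {x} → x ∈ˡ ve (p ⊙ q) → x ∈ˡ ve p ⊎ x ∈ˡ ve q
  ⊙-vertices stop         q i = inj₂ i
  ⊙-vertices (step e j p) q (here refl) = inj₁ (here refl)
  ⊙-vertices (step e j p) q (there i) with ⊙-vertices p q i
  ... | inj₁ k = inj₁ (there k)
  ... | inj₂ k = inj₂ k

  reverse-vertices : ∀ {u v} (p : u ⟶ v) → ve (reverse p) ⊆ˡ ve p
  reverse-vertices stop i = i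
  reverse-vertices (step e j p) i with ⊙-vertices (reverse p) (step e (Joins-sym j) stop) i
  ... | inj₁ k = there (reverse-vertices p k)
  ... | inj₂ (here refl) = there (first∈ p)
  ... | inj₂ (there (here refl)) = here refl

  suffix : ∀ {u v} (p : u ⟶ v) → Unique (ve p) → ∀ {x} → x ∈ˡ ve p →
    ∃ λ (q : Path G x v) → Path.edges q ⊆ˡ ed p × Path.vertices q ⊆ˡ ve p
  suffix stop         s (here refl) = record { walk = stop ; simple = s } , id , id
  suffix (step e j p) s (here refl) = record { walk = step e j p ; simple = s } , id , id
  suffix (step e j p) (_ ∷ s) (there i) with suffix p s i
  ... | q , a , b = q , there ∘ a , there ∘ b

  module _ (em : ExcludedMiddle 0ℓ) where

    simplify : ∀ {u v} (w : u ⟶ v) → ∃ λ (p : Path G u v) → Path.edges p ⊆ˡ ed w × Path.vertices p ⊆ˡ ve w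
    simplify stop = record { walk = stop ; simple = [] ∷ [] } , id , id
    simplify {u} (step e j w) with simplify w
    ... | p , a , b with em {u ∈ˡ Path.vertices p}
    ...   | yes i with suffix (Path.walk p) (Path.simple p) i
    ...     | q , a′ , b′ = q , there ∘ a ∘ a′ , there ∘ b ∘ b′
    simplify {u} (step e j w) | p , a , b | no u∉ =
      record { walk = step e j (Path.walk p) ; simple = All.tabulate (λ i eq → u∉ (subst (_∈ˡ _) (sym eq) i)) ∷ Path.simple p }
      , (λ { (here r) → here r ; (there i) → there (a i) })
      , (λ { (here r) → here r ; (there i) → there (b i) })

    module SameComponents (A : Pred V 0ℓ) where

      walk⇒same : ∀ {u v} (w : u ⟶ v) → (∀ {x} → x ∈ˡ ve w → x ∉ A) → SameComponent G A u v
      walk⇒same w out with simplify w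
      ... | p , _ , b = p , All.tabulate (λ i → out (b i))

      same-refl : ∀ {u} → u ∉ A → SameComponent G A u u
      same-refl u∉ = walk⇒same stop λ { (here refl) → u∉ }

      same-sym : ∀ {u v} → SameComponent G A u v → SameComponent G A v u
      same-sym (p , out) = walk⇒same (reverse (Path.walk p)) λ i → All.lookup out (reverse-vertices (Path.walk p) i)

      same-trans : ∀ {u v w} → SameComponent G A u v → SameComponent G A v w → SameComponent G A u w
      same-trans (p , out) (q , out′) = walk⇒same (Path.walk p ⊙ Path.walk q) λ i → go (⊙-vertices (Path.walk p) (Path.walk q) i)
        where
        go : ∀ {x} → x ∈ˡ ve (Path.walk p) ⊎ x ∈ˡ ve (Path.walk q) → x ∉ A
        go (inj₁ i) = All.lookup out i
        go (inj₂ i) = All.lookup out′ i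

      same-end : ∀ {u v} → SameComponent G A u v → v ∉ A
      same-end (p , out) = All.lookup out (last∈ (Path.walk p))

      same-step : ∀ {e u v} → Joins G e u v → u ∉ A → v ∉ A → SameComponent G A u v
      same-step j u∉ v∉ = walk⇒same (step _ j stop) λ { (here refl) → u∉ ; (there (here refl)) → v∉ }

  record Route : Set where
    constructor route
    field
      {src dst} : V
      path      : Path G src dst

    edges : List E
    edges = Path.edges path

  ends : Route → (V ⊎ V) × (V ⊎ V)
  ends ρ = inj₁ (Route.src ρ) , inj₁ (Route.dst ρ)

  DisjointRoutes : Route → Route → Set
  DisjointRoutes ρ σ = Disjoint (Route.edges ρ) (Route.edges σ)

  DisjointRoutes-sym : ∀ {ρ σ} → DisjointRoutes ρ σ → DisjointRoutes σ ρ
  DisjointRoutes-sym d (x , y) = d (y , x)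

  single : E → Route
  single e = route {src = end₁ e} {dst = end₂ e}
    (record { walk = step e (inj₁ (refl , refl)) stop ; simple = (loopless e ∷ []) ∷ [] ∷ [] })

  single-disjoint : ∀ {e f} → e ≢ f → DisjointRoutes (single e) (single f)
  single-disjoint ne (here refl , here refl) = ne refl

  used : List Route → List E
  used = concatMap Route.edges

  ∈-used⁺ : ∀ {e ρ ρs} → ρ ∈ˡ ρs → e ∈ˡ Route.edges ρ → e ∈ˡ used ρs
  ∈-used⁺ (here refl) e∈ = ∈-++⁺ˡ e∈
  ∈-used⁺ {ρs = ρ ∷ _} (there i) e∈ = ∈-++⁺ʳ (Route.edges ρ) (∈-used⁺ i e∈)

  ∈-used⁻ : ∀ {e} ρs → e ∈ˡ used ρs → ∃ λ ρ → ρ ∈ˡ ρs × e ∈ˡ Route.edges ρ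
  ∈-used⁻ (ρ ∷ ρs) e∈ with ∈-++⁻ (Route.edges ρ) e∈
  ... | inj₁ x = ρ , here refl , x
  ... | inj₂ x with ∈-used⁻ ρs x
  ...   | σ , σ∈ , y = σ , there σ∈ , y

AllPairs-↭ : {X : Set} {R : X → X → Set} → (∀ {x y} → R x y → R y x) →
  ∀ {xs ys} → xs ↭ ys → AllPairs R xs → AllPairs R ys
AllPairs-↭ s refl ps = ps
AllPairs-↭ s (prep x σ) (p ∷ ps) = All-resp-↭ σ p ∷ AllPairs-↭ s σ ps
AllPairs-↭ s (swap x y σ) ((r ∷ p) ∷ q ∷ ps) = (s r ∷ All-resp-↭ σ q) ∷ All-resp-↭ σ p ∷ AllPairs-↭ s σ ps
AllPairs-↭ s (_↭_.trans σ τ) ps = AllPairs-↭ s τ (AllPairs-↭ s σ ps)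

Unique-↭ : {X : Set} {xs ys : List X} → xs ↭ ys → Unique xs → Unique ys
Unique-↭ = AllPairs-↭ (λ ne → ne ∘ sym)

AllPairs-lookup : {X : Set} {R : X → X → Set} → (∀ {x y} → R x y → R y x) →
  ∀ {xs} → AllPairs R xs → ∀ i j → i ≢ j → R (lookup xs i) (lookup xs j)
AllPairs-lookup s (p ∷ ps) zero    zero    ne = ⊥-elim (ne refl)
AllPairs-lookup s (p ∷ ps) zero    (suc j) ne = All.lookup p (∈-lookup j)
AllPairs-lookup s (p ∷ ps) (suc i) zero    ne = s (All.lookup p (∈-lookup i))
AllPairs-lookup s (p ∷ ps) (suc i) (suc j) ne = AllPairs-lookup s ps i j (ne ∘ cong suc)

-- Linking rays

module _ {V E : Set} (G : Multigraph V E) where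

  open Multigraph G

  same-ends : ∀ {e u v u′ v′} → Joins G e u v → Joins G e u′ v′ → (u ≡ u′ × v ≡ v′) ⊎ (u ≡ v′ × v ≡ u′)
  same-ends (inj₁ (refl , refl)) (inj₁ (refl , refl)) = inj₁ (refl , refl)
  same-ends (inj₁ (refl , refl)) (inj₂ (refl , refl)) = inj₂ (refl , refl)
  same-ends (inj₂ (refl , refl)) (inj₁ (refl , refl)) = inj₂ (refl , refl)
  same-ends (inj₂ (refl , refl)) (inj₂ (refl , refl)) = inj₁ (refl , refl)

  edge-injective : ∀ (R : Ray G) {s t} → Ray.edge R s ≡ Ray.edge R t → s ≡ t
  edge-injective R {s} {t} eq with same-ends (subst (λ e → Joins G e _ _) eq (Ray.joins R s)) (Ray.joins R t)
  ... | inj₁ (p , _) = Ray.injective R p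
  ... | inj₂ (p , q) with Ray.injective R p | Ray.injective R q
  ...   | refl | r = ⊥-elim (2+≢ r)
    where
    2+≢ : ∀ {n} → suc (suc n) ≢ n
    2+≢ ()

  module _ {R S : Ray G} (em : ExcludedMiddle 0ℓ) (eq : Equivalent G R S) where

    -- A vertex lies on at most one of the disjoint paths, so of two paths that avoid the rest of
    -- the list at least one avoids `z` as well. The bound `n` serves to obtain a second, different
    -- path.
    far-path : ∀ (Z : List V) n → ∃ λ m → n ≤ m × (∀ {z} → z ∈ˡ Z → z ∉ˡ betweenVertices G {R} {S} (proj₁ eq m))
    far-path []      n = n , ≤-refl , λ ()
    far-path (z ∷ Z) n with far-path Z n
    ... | m , n≤m , out with far-path Z (suc m)
    ...   | m′ , m<m′ , out′ with em {z ∈ˡ betweenVertices G {R} {S} (proj₁ eq m)}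
    ...     | no z∉ = m , n≤m , λ { (here refl) → z∉ ; (there i) → out i }
    ...     | yes z∈ = m′ , ≤-trans n≤m (<⇒≤ m<m′) , λ
      { (here refl) z∈′ → proj₂ eq m m′ (λ { refl → <-irrefl refl m<m′ }) (z∈ , z∈′) ; (there i) → out′ i }

module Rails (em : ExcludedMiddle 0ℓ) {V E : Set} (G : Multigraph V E) (A B : Pred V 0ℓ) (finA : Finite A)
  (B∉A : ∀ {v} → v ∈ B → v ∉ A) (closed : ∀ {e u v} → Joins G e u v → u ∈ B → v ∉ A → v ∈ B)
  (d : ℕ) (rail : Fin d → Ray G)
  (foot∈A : ∀ i → Ray.vertex (rail i) 0 ∈ A) (rail∈B : ∀ i n → Ray.vertex (rail i) (suc n) ∈ B)
  (rail-disjoint : ∀ i j → i ≢ j → RaysEdgeDisjoint G (rail i) (rail j))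
  (rail-equivalent : ∀ i j → i ≢ j → Equivalent G (rail i) (rail j)) where

  open Multigraph G
  open Walks G

  vx : Fin d → ℕ → V
  vx i = Ray.vertex (rail i)

  ex : Fin d → ℕ → E
  ex i = Ray.edge (rail i)

  foot : Fin d → V
  foot i = vx i 0

  Touches : Pred E 0ℓ
  Touches e = end₁ e ∈ B ⊎ end₂ e ∈ B

  ex-touches : ∀ i t → Touches (ex i t)
  ex-touches i t with Ray.joins (rail i) t
  ... | inj₁ (_ , q) = inj₂ (subst B (sym q) (rail∈B i t))
  ... | inj₂ (q , _) = inj₁ (subst B (sym q) (rail∈B i t))

  walk∈B : ∀ {u v} (w : Walk G u v) → u ∈ B → (∀ {x} → x ∈ˡ walkVertices G w → x ∉ A) →
    ∀ {x} → x ∈ˡ walkVertices G w → x ∈ B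
  walk∈B stop         u∈ out (here refl) = u∈
  walk∈B (step e j w) u∈ out (here refl) = u∈
  walk∈B (step e j w) u∈ out (there i)   = walk∈B w (closed j u∈ (out (there (first∈ w)))) (out ∘ there) i

  Avoid : List (Fin d) → List E → Set
  Avoid M F = ∀ {l} → l ∈ˡ M → ∀ t → ex l t ∉ˡ F

  OffRails : List (Fin d) → E → Set
  OffRails M e = ∀ {l} → l ∈ˡ M → ∀ t → ex l t ≢ e

  -- Both ends are at least one step past the foot, hence in B. The walk may touch vertices of the
  -- rails in `M`, but uses none of their edges.
  record Crossing (M : List (Fin d)) (F : List E) (i j : Fin d) : Set where
    field
      {from to} : ℕ
      walk      : Walk G (vx i (suc from)) (vx j (suc to))
      offRails  : ∀ {e} → e ∈ˡ walkEdges G walk → OffRails M e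
      avoids    : ∀ {e} → e ∈ˡ walkEdges G walk → e ∉ˡ F
      touches   : ∀ {e} → e ∈ˡ walkEdges G walk → Touches e

  weaken : ∀ {M F F′ i j} → Crossing M (F ++ F′) i j → Crossing M F i j
  weaken c = record { walk = walk ; offRails = offRails ; touches = touches ; avoids = λ e∈ e∈F → avoids e∈ (∈-++⁺ˡ e∈F) }
    where open Crossing c

  on-rail : ∀ {l t e u v} → Joins G e u v → ex l t ≡ e → u ∉ A → ∃ λ n → u ≡ vx l (suc n)
  on-rail {l} {t} j refl u∉ with same-ends G j (Ray.joins (rail l) t)
  ... | inj₂ (p , _) = t , p
  ... | inj₁ (p , _) with t
  ...   | zero  = ⊥-elim (u∉ (subst A (sym p) (foot∈A l)))
  ...   | suc n = n , p

  module _ (M : List (Fin d)) (χ : Fin d → Bool) where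

    private
      On : Bool → V → Set
      On b u = ∃ λ i → i ∈ˡ M × χ i ≡ b × ∃ λ n → u ≡ vx i (suc n)

    -- Reading a walk backwards from a χ-false rail, only the part since the last rail visited matters.
    free-part : ∀ {u v} (w : Walk G u v) → (∀ {x} → x ∈ˡ walkVertices G w → x ∉ A) → On false v →
      (∃ λ x → On true x × ∃ λ y → On false y × ∃ λ (q : Walk G x y) →
        (∀ {e} → e ∈ˡ walkEdges G q → OffRails M e) × walkEdges G q ⊆ˡ walkEdges G w) ⊎
      (∃ λ y → On false y × ∃ λ (q : Walk G u y) →
        (∀ {e} → e ∈ˡ walkEdges G q → OffRails M e) × walkEdges G q ⊆ˡ walkEdges G w)
    free-part stop out onv = inj₂ (_ , onv , stop , (λ ()) , λ ())
    free-part (step e j w) out onv with free-part w (out ∘ there) onv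
    ... | inj₁ (x , onx , y , ony , q , off , sub) = inj₁ (x , onx , y , ony , q , off , there ∘ sub)
    ... | inj₂ (y , ony , q , off , sub) with em {∃ λ l → l ∈ˡ M × ∃ λ t → ex l t ≡ e}
    ...   | no free = inj₂ (y , ony , step e j q
              , (λ { (here refl) l∈ t eq → free (_ , l∈ , t , eq) ; (there i) → off i })
              , λ { (here r) → here r ; (there i) → there (sub i) })
    ...   | yes (l , l∈ , t , eq) with χ l in χl
    ...     | true  = inj₁ (_ , (l , l∈ , χl , on-rail (Joins-sym j) eq (out (there (first∈ w)))) , y , ony , q , off , there ∘ sub)
    ...     | false = inj₂ (_ , (l , l∈ , χl , on-rail j eq (out (here refl))) , stop , (λ ()) , λ ())

    -- The given rails only witness that both sides are inhabited. A path between them is shortened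
    -- by `free-part`, and the rails at the ends of what is left may be different ones, though still
    -- on opposite sides.
    query : ∀ F → (∃ λ i → i ∈ˡ M × χ i ≡ true) → (∃ λ j → j ∈ˡ M × χ j ≡ false) →
      ∃₂ λ i j → i ∈ˡ M × j ∈ˡ M × χ i ≡ true × χ j ≡ false × Crossing M F i j
    query F (i , i∈ , χi) (j , j∈ , χj) with rail-equivalent i j (λ { refl → true≢false χi χj })
    -- Avoiding A keeps the path inside the component and away from the feet. Avoiding one end of
    -- each edge in `F` is enough to avoid these edges.
    ... | eq with far-path G {rail i} {rail j} em eq (proj₁ finA ++ map end₁ F) 0
    ...   | m , _ , out with proj₁ eq m
    ...     | a , b , p = finish (free-part (Path.walk p) outA (j , j∈ , χj , past-foot j b (last∈ (Path.walk p))))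
      where
      outA : ∀ {x} → x ∈ˡ Path.vertices p → x ∉ A
      outA x∈ αx = out (∈-++⁺ˡ (proj₁ (proj₂ finA) αx)) x∈
      outF : ∀ {e} → e ∈ˡ Path.edges p → e ∉ˡ F
      outF e∈ e∈F = out (∈-++⁺ʳ (proj₁ finA) (∈-map⁺ end₁ e∈F)) (proj₁ (edge-ends (Path.walk p) e∈))
      past-foot : ∀ l c → vx l c ∈ˡ Path.vertices p → ∃ λ n → vx l c ≡ vx l (suc n)
      past-foot l zero    x∈ = ⊥-elim (outA x∈ (foot∈A l))
      past-foot l (suc c) x∈ = c , refl
      start : ∃ λ n → vx i a ≡ vx i (suc n)
      start = past-foot i a (first∈ (Path.walk p))
      touch : ∀ {e} → e ∈ˡ Path.edges p → Touches e
      touch e∈ = inj₁ (walk∈B (Path.walk p) (subst B (sym (proj₂ start)) (rail∈B i (proj₁ start))) outA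
                        (proj₁ (edge-ends (Path.walk p) e∈)))
      build : ∀ {x y} → On true x → On false y → (q : Walk G x y) → (∀ {e} → e ∈ˡ walkEdges G q → OffRails M e) →
        walkEdges G q ⊆ˡ Path.edges p →
        ∃₂ λ i j → i ∈ˡ M × j ∈ˡ M × χ i ≡ true × χ j ≡ false × Crossing M F i j
      build (i , i∈ , χi , m , refl) (j , j∈ , χj , n , refl) q off sub = i , j , i∈ , j∈ , χi , χj ,
        record { walk = q ; offRails = off ; avoids = outF ∘ sub ; touches = touch ∘ sub }
      finish : (∃ λ x → On true x × ∃ λ y → On false y × ∃ λ (q : Walk G x y) →
          (∀ {e} → e ∈ˡ walkEdges G q → OffRails M e) × walkEdges G q ⊆ˡ Path.edges p) ⊎
        (∃ λ y → On false y × ∃ λ (q : Walk G (vx i a) y) →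
          (∀ {e} → e ∈ˡ walkEdges G q → OffRails M e) × walkEdges G q ⊆ˡ Path.edges p) →
        ∃₂ λ i j → i ∈ˡ M × j ∈ˡ M × χ i ≡ true × χ j ≡ false × Crossing M F i j
      finish (inj₁ (x , onx , y , ony , q , off , sub)) = build onx ony q off sub
      finish (inj₂ (y , ony , q , off , sub)) = build (i , i∈ , χi , start) ony q off sub

  segment : ∀ i {a b} → a ≤′ b → Walk G (vx i a) (vx i b)
  segment i ≤′-refl             = stop
  segment i (≤′-step {n = n} p) = segment i p ⊙ step (ex i n) (Ray.joins (rail i) n) stop

  segment-edges : ∀ i {a b} (p : a ≤′ b) {e} → e ∈ˡ walkEdges G (segment i p) → ∃ λ t → a ≤ t × t < b × e ≡ ex i t
  segment-edges i ≤′-refl ()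
  segment-edges i (≤′-step {n = n} p) e∈ with ⊙-edges (segment i p) (step (ex i n) (Ray.joins (rail i) n) stop) e∈
  ... | inj₂ (here refl) = n , ≤′⇒≤ p , n<1+n n , refl
  ... | inj₁ e∈′ with segment-edges i p e∈′
  ...   | t , lo , hi , eq = t , lo , <-trans hi (n<1+n n) , eq

  prefix : ∀ i n → Walk G (foot i) (vx i n)
  prefix i n = segment i z≤′n

  OnRail : Fin d → E → Set
  OnRail i e = ∃ λ t → e ≡ ex i t

  -- What an edge of a new route must satisfy so that the rails in `M` stay free, the routes stay
  -- edge-disjoint, and routes of different components cannot share it.
  record Fresh (M : List (Fin d)) (F : List E) (e : E) : Set where
    field
      touches  : Touches e
      avoids   : e ∉ˡ F
      offRails : OffRails M e

  module _ {M : List (Fin d)} {F : List E} where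

    fresh-rail : ∀ {M′ i e} → Avoid M F → i ∈ˡ M → i ∉ˡ M′ → OnRail i e → Fresh M′ F e
    fresh-rail {M′} {i} av i∈ i∉ (t , refl) = record
      { touches = ex-touches i t ; avoids = av i∈ t
      ; offRails = λ {l} l∈ s eq → rail-disjoint l i (λ { refl → i∉ l∈ }) s t eq }

    fresh-crossing : ∀ {M′ i j e} → (∀ {l} → l ∈ˡ M′ → l ∈ˡ M) → (c : Crossing M F i j) →
      e ∈ˡ walkEdges G (Crossing.walk c) → Fresh M′ F e
    fresh-crossing M′⊆M c e∈ = record
      { touches = Crossing.touches c e∈ ; avoids = Crossing.avoids c e∈
      ; offRails = λ l∈ → Crossing.offRails c e∈ (M′⊆M l∈) }

    link : ∀ {M′ i j} → Avoid M F → i ∈ˡ M → j ∈ˡ M → i ∉ˡ M′ → j ∉ˡ M′ → (∀ {l} → l ∈ˡ M′ → l ∈ˡ M) →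
      Crossing M F i j → ∃ λ (p : Path G (foot i) (foot j)) → ∀ {e} → e ∈ˡ Path.edges p → Fresh M′ F e
    link {M′} {i} {j} av i∈ j∈ i∉ j∉ M′⊆M c
      with simplify em (prefix i _ ⊙ Crossing.walk c ⊙ reverse (prefix j _))
    ... | p , sub , _ = p , λ e∈ → fresh (⊙-edges (prefix i _) _ (sub e∈))
      where
      fresh : ∀ {e} → _ ⊎ _ → Fresh M′ F e
      fresh (inj₁ e∈) with segment-edges i z≤′n e∈
      ... | t , _ , _ , eq = fresh-rail av i∈ i∉ (t , eq)
      fresh (inj₂ e∈) with ⊙-edges (Crossing.walk c) (reverse (prefix j _)) e∈
      ... | inj₁ e∈ = fresh-crossing M′⊆M c e∈
      ... | inj₂ e∈ with segment-edges j z≤′n (reverse-edges (prefix j _) e∈)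
      ...   | t , _ , _ , eq = fresh-rail av j∈ j∉ (t , eq)

  record Tripod (a b c : Fin d) (Q : E → Set) : Set where
    field
      {centre}  : V
      centre∈B  : centre ∈ B
      leg₁      : Path G (foot a) centre
      leg₂      : Path G (foot b) centre
      leg₃      : Path G (foot c) centre
      disjoint₁₂ : Disjoint (Path.edges leg₁) (Path.edges leg₂)
      disjoint₁₃ : Disjoint (Path.edges leg₁) (Path.edges leg₃)
      disjoint₂₃ : Disjoint (Path.edges leg₂) (Path.edges leg₃)
      all₁ : ∀ {e} → e ∈ˡ Path.edges leg₁ → Q e
      all₂ : ∀ {e} → e ∈ˡ Path.edges leg₂ → Q e
      all₃ : ∀ {e} → e ∈ˡ Path.edges leg₃ → Q e

  Tripod-swap₁₂ : ∀ {a b c Q} → Tripod a b c Q → Tripod b a c Q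
  Tripod-swap₁₂ t = record
    { centre∈B = centre∈B ; leg₁ = leg₂ ; leg₂ = leg₁ ; leg₃ = leg₃
    ; disjoint₁₂ = λ { (x , y) → disjoint₁₂ (y , x) } ; disjoint₁₃ = disjoint₂₃ ; disjoint₂₃ = disjoint₁₃
    ; all₁ = all₂ ; all₂ = all₁ ; all₃ = all₃ }
    where open Tripod t

  Tripod-swap₂₃ : ∀ {a b c Q} → Tripod a b c Q → Tripod a c b Q
  Tripod-swap₂₃ t = record
    { centre∈B = centre∈B ; leg₁ = leg₁ ; leg₂ = leg₃ ; leg₃ = leg₂
    ; disjoint₁₂ = disjoint₁₃ ; disjoint₁₃ = disjoint₁₂ ; disjoint₂₃ = λ { (x , y) → disjoint₂₃ (y , x) }
    ; all₁ = all₁ ; all₂ = all₃ ; all₃ = all₂ }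
    where open Tripod t

  module _ {M : List (Fin d)} {F : List E} where

    private
      -- The centre is the point of rail c where the earlier of the two crossings arrives.
      tripod-ordered : ∀ {M′ a b c} → Avoid M F → a ∈ˡ M → b ∈ˡ M → c ∈ˡ M → a ≢ b → a ≢ c → b ≢ c →
        a ∉ˡ M′ → b ∉ˡ M′ → c ∉ˡ M′ → (∀ {l} → l ∈ˡ M′ → l ∈ˡ M) →
        (p : Crossing M F a c) (q : Crossing M F b c) →
        Disjoint (walkEdges G (Crossing.walk p)) (walkEdges G (Crossing.walk q)) →
        Crossing.to p ≤ Crossing.to q → Tripod a b c (Fresh M′ F)
      tripod-ordered {M′} {a} {b} {c} av a∈ b∈ c∈ a≢b a≢c b≢c a∉ b∉ c∉ M′⊆M p q dis le = record
        { centre∈B = rail∈B c (Crossing.to p)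
        ; leg₁ = proj₁ l₁ ; leg₂ = proj₁ l₂ ; leg₃ = proj₁ l₃
        ; disjoint₁₂ = λ { (x , y) → d₁₂ (c₁ x) (c₂ y) }
        ; disjoint₁₃ = λ { (x , y) → d₁₃ (c₁ x) (c₃ y) }
        ; disjoint₂₃ = λ { (x , y) → d₂₃ (c₂ x) (c₃ y) }
        ; all₁ = f₁ ∘ c₁ ; all₂ = f₂ ∘ c₂ ; all₃ = f₃ ∘ c₃ }
        where
        open Crossing
        between : Walk G (vx c (suc (to p))) (vx c (suc (to q)))
        between = segment c (≤⇒≤′ (s≤s le))
        l₁ = simplify em (prefix a _ ⊙ walk p)
        l₂ = simplify em (prefix b _ ⊙ walk q ⊙ reverse between)
        l₃ = simplify em (prefix c (suc (to p)))
        C₁ C₂ C₃ : E → Set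
        C₁ e = OnRail a e ⊎ e ∈ˡ walkEdges G (walk p)
        C₂ e = OnRail b e ⊎ e ∈ˡ walkEdges G (walk q) ⊎ ∃ λ t → suc (to p) ≤ t × e ≡ ex c t
        C₃ e = ∃ λ t → t < suc (to p) × e ≡ ex c t
        onPrefix : ∀ i {n e} → e ∈ˡ walkEdges G (prefix i n) → OnRail i e
        onPrefix i e∈ with segment-edges i z≤′n e∈
        ... | t , _ , _ , eq = t , eq
        c₁ : ∀ {e} → e ∈ˡ Path.edges (proj₁ l₁) → C₁ e
        c₁ e∈ with ⊙-edges (prefix a _) (walk p) (proj₁ (proj₂ l₁) e∈)
        ... | inj₁ x = inj₁ (onPrefix a x)
        ... | inj₂ x = inj₂ x
        c₂ : ∀ {e} → e ∈ˡ Path.edges (proj₁ l₂) → C₂ e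
        c₂ e∈ with ⊙-edges (prefix b _) _ (proj₁ (proj₂ l₂) e∈)
        ... | inj₁ x = inj₁ (onPrefix b x)
        ... | inj₂ x with ⊙-edges (walk q) _ x
        ...   | inj₁ y = inj₂ (inj₁ y)
        ...   | inj₂ y with segment-edges c (≤⇒≤′ (s≤s le)) (reverse-edges between y)
        ...     | t , lo , _ , eq = inj₂ (inj₂ (t , lo , eq))
        c₃ : ∀ {e} → e ∈ˡ Path.edges (proj₁ l₃) → C₃ e
        c₃ e∈ with segment-edges c z≤′n (proj₁ (proj₂ l₃) e∈)
        ... | t , _ , hi , eq = t , hi , eq
        d₁₂ : ∀ {e} → C₁ e → C₂ e → ⊥
        d₁₂ (inj₁ (s , refl)) (inj₁ (t , eq))            = rail-disjoint a b a≢b s t eq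
        d₁₂ (inj₁ (s , refl)) (inj₂ (inj₁ y))            = offRails q y a∈ s refl
        d₁₂ (inj₁ (s , refl)) (inj₂ (inj₂ (t , _ , eq))) = rail-disjoint a c a≢c s t eq
        d₁₂ (inj₂ x) (inj₁ (t , refl))                   = offRails p x b∈ t refl
        d₁₂ (inj₂ x) (inj₂ (inj₁ y))                     = dis (x , y)
        d₁₂ (inj₂ x) (inj₂ (inj₂ (t , _ , refl)))        = offRails p x c∈ t refl
        d₁₃ : ∀ {e} → C₁ e → C₃ e → ⊥
        d₁₃ (inj₁ (s , refl)) (t , _ , eq) = rail-disjoint a c a≢c s t eq
        d₁₃ (inj₂ x) (t , _ , refl)        = offRails p x c∈ t refl
        d₂₃ : ∀ {e} → C₂ e → C₃ e → ⊥
        d₂₃ (inj₁ (s , refl)) (t , _ , eq)              = rail-disjoint b c b≢c s t eq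
        d₂₃ (inj₂ (inj₁ y)) (t , _ , refl)              = offRails q y c∈ t refl
        d₂₃ (inj₂ (inj₂ (s , lo , refl))) (t , hi , eq) with edge-injective G (rail c) eq
        ... | refl = <-irrefl refl (≤-trans hi lo)
        f₁ : ∀ {e} → C₁ e → Fresh M′ F e
        f₁ (inj₁ x) = fresh-rail av a∈ a∉ x
        f₁ (inj₂ x) = fresh-crossing M′⊆M p x
        f₂ : ∀ {e} → C₂ e → Fresh M′ F e
        f₂ (inj₁ x)                   = fresh-rail av b∈ b∉ x
        f₂ (inj₂ (inj₁ x))            = fresh-crossing M′⊆M q x
        f₂ (inj₂ (inj₂ (t , _ , eq))) = fresh-rail av c∈ c∉ (t , eq)
        f₃ : ∀ {e} → C₃ e → Fresh M′ F e
        f₃ (t , _ , eq) = fresh-rail av c∈ c∉ (t , eq)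

    -- The second crossing was requested with the edges of the first added to `F`; this alone makes
    -- them disjoint. Which of them reaches rail `c` earlier cannot be controlled, hence the two
    -- symmetric cases.
    tripod : ∀ {M′ a b c} → Avoid M F → a ∈ˡ M → b ∈ˡ M → c ∈ˡ M → a ≢ b → a ≢ c → b ≢ c →
      a ∉ˡ M′ → b ∉ˡ M′ → c ∉ˡ M′ → (∀ {l} → l ∈ˡ M′ → l ∈ˡ M) →
      (p : Crossing M F a c) → Crossing M (F ++ walkEdges G (Crossing.walk p)) b c → Tripod a b c (Fresh M′ F)
    tripod av a∈ b∈ c∈ a≢b a≢c b≢c a∉ b∉ c∉ M′⊆M p q with ≤-total (Crossing.to p) (Crossing.to q)
    ... | inj₁ le = tripod-ordered av a∈ b∈ c∈ a≢b a≢c b≢c a∉ b∉ c∉ M′⊆M p (weaken q)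
          (λ (x , y) → Crossing.avoids q y (∈-++⁺ʳ F x)) le
    ... | inj₂ le = Tripod-swap₁₂ (tripod-ordered av b∈ a∈ c∈ (a≢b ∘ sym) b≢c a≢c b∉ a∉ c∉ M′⊆M (weaken q) p
          (λ (x , y) → Crossing.avoids q x (∈-++⁺ʳ F y)) le)

-- Reducing one component

-- In V ⊎ V, inj₁ v is the vertex v and inj₂ r the contracted component of G - A represented by r.
Terminal : {V : Set} → Pred V 0ℓ → Pred (V ⊎ V) 0ℓ
Terminal A (inj₁ v) = A v
Terminal A (inj₂ _) = ⊥

module Pieces {V E : Set} (G : Multigraph V E) (A B : Pred V 0ℓ) where
  open Multigraph G
  open Walks G

  Linking : Route → Set
  Linking ρ = Route.src ρ ∈ A × Route.dst ρ ∈ A × Route.src ρ ≢ Route.dst ρ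

  data Spokes : List Route → Set where
    none  : Spokes []
    three : ∀ {a b c x} → x ∈ B → a ∈ A → b ∈ A → c ∈ A → (p : Path G a x) (q : Path G b x) (r : Path G c x) →
      Spokes (route p ∷ route q ∷ route r ∷ [])

  record Piece : Set where
    field
      {spokes links} : List Route
      isSpokes       : Spokes spokes
      isLinks        : All Linking links

    routes : List Route
    routes = spokes ++ links

    field
      disjoint : AllPairs DisjointRoutes routes
      touching : All (λ ρ → ∀ {e} → e ∈ˡ Route.edges ρ → end₁ e ∈ B ⊎ end₂ e ∈ B) routes

WellCut : (em : ExcludedMiddle 0ℓ) {V : Set} (A : Pred V 0ℓ) (k : ℕ) → List ((V ⊎ V) × (V ⊎ V)) → Set
WellCut em {V} A k L = ∀ S → Cuts.Sep em (V ⊎ V) (Terminal A) (k + k) S → k + k ≤ count (Sets.crosses (V ⊎ V) S) L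

module Process (em : ExcludedMiddle 0ℓ) {V E : Set} (G : Multigraph V E) (A B : Pred V 0ℓ) (finA : Finite A)
  (B∉A : ∀ {v} → v ∈ B → v ∉ A) (closed : ∀ {e u v} → Joins G e u v → u ∈ B → v ∉ A → v ∈ B)
  (d : ℕ) (rail : Fin d → Ray G)
  (foot∈A : ∀ i → Ray.vertex (rail i) 0 ∈ A) (rail∈B : ∀ i n → Ray.vertex (rail i) (suc n) ∈ B)
  (rail-disjoint : ∀ i j → i ≢ j → RaysEdgeDisjoint G (rail i) (rail j))
  (rail-equivalent : ∀ i j → i ≢ j → Equivalent G (rail i) (rail j))
  (k : ℕ) (L₀ : List ((V ⊎ V) × (V ⊎ V))) where

  open Multigraph G
  open Rails em G A B finA B∉A closed d rail foot∈A rail∈B rail-disjoint rail-equivalent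
  open Walks G
  open Pieces G A B
  open Cuts em (V ⊎ V) (Terminal A) (k + k)

  end : Fin d → V ⊎ V
  end i = inj₁ (foot i)

  open Splitting em (V ⊎ V) (Terminal A) k (Fin d) end
    using (Star; module Star; Split; cross; star; split; reduce; lift-star; star-swap; star-↭; star-pair; attach)
  open Half (Fin d) end using (Good; Good-↭)

  data Hub : List (Fin d) → Set where
    none  : Hub []
    three : ∀ {a b c x} → x ∈ B → Path G (foot a) x → Path G (foot b) x → Path G (foot c) x → Hub (a ∷ b ∷ c ∷ [])

  spokesOf : ∀ {T} → Hub T → List Route
  spokesOf none              = []
  spokesOf (three _ p q r) = route p ∷ route q ∷ route r ∷ []

  -- M lists the boundary edges of B still to be dealt with, T those joined to the hub.
  record State (T M : List (Fin d)) : Set where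
    field
      links    : List Route
      isLinks  : All Linking links
      hub      : Hub T
      unique   : Unique M

    routes : List Route
    routes = spokesOf hub ++ links

    current : List ((V ⊎ V) × (V ⊎ V))
    current = map ends links ++ L₀

    field
      good     : Good current (T ++ M)
      disjoint : AllPairs DisjointRoutes routes
      touching : All (λ ρ → ∀ {e} → e ∈ˡ Route.edges ρ → Touches e) routes
      avoid    : Avoid M (used routes)

  -- Up to this point the spokes count as half-edges at the contracted vertex, so that `Star` keeps
  -- applying while pairs are linked after the tripod. Only now does `attach` move them to the
  -- actual hub.
  piece : ∀ {T} → State T [] → ∃ λ (p : Piece) → WellCut em A k (map ends (Piece.routes p) ++ L₀)
  piece {T} s = record { isLinks = isLinks ; isSpokes = isSpokes hub ; disjoint = disjoint ; touching = touching }
    , good′ T hub good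
    where
    open State s
    isSpokes : ∀ {T} (h : Hub T) → Spokes (spokesOf h)
    isSpokes none = none
    isSpokes (three {a} {b} {c} x∈ p q r) = three x∈ (foot∈A a) (foot∈A b) (foot∈A c) p q r
    good′ : ∀ T (h : Hub T) → Good current (T ++ []) → WellCut em A k (map ends (spokesOf h ++ links) ++ L₀)
    good′ _ none g S s = ≤-trans (g S s) (≤-reflexive (+-identityʳ _))
    good′ _ (three {a} {b} {c} {x} _ _ _ _) g S s = attach {current} {a ∷ b ∷ c ∷ []} g (inj₁ x) S s

  drop-rail : ∀ {M i M′} (s : State [] M) → M ↭ i ∷ M′ → Good (State.current s) M′ → State [] M′
  drop-rail s σ g = record
    { links = links ; isLinks = isLinks ; hub = hub ; good = g ; disjoint = disjoint ; touching = touching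
    ; unique = tail (Unique-↭ σ unique) ; avoid = λ l∈ → avoid (∈-resp-↭ (↭-sym σ) (there l∈)) }
    where open State s

  fresh⇒disjoint : ∀ {M ρs p} → (∀ {e} → e ∈ˡ p → Fresh M (used ρs) e) → All (λ ρ → Disjoint p (Route.edges ρ)) ρs
  fresh⇒disjoint f = All.tabulate λ ρ∈ (x , y) → Fresh.avoids (f x) (∈-used⁺ ρ∈ y)

  add-link : ∀ {T M i j M′} (s : State T M) → M ↭ i ∷ j ∷ M′ → Crossing M (used (State.routes s)) i j → foot i ≢ foot j →
    Good ((end i , end j) ∷ State.current s) (T ++ M′) → State T M′
  add-link {T} {M} {i} {j} {M′} s σ c i≢j g = record
    { links = ρ ∷ links ; isLinks = (foot∈A i , foot∈A j , i≢j) ∷ isLinks ; hub = hub ; unique = tail (tail u)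
    ; good = g
    ; disjoint = AllPairs-↭ (λ {ρ} {σ} → DisjointRoutes-sym {ρ} {σ}) τ (fresh⇒disjoint fresh ∷ disjoint)
    ; touching = All-resp-↭ τ ((λ e∈ → Fresh.touches (fresh e∈)) ∷ touching)
    ; avoid = avoid′ }
    where
    open State s
    u : Unique (i ∷ j ∷ M′)
    u = Unique-↭ σ unique
    back : ∀ {l} → l ∈ˡ i ∷ j ∷ M′ → l ∈ˡ M
    back = ∈-resp-↭ (↭-sym σ)
    linked : ∃ λ (p : Path G (foot i) (foot j)) → ∀ {e} → e ∈ˡ Path.edges p → Fresh M′ (used routes) e
    linked = link avoid (back (here refl)) (back (there (here refl)))
      (λ i∈ → Unique[x∷xs]⇒x∉xs u (there i∈)) (Unique[x∷xs]⇒x∉xs (tail u)) (λ l∈ → back (there (there l∈))) c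
    ρ : Route
    ρ = route (proj₁ linked)
    fresh : ∀ {e} → e ∈ˡ Route.edges ρ → Fresh M′ (used routes) e
    fresh = proj₂ linked
    τ : ρ ∷ routes ↭ spokesOf hub ++ ρ ∷ links
    τ = ↭-sym (shift ρ (spokesOf hub) links)
    avoid′ : Avoid M′ (used (spokesOf hub ++ ρ ∷ links))
    avoid′ l∈ t e∈ with ∈-used⁻ (spokesOf hub ++ ρ ∷ links) e∈
    ... | σ′ , σ∈ , x with ∈-resp-↭ (↭-sym τ) σ∈
    ...   | here refl = Fresh.offRails (fresh x) l∈ t refl
    ...   | there i   = avoid (back (there (there l∈))) t (∈-used⁺ i x)

  no-spokes : (h : Hub []) → spokesOf h ≡ []
  no-spokes none = refl

  -- The cut condition is unchanged: three half-edges pass from the pending list to the hub list and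
  -- nothing is split off.
  set-hub : ∀ {M a b c M′} (s : State [] M) → M ↭ a ∷ b ∷ c ∷ M′ → Tripod a b c (Fresh M′ (used (State.routes s))) →
    State (a ∷ b ∷ c ∷ []) M′
  set-hub {M} {a} {b} {c} {M′} s σ t = record
    { links = links ; isLinks = isLinks ; hub = three centre∈B leg₁ leg₂ leg₃ ; unique = tail (tail (tail (Unique-↭ σ unique)))
    ; good = Good-↭ {current} {current} ↭-refl σ good
    ; disjoint = (disjoint₁₂ ∷ disjoint₁₃ ∷ apart all₁) ∷ (disjoint₂₃ ∷ apart all₂) ∷ apart all₃ ∷ subst (AllPairs DisjointRoutes) bare disjoint
    ; touching = (λ e∈ → Fresh.touches (all₁ e∈)) ∷ (λ e∈ → Fresh.touches (all₂ e∈)) ∷ (λ e∈ → Fresh.touches (all₃ e∈))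
        ∷ subst (All _) bare touching
    ; avoid = avoid′ }
    where
    open State s
    open Tripod t
    bare : routes ≡ links
    bare = cong (_++ links) (no-spokes hub)
    apart : ∀ {p} → (∀ {e} → e ∈ˡ p → Fresh M′ (used routes) e) → All (λ ρ → Disjoint p (Route.edges ρ)) links
    apart f = subst (All _) bare (fresh⇒disjoint f)
    avoid′ : Avoid M′ (used (route leg₁ ∷ route leg₂ ∷ route leg₃ ∷ links))
    avoid′ l∈ n e∈ with ∈-used⁻ (route leg₁ ∷ route leg₂ ∷ route leg₃ ∷ links) e∈
    ... | _ , here refl , x = Fresh.offRails (all₁ x) l∈ n refl
    ... | _ , there (here refl) , x = Fresh.offRails (all₂ x) l∈ n refl
    ... | _ , there (there (here refl)) , x = Fresh.offRails (all₃ x) l∈ n refl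
    ... | _ , there (there (there i)) , x =
      avoid (∈-resp-↭ (↭-sym σ) (there (there (there l∈)))) n (subst (λ ρs → _ ∈ˡ used ρs) (sym bare) (∈-used⁺ i x))

  Final : Set
  Final = ∃ λ T → State T []

  flip : ∀ {M F i j} → Crossing M F i j → Crossing M F j i
  flip c = record { walk = reverse walk ; offRails = λ e∈ → offRails (reverse-edges walk e∈)
                  ; touches = λ e∈ → touches (reverse-edges walk e∈) ; avoids = λ e∈ → avoids (reverse-edges walk e∈) }
    where open Crossing c

  is : Fin d → Fin d → Bool
  is i l = does (l ≟ i)

  is-refl : ∀ i → is i i ≡ true
  is-refl i = dec-true (i ≟ i) refl

  is-≢ : ∀ {i l} → l ≢ i → is i l ≡ false
  is-≢ {i} {l} ne = dec-false (l ≟ i) ne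

  is⁻ : ∀ {i l} → is i l ≡ true → l ≡ i
  is⁻ {i} {l} e with l ≟ i
  ... | yes p = p

  is-false⁻ : ∀ {i l} → is i l ≡ false → l ≢ i
  is-false⁻ {i} {l} e refl = true≢false (is-refl i) e

  private
    -- A request from `z` is answered at `x` or at `y`. The rail that answers is then met by two
    -- crossings and carries the centre.
    third : ∀ {x y z M F} → M ↭ x ∷ y ∷ z ∷ [] → Unique (x ∷ y ∷ z ∷ []) → Avoid M F → Crossing M F x y → Tripod x y z (Fresh [] F)
    third {x} {y} {z} {M} {F} σ ((x≢y ∷ x≢z ∷ []) ∷ (y≢z ∷ []) ∷ _) av c =
      go (query M (is z) (F ++ walkEdges G (Crossing.walk c)) (z , z∈ , is-refl z) (x , x∈ , is-≢ x≢z))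
      where
      x∈ : x ∈ˡ M
      x∈ = ∈-resp-↭ (↭-sym σ) (here refl)
      y∈ : y ∈ˡ M
      y∈ = ∈-resp-↭ (↭-sym σ) (there (here refl))
      z∈ : z ∈ˡ M
      z∈ = ∈-resp-↭ (↭-sym σ) (there (there (here refl)))
      reversed : Crossing M (F ++ walkEdges G (Crossing.walk c)) z x → Crossing M (F ++ walkEdges G (Crossing.walk (flip c))) z x
      reversed c′ = record { walk = walk ; offRails = offRails ; touches = touches ; avoids = avoids′ }
        where
        open Crossing c′
        avoids′ : ∀ {e} → e ∈ˡ walkEdges G walk → e ∉ˡ F ++ walkEdges G (Crossing.walk (flip c))
        avoids′ e∈ i with ∈-++⁻ F i
        ... | inj₁ i = avoids e∈ (∈-++⁺ˡ i)
        ... | inj₂ i = avoids e∈ (∈-++⁺ʳ F (reverse-edges (Crossing.walk c) i))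
      go : (∃₂ λ i j → i ∈ˡ M × j ∈ˡ M × is z i ≡ true × is z j ≡ false × Crossing M (F ++ walkEdges G (Crossing.walk c)) i j) →
        Tripod x y z (Fresh [] F)
      go (i , w , _ , w∈ , isz , w≢z , c′) with is⁻ {z} {i} isz | ∈-resp-↭ σ w∈
      ... | refl | here refl = Tripod-swap₁₂ (Tripod-swap₂₃
              (tripod av y∈ z∈ x∈ y≢z (x≢y ∘ sym) (x≢z ∘ sym) (λ ()) (λ ()) (λ ()) (λ ()) (flip c) (reversed c′)))
      ... | refl | there (here refl) = Tripod-swap₂₃ (tripod av x∈ z∈ y∈ x≢z x≢y (y≢z ∘ sym) (λ ()) (λ ()) (λ ()) (λ ()) c c′)
      ... | refl | there (there (here refl)) = ⊥-elim (is-false⁻ {z} w≢z refl)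

  -- With only three rails left all of them go to the hub, so it does not matter which rail carries
  -- the centre.
  triple : ∀ {x y z M F} → M ↭ x ∷ y ∷ z ∷ [] → Unique M → Avoid M F → Tripod x y z (Fresh [] F)
  triple {x} {y} {z} {M} {F} σ u av with Unique-↭ σ u
  ... | u′@((x≢y ∷ _) ∷ _) with query M (is x) F (x , ∈-resp-↭ (↭-sym σ) (here refl) , is-refl x)
                                  (y , ∈-resp-↭ (↭-sym σ) (there (here refl)) , is-≢ (x≢y ∘ sym))
  ...   | i , w , _ , w∈ , isx , w≢x , c with is⁻ {x} {i} isx | ∈-resp-↭ σ w∈
  ...     | refl | here refl                 = ⊥-elim (is-false⁻ {x} w≢x refl)
  ...     | refl | there (here refl)         = third σ u′ av c
  ...     | refl | there (there (here refl)) = Tripod-swap₂₃ (third σ′ (Unique-↭ σ′ u) av c)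
    where
    σ′ : M ↭ x ∷ z ∷ y ∷ []
    σ′ = ↭-trans σ (prep x (swap y z ↭-refl))

  foot-≢ : ∀ (S : V ⊎ V → Bool) {i j} → S (end i) ≡ true → S (end j) ≡ false → foot i ≢ foot j
  foot-≢ S si sj eq = true≢false si (trans (cong (S ∘ inj₁) eq) sj)

  sides-differ : ∀ (S : V ⊎ V → Bool) {i j} → S (end i) ≡ true → S (end j) ≡ false → i ≢ j
  sides-differ S si sj refl = true≢false si sj

  -- The spokes p and r stay in the star although their rails are used up. They keep both classes at
  -- size at least 2 while a pair is pending, which is exactly what `lift-star` requires.
  finish-star : ∀ n {e p r M} (s : State (e ∷ p ∷ r ∷ []) M) (st : Star (State.current s) e (p ∷ r ∷ M) (suc n)) →
    Star.P st (end p) ≡ true → Star.P st (end r) ≡ false → Final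
  finish-star zero s st pp pr = _ , subst (State _) (star-pair st pp pr) s
  finish-star (suc n) {e} {p} {r} {M} s st pp pr = go
    (query M (Star.P st ∘ end) (used (State.routes s))
      (count-exists _ M (≤-trans (s≤s z≤n) (≤-reflexive (sym sizeP′))))
      (outside (count-exists _ M (≤-trans (s≤s z≤n) (≤-reflexive (sym sizeR′))))))
    where
    open Star st
    sizeP′ : count (P ∘ end) M ≡ suc n
    sizeP′ = suc-injective (trans (cong₂ (λ x y → b2n x + (b2n y + count (P ∘ end) M)) (sym pp) (sym pr)) sizeP)
    sizeR′ : count (R ∘ end) M ≡ suc n
    sizeR′ = suc-injective (trans (cong₂ (λ x y → b2n x + (b2n y + count (R ∘ end) M))
      (sym (trans (opposite (here refl)) (cong not pp))) (sym (trans (opposite (there (here refl))) (cong not pr)))) sizeR)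
    outside : (∃ λ j → j ∈ˡ M × R (end j) ≡ true) → ∃ λ j → j ∈ˡ M × P (end j) ≡ false
    outside (j , j∈ , rj) = j , j∈ , not-true⁻ (P (end j)) (trans (sym (opposite (there (there j∈)))) rj)
    go : (∃₂ λ i j → i ∈ˡ M × j ∈ˡ M × P (end i) ≡ true × P (end j) ≡ false × Crossing M (used (State.routes s)) i j) → Final
    go (i , j , i∈ , j∈ , pi , pj , c) with ∈∈⇒↭ i∈ j∈ (sides-differ P pi pj)
    ... | M′ , σ = finish-star n (add-link s σ c (foot-≢ P pi pj) (Star.good st′)) st′ pp pr
      where
      τ : p ∷ r ∷ M ↭ i ∷ j ∷ p ∷ r ∷ M′
      τ = ↭-trans (prep p (prep r σ)) (↭-trans (prep p (↭-sym (shift r (i ∷ j ∷ []) M′))) (↭-sym (shift p (i ∷ j ∷ []) (r ∷ M′))))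
      st′ : Star ((end i , end j) ∷ State.current s) e (p ∷ r ∷ M′) (suc n)
      st′ = lift-star st τ pi pj

  module _ {e M n} (s : State [] (e ∷ M)) (st : Star (State.current s) e M (suc n)) where

    private
      open Star st
      F : List E
      F = used (State.routes s)

    someP : ∃ λ i → i ∈ˡ M × P (end i) ≡ true
    someP = count-exists _ M (≤-trans (s≤s z≤n) (≤-reflexive (sym sizeP)))

    someR : ∃ λ i → i ∈ˡ M × R (end i) ≡ true
    someR = count-exists _ M (≤-trans (s≤s z≤n) (≤-reflexive (sym sizeR)))

    star-tripod : ∀ {p r M′} → M ↭ p ∷ r ∷ M′ → P (end p) ≡ true → P (end r) ≡ false → Tripod e p r (Fresh M′ F) → Final
    star-tripod σ pp pr t = finish-star n (set-hub s (prep e σ) t) (star-↭ σ st) pp pr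

    notP : ∀ {r} → r ∈ˡ M → R (end r) ≡ true → P (end r) ≡ false
    notP {r} r∈ rr = not-true⁻ (P (end r)) (trans (sym (opposite r∈)) rr)

    data Choice : Set where
      crossing : ∀ {i j} → i ∈ˡ M → j ∈ˡ M → P (end i) ≡ true → P (end j) ≡ false → Crossing (e ∷ M) F i j → Choice
      crossing′ : ∀ {i j} → i ∈ˡ M → j ∈ˡ M → R (end i) ≡ true → R (end j) ≡ false → Crossing (e ∷ M) F i j → Choice
      finished : Final → Choice

    -- Ask from the class of `P`: the answer is the other class, giving a pair to link, or e. In the
    -- latter case ask from the class of `R`, avoiding the first crossing: again the answer is a
    -- linkable pair or e, and two disjoint crossings into the rail of e make a tripod.
    choose : Choice
    choose with query (e ∷ M) (P ∘ end) F (proj₁ someP , there (proj₁ (proj₂ someP)) , proj₂ (proj₂ someP)) (e , here refl , e∉P)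
    ... | _ , _ , here refl , _ , pi , _ , _ = ⊥-elim (true≢false pi e∉P)
    ... | i , j , there i∈ , there j∈ , pi , pj , c = crossing i∈ j∈ pi pj c
    ... | i , _ , there i∈ , here refl , pi , _ , c
      with query (e ∷ M) (R ∘ end) (F ++ walkEdges G (Crossing.walk c))
             (proj₁ someR , there (proj₁ (proj₂ someR)) , proj₂ (proj₂ someR)) (e , here refl , e∉R)
    ...   | _ , _ , here refl , _ , ri , _ , _ = ⊥-elim (true≢false ri e∉R)
    ...   | i′ , j , there i′∈ , there j∈ , ri , rj , c′ = crossing′ i′∈ j∈ ri rj (weaken c′)
    ...   | r , _ , there r∈ , here refl , rr , _ , c′ with ∈∈⇒↭ i∈ r∈ (sides-differ P pi (notP r∈ rr)) | State.unique s
    ...     | M′ , σ | e# ∷ u with Unique-↭ σ u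
    ...       | u′@((i≢r ∷ _) ∷ ur@(_ ∷ _)) = finished (star-tripod σ pi (notP r∈ rr) (Tripod-swap₁₂ (Tripod-swap₂₃
                  (tripod {M′ = M′} (State.avoid s) (there i∈) (there r∈) (here refl)
                  i≢r (λ { refl → e∉M i∈ }) (λ { refl → e∉M r∈ })
                  (λ x → Unique[x∷xs]⇒x∉xs u′ (there x)) (Unique[x∷xs]⇒x∉xs ur) (λ x → e∉M (back (there (there x))))
                  (λ x → there (back (there (there x)))) c c′))))
      where
      e∉M : e ∉ˡ M
      e∉M = Unique[x∷xs]⇒x∉xs (e# ∷ u)
      back : ∀ {l} → l ∈ˡ i ∷ r ∷ M′ → l ∈ˡ M
      back = ∈-resp-↭ (↭-sym σ)

  process-star : ∀ n {e M} (s : State [] (e ∷ M)) → Star (State.current s) e M (suc n) → Final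
  process-star zero {e} {M} s st with someP s st | someR s st
  ... | p , p∈ , pp | r , r∈ , rr with ∈∈⇒↭ p∈ r∈ (sides-differ (Star.P st) pp (notP s st r∈ rr))
  ...   | M′ , σ with star-pair (star-↭ σ st) pp (notP s st r∈ rr)
  ...     | refl = star-tripod s st σ pp (notP s st r∈ rr) (triple (prep e σ) (State.unique s) (State.avoid s))
  process-star (suc n) {e} {M} s st = go (choose s st)
    where
    continue : (st : Star (State.current s) e M (suc (suc n))) → ∀ {i j} → i ∈ˡ M → j ∈ˡ M →
      Star.P st (end i) ≡ true → Star.P st (end j) ≡ false → Crossing (e ∷ M) (used (State.routes s)) i j → Final
    continue st {i} {j} i∈ j∈ pi pj c with ∈∈⇒↭ i∈ j∈ (sides-differ (Star.P st) pi pj)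
    ... | M′ , σ = process-star n
      (add-link s (↭-trans (prep e σ) (↭-sym (shift e (i ∷ j ∷ []) M′))) c (foot-≢ (Star.P st) pi pj) (Star.good st′)) st′
      where
      st′ : Star ((end i , end j) ∷ State.current s) e M′ (suc n)
      st′ = lift-star st σ pi pj
    go : Choice s st → Final
    go (crossing i∈ j∈ pi pj c)  = continue st i∈ j∈ pi pj c
    -- The crossing starts in the class of `R`, so the two classes exchange names.
    go (crossing′ i∈ j∈ ri rj c) = continue (star-swap st) i∈ j∈ ri rj c
    go (finished f)              = f

  state-↭ : ∀ {M M′} → M ↭ M′ → State [] M → State [] M′
  state-↭ σ s = record
    { links = links ; isLinks = isLinks ; hub = hub ; unique = Unique-↭ σ unique ; good = Good-↭ {current} {current} ↭-refl σ good
    ; disjoint = disjoint ; touching = touching ; avoid = λ l∈ → avoid (∈-resp-↭ (↭-sym σ) l∈) }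
    where open State s

  -- Deletion comes before splitting because `split` needs every pending half-edge to lie in a tight
  -- set. Once a star appears the rest is left to `process-star`, since `lift-star` preserves the
  -- star.
  process : ∀ n {M} → length M ≤ n → State [] M → Final
  process n       {[]}         le s = [] , s
  process (suc n) {M@(i₀ ∷ _)} le s with reduce {State.current s} (State.good s)
  ... | inj₁ (i , M′ , σ , g) = process n (≤-pred (≤-trans (≤-reflexive (sym (↭-length σ))) le)) (drop-rail s σ g)
  ... | inj₂ tight with split {State.current s} (State.good s) tight (i₀ , here refl)
  ...   | star σ st _ _ _ = process-star _ (state-↭ σ s) st
  ...   | cross Y in-Y out-Y liftable with query M (Y ∘ end) (used (State.routes s)) in-Y out-Y
  ...     | i , j , i∈ , j∈ , yi , yj , c with ∈∈⇒↭ i∈ j∈ (sides-differ Y yi yj)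
  ...       | M′ , σ = process n (≤-trans (n≤1+n _) (≤-pred (≤-trans (≤-reflexive (sym (↭-length σ))) le)))
                (add-link s σ c (foot-≢ Y yi yj) (liftable σ yi yj))

  component-piece : Good L₀ (allFin d) → ∃ λ (p : Piece) → WellCut em A k (map ends (Piece.routes p) ++ L₀)
  component-piece g = piece (proj₂ (process d (≤-reflexive (length-tabulate id)) record
    { links = [] ; isLinks = [] ; hub = none ; unique = allFin⁺ d ; good = g ; disjoint = [] ; touching = [] ; avoid = λ _ _ () }))

-- Contracting the components of G - A

module _ (em : ExcludedMiddle 0ℓ) where

  select : {X : Set} (P : X → Set) (xs : List X) → ∃ λ ys → Unique ys × (∀ {y} → y ∈ˡ ys → P y) × (∀ {x} → x ∈ˡ xs → P x → x ∈ˡ ys)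
  select P [] = [] , [] , (λ ()) , λ ()
  select P (x ∷ xs) with select P xs
  ... | ys , u , sound , complete with em {P x × x ∉ˡ ys}
  ...   | yes (px , x∉) = x ∷ ys , All.tabulate (λ { y∈ refl → x∉ y∈ }) ∷ u
            , (λ { (here refl) → px ; (there i) → sound i })
            , λ { (here refl) _ → here refl ; (there i) p → there (complete i p) }
  ...   | no dup = ys , u , sound , λ { (here refl) px → found px ; (there i) p → complete i p }
    where
    found : P x → x ∈ˡ ys
    found px with em {x ∈ˡ ys}
    ... | yes i = i
    ... | no x∉ = ⊥-elim (dup (px , x∉))

  representatives : {X : Set} (R : X → X → Set) → (∀ {x y} → R x y → R y x) → (xs : List X) → (∀ {x} → x ∈ˡ xs → R x x) →
    ∃ λ ys → AllPairs (λ x y → ¬ R x y) ys × (∀ {y} → y ∈ˡ ys → y ∈ˡ xs) × (∀ {x} → x ∈ˡ xs → ∃ λ y → y ∈ˡ ys × R y x)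
  representatives R s [] _ = [] , [] , (λ ()) , λ ()
  representatives R s (x ∷ xs) rfl with representatives R s xs (rfl ∘ there)
  ... | ys , ap , sub , cov with em {∃ λ y → y ∈ˡ ys × R y x}
  ...   | yes old = ys , ap , there ∘ sub , λ { (here refl) → old ; (there i) → cov i }
  ...   | no new = x ∷ ys , All.tabulate (λ y∈ r → new (_ , y∈ , s r)) ∷ ap
            , (λ { (here r) → here r ; (there i) → there (sub i) })
            , λ { (here refl) → x , here refl , rfl (here refl) ; (there i) → weaken (cov i) }
    where
    weaken : ∀ {z} → (∃ λ y → y ∈ˡ ys × R y z) → ∃ λ y → y ∈ˡ x ∷ ys × R y z
    weaken (y , i , r) = y , there i , r

crossing-items : {X Y : Set} (p : Y → Bool) (xs : List (X × Y)) →
  ∃ λ F → length F ≡ count p (map proj₂ xs) × (∀ {x y} → (x , y) ∈ˡ xs → p y ≡ true → x ∈ˡ F)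
crossing-items p [] = [] , refl , λ ()
crossing-items p ((x , y) ∷ xs) with crossing-items p xs | p y in eq
... | F , len , cov | true  = x ∷ F , cong suc len , λ { (here refl) _ → here refl ; (there i) e → there (cov i e) }
... | F , len , cov | false = F , len , λ { (here refl) e → ⊥-elim (true≢false e eq) ; (there i) e → cov i e }

module Components (em : ExcludedMiddle 0ℓ) {V E : Set} (G : Multigraph V E) (lf : LocallyFinite G)
  (A : Pred V 0ℓ) (finA : Finite A) where
  open Multigraph G
  open Walks G
  open Walks.SameComponents G em A public

  near : List E
  near = concatMap (λ v → proj₁ (lf v)) (proj₁ finA)

  near-complete : ∀ {v e} → v ∈ A → Incident G v e → e ∈ˡ near
  near-complete {v} v∈ inc = ∈-concatMap⁺ (λ v → proj₁ (lf v)) (lose (proj₁ (proj₂ finA) v∈) (proj₁ (proj₂ (lf v)) inc))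

  Joins⇒Incident : ∀ {e u v} → Joins G e u v → Incident G u e
  Joins⇒Incident (inj₁ (p , _)) = inj₁ p
  Joins⇒Incident (inj₂ (_ , q)) = inj₂ q

  ∈A? : ∀ v → Dec (v ∈ A)
  ∈A? v = em

  module Component (r : V) (r∉A : r ∉ A) (linked : BoundaryLinked G (SameComponent G A r)) where

    B : Pred V 0ℓ
    B = SameComponent G A r

    B∉A : ∀ {v} → v ∈ B → v ∉ A
    B∉A = same-end

    closed : ∀ {e u v} → Joins G e u v → u ∈ B → v ∉ A → v ∈ B
    closed j u∈ v∉ = same-trans u∈ (same-step j (B∉A u∈) v∉)

    module L = BoundaryLinked linked

    outside⇒A : ∀ {e u v} → Joins G e u v → u ∈ B → v ∉ B → v ∈ A
    outside⇒A {v = v} j u∈ v∉ with ∈A? v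
    ... | yes α = α
    ... | no v∉A = ⊥-elim (v∉ (closed j u∈ v∉A))

    boundary : List E
    boundary = proj₁ (select em (Boundary G B) near)

    boundary-unique : Unique boundary
    boundary-unique = proj₁ (proj₂ (select em (Boundary G B) near))

    boundary-sound : ∀ {e} → e ∈ˡ boundary → e ∈ Boundary G B
    boundary-sound = proj₁ (proj₂ (proj₂ (select em (Boundary G B) near)))

    boundary-complete : ∀ {e u v} → Joins G e u v → u ∈ A → v ∈ B → e ∈ˡ boundary
    boundary-complete j u∈A v∈B = proj₂ (proj₂ (proj₂ (select em (Boundary G B) near)))
      (near-complete u∈A (Joins⇒Incident j)) (bd j)
      where
      bd : ∀ {e} → Joins G e _ _ → e ∈ Boundary G B
      bd (inj₁ (refl , refl)) = inj₂ ((λ u∈ → B∉A u∈ u∈A) , v∈B)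
      bd (inj₂ (refl , refl)) = inj₁ (v∈B , λ u∈ → B∉A u∈ u∈A)

    d : ℕ
    d = length boundary

    idx : Fin d → L.Index
    idx f = proj₁ (L.covers (lookup boundary f) (boundary-sound (∈-lookup f)))

    first-edge : ∀ f → Ray.edge (L.ray (idx f)) 0 ≡ lookup boundary f
    first-edge f = proj₂ (L.covers (lookup boundary f) (boundary-sound (∈-lookup f)))

    rail : Fin d → Ray G
    rail f = L.ray (idx f)

    -- A boundary edge is the first edge of its own ray only, so a rail never returns to A.
    later-inside : ∀ i n → Inside G B (Ray.edge (L.ray i) (suc n))
    later-inside i n with L.within i (suc n)
    ... | inj₁ ins = ins
    ... | inj₂ bd with L.covers _ bd
    ...   | j , eq with em {j ≡ i}
    ...     | no j≢i = ⊥-elim (L.edgeDisjoint j i j≢i 0 (suc n) eq)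
    ...     | yes refl with edge-injective G (L.ray i) eq
    ...       | ()

    rail∈B : ∀ f n → Ray.vertex (rail f) (suc n) ∈ B
    rail∈B f n with Ray.joins (rail f) (suc n) | later-inside (idx f) n
    ... | inj₁ (p , _) | a , _ = subst B p a
    ... | inj₂ (_ , q) | _ , b = subst B q b

    foot∈A : ∀ f → Ray.vertex (rail f) 0 ∈ A
    foot∈A f = outside⇒A (Joins-sym (Ray.joins (rail f) 0)) (rail∈B f 0) out
      where
      out : Ray.vertex (rail f) 0 ∉ B
      out v₀∈ with Ray.joins (rail f) 0 | subst (Boundary G B) (sym (first-edge f)) (boundary-sound (∈-lookup f))
      ... | inj₁ (p , q) | inj₁ (_ , y) = y (subst B (sym q) (rail∈B f 0))
      ... | inj₁ (p , q) | inj₂ (x , _) = x (subst B (sym p) v₀∈)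
      ... | inj₂ (p , q) | inj₁ (_ , y) = y (subst B (sym q) v₀∈)
      ... | inj₂ (p , q) | inj₂ (x , _) = x (subst B (sym p) (rail∈B f 0))

    idx-injective : ∀ {f g} → f ≢ g → idx f ≢ idx g
    idx-injective {f} {g} f≢g eq = AllPairs-lookup (λ ne → ne ∘ sym) boundary-unique f g f≢g
      (trans (sym (first-edge f)) (trans (cong (λ i → Ray.edge (L.ray i) 0) eq) (first-edge g)))

    rail-disjoint : ∀ f g → f ≢ g → RaysEdgeDisjoint G (rail f) (rail g)
    rail-disjoint f g ne = L.edgeDisjoint (idx f) (idx g) (idx-injective ne)

    rail-equivalent : ∀ f g → f ≢ g → Equivalent G (rail f) (rail g)
    rail-equivalent f g ne = L.equivalent (idx f) (idx g) (idx-injective ne)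

    foot : Fin d → V
    foot f = Ray.vertex (rail f) 0

    pending : List (E × (V ⊎ V) × (V ⊎ V))
    pending = map (λ f → lookup boundary f , inj₁ (foot f) , inj₂ r) (allFin d)

    pending-complete : ∀ {e u v} → Joins G e u v → u ∈ A → v ∈ B → (e , inj₁ u , inj₂ r) ∈ˡ pending
    pending-complete {e} {u} {v} j u∈A v∈B = subst (_∈ˡ pending)
      (cong₂ (λ e u → e , inj₁ u , inj₂ r) (sym eq) foot≡u) (∈-map⁺ _ (∈-allFin f))
      where
      e∈ : e ∈ˡ boundary
      e∈ = boundary-complete j u∈A v∈B
      f : Fin d
      f = index e∈
      eq : e ≡ lookup boundary f
      eq = lookup-index e∈
      foot≡u : foot f ≡ u
      foot≡u with same-ends G (Ray.joins (rail f) 0) (subst (λ e → Joins G e u v) (trans eq (sym (first-edge f))) j)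
      ... | inj₁ (p , _) = p
      ... | inj₂ (p , _) = ⊥-elim (B∉A v∈B (subst A p (foot∈A f)))

    module _ (k : ℕ) (L₀ : List ((V ⊎ V) × (V ⊎ V))) where
      open Process em G A B finA B∉A closed d rail foot∈A rail∈B rail-disjoint rail-equivalent k L₀
        using (component-piece)

      open Cuts em (V ⊎ V) (Terminal A) (k + k)
      open Sets (V ⊎ V) using (crosses)

      without : (V ⊎ V → Bool) → V ⊎ V → Bool
      without S (inj₁ v) = S (inj₁ v)
      without S (inj₂ v) with em {v ≡ r}
      ... | yes _ = false
      ... | no _  = S (inj₂ v)

      without-r : ∀ S → without S (inj₂ r) ≡ false
      without-r S with em {r ≡ r}
      ... | yes _ = refl
      ... | no ne = ⊥-elim (ne refl)

      without-≢ : ∀ S {w} → w ≢ inj₂ r → without S w ≡ S w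
      without-≢ S {inj₁ v} _ = refl
      without-≢ S {inj₂ v} ne with em {v ≡ r}
      ... | yes refl = ⊥-elim (ne refl)
      ... | no _     = refl

      -- `Good` measures sets avoiding the contracted vertex. Taking `inj₂ r`, which is no terminal,
      -- out of `S` changes nothing on `L₀` and turns the crossing pending edges into those whose
      -- foot lies in `S`.
      solve-component : (∀ {x y} → (x , y) ∈ˡ L₀ → x ≢ inj₂ r × y ≢ inj₂ r) →
        WellCut em A k (map proj₂ pending ++ L₀) →
        ∃ λ (p : Pieces.Piece G A B) → WellCut em A k (map ends (Pieces.Piece.routes p) ++ L₀)
      solve-component fresh good = component-piece λ S s → ≤-trans (good (without S) (sep′ S s)) (≤-reflexive (same S))
        where
        sep′ : ∀ S → Sep S → Sep (without S)
        sep′ S ((inj₁ a , α , p) , (inj₁ b , β , q)) = (inj₁ a , α , p) , (inj₁ b , β , q)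
        same : ∀ S → count (crosses (without S)) (map proj₂ pending ++ L₀)
          ≡ count (crosses S) L₀ + count (S ∘ inj₁ ∘ foot) (allFin d)
        same S = trans (count-++ _ (map proj₂ pending) L₀) (trans (+-comm (count (crosses (without S)) (map proj₂ pending)) _)
          (cong₂ _+_
            (count-cong L₀ λ { {x , y} i → cong₂ _xor_ (without-≢ S (proj₁ (fresh i))) (without-≢ S (proj₂ (fresh i))) })
            (trans (count-map proj₂ _ pending) (trans (count-map _ _ (allFin d))
              (count-cong (allFin d) λ {f} _ → trans (cong (S (inj₁ (foot f)) xor_) (without-r S)) (xor-identityʳ _))))))

WellCut-↭ : ∀ (em : ExcludedMiddle 0ℓ) {V : Set} {A : Pred V 0ℓ} {k L L′} → L ↭ L′ → WellCut em A k L → WellCut em A k L′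
WellCut-↭ em σ good S s = ≤-trans (good S s) (≤-reflexive (count-↭ _ σ))

module Assembly (em : ExcludedMiddle 0ℓ) (k : ℕ) {V E : Set} (G : Multigraph V E)
  (connected : EdgeConnected G (2 * k)) (lf : LocallyFinite G) (A : Pred V 0ℓ) (finA : Finite A)
  (linked : ∀ v → v ∉ A → BoundaryLinked G (SameComponent G A v)) where
  open Multigraph G
  open Walks G
  open Components em G lf A finA
  open Cuts em (V ⊎ V) (Terminal A) (k + k) using (Sep)
  open Sets (V ⊎ V) using (crosses)

  Same : V → V → Set
  Same = SameComponent G A

  PieceAt : V → Set
  PieceAt r = Pieces.Piece G A (Same r)

  pendingAt : ∀ r → r ∉ A → List (E × (V ⊎ V) × (V ⊎ V))
  pendingAt r r∉ = Component.pending r r∉ (linked r r∉)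

  pendings : ∀ {rs} → All (_∉ A) rs → List (E × (V ⊎ V) × (V ⊎ V))
  pendings []               = []
  pendings (_∷_ {r} r∉ out) = pendingAt r r∉ ++ pendings out

  pendings-ends : ∀ {rs} (out : All (_∉ A) rs) {e x y} → (e , x , y) ∈ˡ pendings out →
    (∃ λ v → x ≡ inj₁ v) × (∃ λ r → r ∈ˡ rs × y ≡ inj₂ r)
  pendings-ends (_∷_ {r} r∉ out) i with ∈-++⁻ (pendingAt r r∉) i
  ... | inj₁ i with ∈-map⁻ _ i
  ...   | f , _ , refl = (_ , refl) , (r , here refl , refl)
  pendings-ends (r∉ ∷ out) _ | inj₂ i with pendings-ends out i
  ... | x , (r′ , r′∈ , eq) = x , (r′ , there r′∈ , eq)

  allRoutes : ∀ {rs} → All PieceAt rs → List Route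
  allRoutes []       = []
  allRoutes (p ∷ ps) = Pieces.Piece.routes p ++ allRoutes ps

  -- One component at a time: the fixed part of the graph consists of the boundary edges of
  -- components still contracted and the routes already found. Distinct representatives ensure that
  -- the current contracted vertex is not an end of any of these.
  solve-all : ∀ {rs} → AllPairs (λ r r′ → ¬ Same r r′) rs → (out : All (_∉ A) rs) → (ρs : List Route) →
    WellCut em A k (map proj₂ (pendings out) ++ map ends ρs) →
    ∃ λ (ps : All PieceAt rs) → WellCut em A k (map ends (allRoutes ps ++ ρs))
  solve-all [] [] ρs good = [] , good
  solve-all (r# ∷ apart) (_∷_ {r} r∉ out) ρs good with Component.solve-component r r∉ (linked r r∉) k (map proj₂ (pendings out) ++ map ends ρs) fresh
    (subst (WellCut em A k) (trans (cong (_++ map ends ρs) (map-++ proj₂ (pendingAt r r∉) (pendings out)))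
      (++-assoc (map proj₂ (pendingAt r r∉)) (map proj₂ (pendings out)) (map ends ρs))) good)
    where
    fresh : ∀ {x y} → (x , y) ∈ˡ map proj₂ (pendings out) ++ map ends ρs → x ≢ inj₂ r × y ≢ inj₂ r
    fresh i with ∈-++⁻ (map proj₂ (pendings out)) i
    ... | inj₁ i with ∈-map⁻ proj₂ i
    ...   | _ , j , refl with pendings-ends out j
    ...     | (v , refl) , (r′ , r′∈ , refl) = (λ ()) , λ { refl → All.lookup r# r′∈ (same-refl r∉) }
    fresh _ | inj₂ i with ∈-map⁻ ends i
    ... | _ , _ , refl = (λ ()) , λ ()
  ... | p , good′ with solve-all apart out (Pieces.Piece.routes p ++ ρs)
    (WellCut-↭ em {k = k} (↭-trans (shifts (map ends (Pieces.Piece.routes p)) (map proj₂ (pendings out)))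
      (↭-reflexive (cong (map proj₂ (pendings out) ++_) (sym (map-++ ends (Pieces.Piece.routes p) ρs))))) good′)
  ...   | ps , good″ = p ∷ ps , WellCut-↭ em {k = k} (map⁺ ends (↭-trans (shifts (allRoutes ps) (Pieces.Piece.routes p))
            (↭-reflexive (sym (++-assoc (Pieces.Piece.routes p) (allRoutes ps) ρs))))) good″

  selected = select em (Inside G A) near

  insideEdges : List E
  insideEdges = proj₁ selected

  insideEdges-complete : ∀ {e} → e ∈ Inside G A → e ∈ˡ insideEdges
  insideEdges-complete ins = proj₂ (proj₂ (proj₂ selected)) (near-complete (proj₁ ins) (inj₁ refl)) ins

  insideRoutes : List Route
  insideRoutes = map single insideEdges

  outer : List V
  outer = proj₁ (select em (_∉ A) (map end₁ near ++ map end₂ near))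

  outer∉A : ∀ {v} → v ∈ˡ outer → v ∉ A
  outer∉A = proj₁ (proj₂ (proj₂ (select em (_∉ A) (map end₁ near ++ map end₂ near))))

  outer-complete : ∀ {e u v} → Joins G e u v → u ∈ A → v ∉ A → v ∈ˡ outer
  outer-complete {e} {u} {v} j u∈ v∉ = proj₂ (proj₂ (proj₂ (select em (_∉ A) (map end₁ near ++ map end₂ near)))) (side j) v∉
    where
    e∈ : e ∈ˡ near
    e∈ = near-complete u∈ (Joins⇒Incident j)
    side : Joins G e u v → v ∈ˡ map end₁ near ++ map end₂ near
    side (inj₁ (_ , refl)) = ∈-++⁺ʳ (map end₁ near) (∈-map⁺ end₂ e∈)
    side (inj₂ (refl , _)) = ∈-++⁺ˡ (∈-map⁺ end₁ e∈)

  chosen = representatives em Same same-sym outer (λ v∈ → same-refl (outer∉A v∈))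

  reps : List V
  reps = proj₁ chosen

  reps-apart : AllPairs (λ r r′ → ¬ Same r r′) reps
  reps-apart = proj₁ (proj₂ chosen)

  reps∉A : All (_∉ A) reps
  reps∉A = All.tabulate (λ r∈ → outer∉A (proj₁ (proj₂ (proj₂ chosen)) r∈))

  reps-cover : ∀ {v} → v ∈ˡ outer → ∃ λ r → r ∈ˡ reps × Same r v
  reps-cover = proj₂ (proj₂ (proj₂ chosen))

  reps-unique : ∀ {r r′ v} → r ∈ˡ reps → r′ ∈ˡ reps → Same r v → Same r′ v → r ≡ r′
  reps-unique = go reps-apart
    where
    go : ∀ {rs} → AllPairs (λ r r′ → ¬ Same r r′) rs → ∀ {r r′ v} → r ∈ˡ rs → r′ ∈ˡ rs → Same r v → Same r′ v → r ≡ r′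
    go (p ∷ ap) (here refl) (here refl) s s′ = refl
    go (p ∷ ap) (here refl) (there i) s s′ = ⊥-elim (All.lookup p i (same-trans s (same-sym s′)))
    go (p ∷ ap) (there i) (here refl) s s′ = ⊥-elim (All.lookup p i (same-trans s′ (same-sym s)))
    go (p ∷ ap) (there i) (there j) s s′ = go ap i j s s′

  items : List (E × (V ⊎ V) × (V ⊎ V))
  items = pendings reps∉A ++ map (λ e → e , ends (single e)) insideEdges

  pending∈items : ∀ {e u v r} → Joins G e u v → u ∈ A → r ∈ˡ reps → Same r v → (e , inj₁ u , inj₂ r) ∈ˡ items
  pending∈items {e} {u} {v} j u∈ = λ r∈ s → ∈-++⁺ˡ (go reps∉A r∈ s)
    where
    go : ∀ {rs} (out : All (_∉ A) rs) {r} → r ∈ˡ rs → Same r v → (e , inj₁ u , inj₂ r) ∈ˡ pendings out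
    go (_∷_ {r} r∉ out) (here refl) s = ∈-++⁺ˡ (Component.pending-complete r r∉ (linked r r∉) j u∈ s)
    go (_∷_ {r} r∉ out) (there i)   s = ∈-++⁺ʳ (pendingAt r r∉) (go out i s)

  -- A cut of the contracted graph is a cut of G: every vertex goes to the side of its component.
  module _ (S : V ⊎ V → Bool) where

    outside : ∀ v → Dec (∃ λ r → r ∈ˡ reps × Same r v) → Bool
    outside v (yes (r , _)) = S (inj₂ r)
    -- A component without a representative has no edge to A, so its side is arbitrary as long as it
    -- is constant on the component.
    outside v (no _)        = false

    sideOf : ∀ v → Dec (v ∈ A) → Bool
    sideOf v (yes _) = S (inj₁ v)
    sideOf v (no _)  = outside v em

    side : V → Bool
    side v = sideOf v (∈A? v)

    side-A : ∀ {v} → v ∈ A → side v ≡ S (inj₁ v)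
    side-A {v} v∈ with ∈A? v
    ... | yes _ = refl
    ... | no v∉ = ⊥-elim (v∉ v∈)

    side-rep : ∀ {v r} → r ∈ˡ reps → Same r v → side v ≡ S (inj₂ r)
    side-rep {v} {r} r∈ s with ∈A? v
    ... | yes v∈ = ⊥-elim (same-end s v∈)
    ... | no _ = go em
      where
      go : (dec : Dec (∃ λ r → r ∈ˡ reps × Same r v)) → outside v dec ≡ S (inj₂ r)
      go (yes (r′ , r′∈ , s′)) = cong (S ∘ inj₂) (reps-unique r′∈ r∈ s′ s)
      go (no none)             = ⊥-elim (none (r , r∈ , s))

    side-none : ∀ {v} → v ∉ A → ¬ (∃ λ r → r ∈ˡ reps × Same r v) → side v ≡ false
    side-none {v} v∉ none with ∈A? v
    ... | yes v∈ = ⊥-elim (v∉ v∈)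
    ... | no _ = go em
      where
      go : (dec : Dec (∃ λ r → r ∈ˡ reps × Same r v)) → outside v dec ≡ false
      go (yes some) = ⊥-elim (none some)
      go (no _)     = refl

    side-same : ∀ {u v} → Same u v → v ∉ A → u ∉ A → side u ≡ side v
    side-same {u} {v} s v∉ u∉ with em {∃ λ r → r ∈ˡ reps × Same r u}
    ... | yes (r , r∈ , t) = trans (side-rep r∈ t) (sym (side-rep r∈ (same-trans t s)))
    ... | no none = trans (side-none u∉ none)
      (sym (side-none v∉ (λ { (r , r∈ , t) → none (r , r∈ , same-trans t (same-sym s)) })))

    xor-≢ : ∀ {a b} → a xor b ≢ true → a ≡ b
    xor-≢ {true}  {true}  _ = refl
    xor-≢ {true}  {false} n = ⊥-elim (n refl)
    xor-≢ {false} {true}  n = ⊥-elim (n refl)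
    xor-≢ {false} {false} _ = refl

    module _ (F : List E) (covers : ∀ {e y} → (e , y) ∈ˡ items → crosses S y ≡ true → e ∈ˡ F) where

      side-boundary : ∀ {e u v} → Joins G e u v → e ∉ˡ F → u ∈ A → v ∉ A → side u ≡ side v
      side-boundary j e∉ u∈ v∉ with reps-cover (outer-complete j u∈ v∉)
      ... | r , r∈ , s = trans (side-A u∈) (trans (xor-≢ (λ c → e∉ (covers (pending∈items j u∈ r∈ s) c))) (sym (side-rep r∈ s)))

      side-step : ∀ {e u v} → Joins G e u v → e ∉ˡ F → side u ≡ side v
      side-step {e} {u} {v} j e∉ = go em em
        where
        item : ∀ {e} → e ∈ Inside G A → (e , ends (single e)) ∈ˡ items
        item ins = ∈-++⁺ʳ (pendings reps∉A) (∈-map⁺ _ (insideEdges-complete ins))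
        inside : Joins G e u v → u ∈ A → v ∈ A → S (inj₁ u) ≡ S (inj₁ v)
        inside (inj₁ (refl , refl)) u∈ v∈ = xor-≢ (λ c → e∉ (covers (item (u∈ , v∈)) c))
        inside (inj₂ (refl , refl)) u∈ v∈ = sym (xor-≢ (λ c → e∉ (covers (item (v∈ , u∈)) c)))
        go : Dec (u ∈ A) → Dec (v ∈ A) → side u ≡ side v
        go (yes u∈) (no v∉)  = side-boundary j e∉ u∈ v∉
        go (no u∉)  (yes v∈) = sym (side-boundary (Joins-sym j) e∉ v∈ u∉)
        go (no u∉)  (no v∉)  = side-same (same-step j u∉ v∉) v∉ u∉
        go (yes u∈) (yes v∈) = trans (side-A u∈) (trans (inside j u∈ v∈) (sym (side-A v∈)))

      side-walk : ∀ {u v} (w : Walk G u v) → Disjoint (walkEdges G w) F → side u ≡ side v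
      side-walk stop         d = refl
      side-walk (step e j w) d = trans (side-step j (λ e∈ → d (here refl , e∈))) (side-walk w (λ (x , y) → d (there x , y)))

  -- Fewer than 2k crossing items would be fewer than 2k edges of `G`. Some path between the two
  -- terminals avoids them, but without crossing items `side` is constant along it.
  contracted-cuts : WellCut em A k (map proj₂ items)
  contracted-cuts S ((inj₁ a , α , p) , (inj₁ b , β , q)) with crossing-items (crosses S) items
  ... | F , len , covers = ≮⇒≥ λ lt → contra (connected F (≤-trans (≤-reflexive (cong suc len)) (≤-trans lt (≤-reflexive (cong (k +_) (sym (+-identityʳ k)))))) a b)
    where
    contra : (∃ λ (p : Path G a b) → Disjoint (Path.edges p) F) → ⊥
    contra (w , d) = true≢false p (trans (trans (sym (side-A S α)) (trans (side-walk S F covers (Path.walk w) d) (side-A S β))) q)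

  solution : ∃ λ (ps : All PieceAt reps) → WellCut em A k (map ends (allRoutes ps ++ insideRoutes))
  solution = solve-all reps-apart reps∉A insideRoutes (subst (WellCut em A k)
    (trans (map-++ proj₂ (pendings reps∉A) _) (cong (map proj₂ (pendings reps∉A) ++_)
      (trans (sym (map-∘ insideEdges)) (map-∘ insideEdges)))) contracted-cuts)

-- Edge-disjoint paths by splitting off

module Menger (em : ExcludedMiddle 0ℓ) (k : ℕ) {W D : Set} (H : Multigraph W D) (a b : W) (a≢b : a ≢ b) where
  open Multigraph H
  open Walks H

  Endpoint : Pred W 0ℓ
  Endpoint w = w ≡ a ⊎ w ≡ b

  open Splitting em W Endpoint k Route Route.src
  open Cuts em W Endpoint (k + k)
  open Half Route Route.src using (Good; Good-↭; μ)
  open Sets W using (crosses)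

  pair : Route → W × W
  pair ρ = Route.src ρ , Route.dst ρ

  AllCut : List Route → Set
  AllCut ρs = ∀ S → Sep S → k + k ≤ count (crosses S) (map pair ρs)

  Proper : (W → Set) → Route → Set
  Proper Q ρ = Route.src ρ ≢ Route.dst ρ × Q (Route.src ρ) × Q (Route.dst ρ)

  -- A graph on the vertices satisfying `Q` whose edges are edge-disjoint paths of `H`. Eliminated
  -- vertices are no longer ends of routes, but routes may still run through them.
  record Family (Q : W → Set) : Set where
    field
      routes   : List Route
      proper   : All (Proper Q) routes
      disjoint : AllPairs DisjointRoutes routes
      cut      : AllCut routes

  backwards : ∀ {u v} (p : Path H u v) → ∃ λ (q : Path H v u) → Path.edges q ⊆ˡ Path.edges p
  backwards p with simplify em (reverse (Path.walk p))
  ... | q , sub , _ = q , reverse-edges (Path.walk p) ∘ sub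

  turn : Route → Route
  turn ρ = route (proj₁ (backwards (Route.path ρ)))

  turn-edges : ∀ ρ → Route.edges (turn ρ) ⊆ˡ Route.edges ρ
  turn-edges ρ = proj₂ (backwards (Route.path ρ))

  shrink : ∀ (f : Route → Route) → (∀ ρ → Route.edges (f ρ) ⊆ˡ Route.edges ρ) → ∀ {ρs} →
    AllPairs DisjointRoutes ρs → AllPairs DisjointRoutes (map f ρs)
  shrink f sub ps = AllPairs-map⁺ (AllPairs.map (λ {ρ} {σ} → shrunk ρ σ) ps)
    where
    shrunk : ∀ ρ σ → DisjointRoutes ρ σ → DisjointRoutes (f ρ) (f σ)
    shrunk ρ σ d (x , y) = d (sub ρ x , sub σ y)

  -- The three terminals of a star are told apart by `P` and `R`, but only `a` and `b` are
  -- available.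
  no-star : ∀ {L M} → Split L M → ∃ λ Y → (∃ λ i → i ∈ˡ M × Y (Route.src i) ≡ true) × (∃ λ j → j ∈ˡ M × Y (Route.src j) ≡ false) ×
      (∀ {i j M′} → M ↭ i ∷ j ∷ M′ → Y (Route.src i) ≡ true → Y (Route.src j) ≡ false → Good ((Route.src i , Route.src j) ∷ L) M′)
  no-star (cross Y i j f) = Y , i , j , f
  no-star (star _ s (p , tp , pp , rp) (r , tr , pr , rr) (q , tq , pq , rq)) = ⊥-elim (go tp tr tq)
    where
    go : Endpoint p → Endpoint r → Endpoint q → ⊥
    go (inj₁ refl) (inj₁ refl) _           = true≢false pp pr
    go (inj₂ refl) (inj₂ refl) _           = true≢false pp pr
    go (inj₁ refl) (inj₂ refl) (inj₁ refl) = true≢false pp pq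
    go (inj₁ refl) (inj₂ refl) (inj₂ refl) = true≢false rr rq
    go (inj₂ refl) (inj₁ refl) (inj₁ refl) = true≢false rr rq
    go (inj₂ refl) (inj₁ refl) (inj₂ refl) = true≢false pp pq

  module Eliminate (s : W) (s∉T : ¬ Endpoint s) (Q : W → Set) where

    Q′ : W → Set
    Q′ w = Q w × w ≢ s

    Ending : Route → Set
    Ending ρ = Q′ (Route.src ρ) × Route.dst ρ ≡ s

    orient : Route → Route
    orient ρ with em {Route.src ρ ≡ s}
    ... | yes _ = turn ρ
    ... | no _  = ρ

    orient-edges : ∀ ρ → Route.edges (orient ρ) ⊆ˡ Route.edges ρ
    orient-edges ρ with em {Route.src ρ ≡ s}
    ... | yes _ = turn-edges ρ
    ... | no _  = id

    orient-crosses : ∀ S ρ → crosses S (pair (orient ρ)) ≡ crosses S (pair ρ)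
    orient-crosses S ρ with em {Route.src ρ ≡ s}
    ... | yes _ = xor-comm (S (Route.dst ρ)) (S (Route.src ρ))
    ... | no _  = refl

    orient-sort : ∀ ρ → Proper Q ρ → Ending (orient ρ) ⊎ Proper Q′ (orient ρ)
    orient-sort ρ (ne , qs , qd) with em {Route.src ρ ≡ s}
    ... | yes refl = inj₁ ((qd , ne ∘ sym) , refl)
    ... | no src≢s with em {Route.dst ρ ≡ s}
    ...   | yes eq = inj₁ ((qs , src≢s) , eq)
    ...   | no dst≢s = inj₂ (ne , (qs , src≢s) , (qd , dst≢s))

    sort : ∀ {ρs} → All (λ ρ → Ending ρ ⊎ Proper Q′ ρ) ρs →
      ∃₂ λ Ms Ls → ρs ↭ Ms ++ Ls × All Ending Ms × All (Proper Q′) Ls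
    sort [] = [] , [] , refl , [] , []
    sort {ρ ∷ _} (inj₁ e ∷ xs) with sort xs
    ... | Ms , Ls , σ , es , ps = ρ ∷ Ms , Ls , prep ρ σ , e ∷ es , ps
    sort {ρ ∷ _} (inj₂ p ∷ xs) with sort xs
    ... | Ms , Ls , σ , es , ps = Ms , ρ ∷ Ls , ↭-trans (prep ρ σ) (↭-sym (shift ρ Ms Ls)) , es , p ∷ ps

    joined : ∀ ρ σ → Route.dst ρ ≡ s → Route.dst σ ≡ s → ∃ λ (p : Path H (Route.src ρ) (Route.src σ)) →
      ∀ {e} → e ∈ˡ Path.edges p → e ∈ˡ Route.edges ρ ⊎ e ∈ˡ Route.edges σ
    joined ρ σ refl eq with Route.dst σ | Route.path σ
    joined ρ σ refl refl | _ | q with simplify em (Path.walk (Route.path ρ) ⊙ reverse (Path.walk q))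
    ... | p , sub , _ = p , λ e∈ → back (⊙-edges (Path.walk (Route.path ρ)) _ (sub e∈))
      where
      back : ∀ {e} → e ∈ˡ Route.edges ρ ⊎ e ∈ˡ walkEdges H (reverse (Path.walk q)) → e ∈ˡ Route.edges ρ ⊎ e ∈ˡ Path.edges q
      back (inj₁ x) = inj₁ x
      back (inj₂ x) = inj₂ (reverse-edges (Path.walk q) x)

    permute : ∀ {ρs σs} → ρs ↭ σs → AllPairs DisjointRoutes ρs → AllPairs DisjointRoutes σs
    permute = AllPairs-↭ (λ {ρ} {σ} → DisjointRoutes-sym {ρ} {σ})

    -- The routes ending at `s` act as half-edges there: a deleted one is discarded, and a split
    -- pair is concatenated at `s`. The ends of the new route differ because they lie on different
    -- sides of `Y`.
    absorb : ∀ n Ms Ls → length Ms ≤ n → All Ending Ms → All (Proper Q′) Ls → AllPairs DisjointRoutes (Ms ++ Ls) →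
      Good (map pair Ls) Ms → Family Q′
    absorb n [] Ls _ _ proper disjoint good = record
      { routes = Ls ; proper = proper ; disjoint = disjoint
      ; cut = λ S s → ≤-trans (good S s) (≤-reflexive (+-identityʳ _)) }
    absorb (suc n) Ms@(m₀ ∷ _) Ls le ending proper disjoint good with reduce {map pair Ls} good
    ... | inj₁ (i , M′ , σ , g) = absorb n M′ Ls (≤-pred (≤-trans (≤-reflexive (sym (↭-length σ))) le))
          (All.tail (All-resp-↭ σ ending)) proper (tail (permute (++⁺ʳ Ls σ) disjoint)) g
    ... | inj₂ tight with no-star (split {map pair Ls} good tight (m₀ , here refl))
    ...   | Y , (i , i∈ , yi) , (j , j∈ , yj) , liftable with ∈∈⇒↭ i∈ j∈ (λ { refl → true≢false yi yj })
    ...     | M′ , σ with All-resp-↭ σ ending | permute (++⁺ʳ Ls σ) disjoint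
    ...       | (qi , di) ∷ (qj , dj) ∷ ending′ | (_ ∷ i#) ∷ j# ∷ rest = absorb n M′ (ρ ∷ Ls)
          (≤-trans (n≤1+n _) (≤-pred (≤-trans (≤-reflexive (sym (↭-length σ))) le))) ending′
          (((λ eq → true≢false yi (trans (cong Y eq) yj)) , qi , qj) ∷ proper)
          (permute (↭-sym (shift ρ M′ Ls)) (All.zipWith (λ {τ} → apart {τ}) (i# , j#) ∷ rest))
          (liftable σ yi yj)
      where
      ρ : Route
      ρ = route (proj₁ (joined i j di dj))
      apart : ∀ {τ} → DisjointRoutes i τ × DisjointRoutes j τ → DisjointRoutes ρ τ
      apart (x , y) (e∈ , f∈) with proj₂ (joined i j di dj) e∈
      ... | inj₁ p = x (p , f∈)
      ... | inj₂ p = y (p , f∈)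

    without : (W → Bool) → W → Bool
    without S w with em {w ≡ s}
    ... | yes _ = false
    ... | no _  = S w

    without-≢ : ∀ S {w} → w ≢ s → without S w ≡ S w
    without-≢ S {w} ne with em {w ≡ s}
    ... | yes eq = ⊥-elim (ne eq)
    ... | no _   = refl

    without-s : ∀ S {w} → w ≡ s → without S w ≡ false
    without-s S {w} eq with em {w ≡ s}
    ... | yes _ = refl
    ... | no ne = ⊥-elim (ne eq)

    eliminate : Family Q → Family Q′
    eliminate F with sort (All-map⁺ (All.map (λ {ρ} → orient-sort ρ) (Family.proper F)))
    ... | Ms , Ls , σ , ending , proper = absorb (length Ms) Ms Ls ≤-refl ending proper
          (permute σ (shrink orient orient-edges disjoint))
          λ S sS → ≤-trans (cut (without S) (sep′ S sS)) (≤-reflexive (trans (same S) (counted S)))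
      where
      open Family F using (routes; disjoint; cut)
      sep′ : ∀ S → Sep S → Sep (without S)
      sep′ S ((a , α , p) , (b , β , q)) =
        (a , α , trans (without-≢ S (λ { refl → s∉T α })) p) , (b , β , trans (without-≢ S (λ { refl → s∉T β })) q)
      same : ∀ S → count (crosses (without S)) (map pair routes) ≡ count (crosses (without S)) (map pair (Ms ++ Ls))
      same S = trans (count-map pair _ routes) (trans (count-cong routes (λ {ρ} _ → sym (orient-crosses (without S) ρ)))
        (trans (sym (count-map orient _ routes)) (trans (sym (count-map pair _ (map orient routes)))
        (count-↭ _ (map⁺ pair σ)))))
      counted : ∀ S → count (crosses (without S)) (map pair (Ms ++ Ls)) ≡ count (crosses S) (map pair Ls) + μ Ms S
      counted S = trans (cong (count _) (map-++ pair Ms Ls)) (trans (count-++ _ (map pair Ms) (map pair Ls))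
        (trans (+-comm (count (crosses (without S)) (map pair Ms)) _) (cong₂ _+_
          (trans (count-map pair _ Ls) (trans (count-cong Ls (λ {ρ} ρ∈ → L-crosses {ρ} (All.lookup proper ρ∈))) (sym (count-map pair _ Ls))))
          (trans (count-map pair _ Ms) (count-cong Ms (λ {ρ} ρ∈ → M-crosses {ρ} (All.lookup ending ρ∈)))))))
        where
        L-crosses : ∀ {ρ} → Proper Q′ ρ → crosses (without S) (pair ρ) ≡ crosses S (pair ρ)
        L-crosses (_ , (_ , x) , (_ , y)) = cong₂ _xor_ (without-≢ S x) (without-≢ S y)
        M-crosses : ∀ {ρ} → Ending ρ → crosses (without S) (pair ρ) ≡ S (Route.src ρ)
        M-crosses ((_ , x) , y) = trans (cong₂ _xor_ (without-≢ S x) (without-s S y)) (xor-identityʳ _)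

  relax : ∀ {Q R : W → Set} → (∀ {w} → Q w → R w) → Family Q → Family R
  relax f F = record { routes = routes ; proper = All.map (λ (ne , x , y) → ne , f x , f y) proper ; disjoint = disjoint ; cut = cut }
    where open Family F

  eliminate-all : ∀ vs {Q} → Family Q → Family (λ w → Q w × (w ∈ˡ vs → Endpoint w))
  eliminate-all []       F = relax (λ q → q , λ ()) F
  eliminate-all (v ∷ vs) {Q} F with em {Endpoint v}
  ... | yes tv = relax (λ (q , f) → q , λ { (here refl) → tv ; (there i) → f i }) (eliminate-all vs F)
  ... | no ¬tv = relax (λ ((q , ne) , f) → q , λ { (here eq) → ⊥-elim (ne eq) ; (there i) → f i })
                   (eliminate-all vs (Eliminate.eliminate v ¬tv Q F))

  menger : (vs : List W) → (∀ w → w ∈ˡ vs) → (ds : List D) → Unique ds →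
    (∀ S → Sep S → k + k ≤ count (λ f → S (end₁ f) xor S (end₂ f)) ds) → EdgeDisjointPaths H a b (k + k)
  menger vs complete ds unique cuts = (λ i → proj₁ (ab i)) , λ i j ne (x , y) →
      AllPairs-lookup (λ {ρ} {σ} → DisjointRoutes-sym {ρ} {σ}) disjoint (inject≤ i size) (inject≤ j size)
        (λ eq → ne (inject≤-injective size size i j eq)) (proj₂ (ab i) x , proj₂ (ab j) y)
    where
    -- The condition on ends is empty at the start: it is the constant type `W`, inhabited by `a`.
    start : Family (λ _ → W)
    start = record
      { routes = map single ds
      ; proper = All-map⁺ (All.tabulate (λ {f} _ → loopless f , a , a))
      ; disjoint = AllPairs-map⁺ (AllPairs.map single-disjoint unique)
      ; cut = λ S s → ≤-trans (cuts S s) (≤-reflexive (sym (trans (count-map pair _ (map single ds)) (count-map single _ ds)))) }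
    open Family (eliminate-all vs start)
    isA : W → Bool
    isA w = does (em {w ≡ a})
    isA-a : isA a ≡ true
    isA-a = dec-true em refl
    isA-b : isA b ≡ false
    isA-b = dec-false em (a≢b ∘ sym)
    -- By now every route joins `a` and `b`; the cut condition for the set consisting of `a` bounds
    -- their number from below.
    size : k + k ≤ length routes
    size = ≤-trans (cut isA ((a , inj₁ refl , isA-a) , (b , inj₂ refl , isA-b)))
      (≤-trans (≤-reflexive (count-map pair _ routes)) (count≤length _ routes))
    oriented : ∀ ρ → Proper (λ w → W × (w ∈ˡ vs → Endpoint w)) ρ → ∃ λ (p : Path H a b) → Path.edges p ⊆ˡ Route.edges ρ
    oriented ρ (ne , (_ , x) , (_ , y)) with x (complete _) | y (complete _)
    ... | inj₁ refl | inj₁ refl = ⊥-elim (ne refl)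
    ... | inj₁ refl | inj₂ refl = Route.path ρ , id
    ... | inj₂ refl | inj₁ refl = backwards (Route.path ρ)
    ... | inj₂ refl | inj₂ refl = ⊥-elim (ne refl)
    ab : ∀ i → ∃ λ (p : Path H a b) → Path.edges p ⊆ˡ Route.edges (lookup routes (inject≤ i size))
    ab i = oriented (lookup routes (inject≤ i size)) (All.lookup proper (∈-lookup (inject≤ i size)))

-- The immersed multigraph

edge-disjoint-bound : {W : Set} {m : ℕ} (H : Multigraph W (Fin m)) {a b : W} → a ≢ b → ∀ n → EdgeDisjointPaths H a b n → n ≤ m
edge-disjoint-bound H {a} {b} a≢b n (P , dis) = injective⇒≤ {f = λ i → proj₁ (firsts i)} inj
  where
  first : (p : Path H a b) → ∃ λ e → e ∈ˡ Path.edges p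
  first p with Path.walk p
  ... | stop       = ⊥-elim (a≢b refl)
  ... | step e _ _ = e , here refl
  firsts : ∀ i → ∃ λ e → e ∈ˡ Path.edges (P i)
  firsts i = first (P i)
  inj : Injective _≡_ _≡_ (λ i → proj₁ (firsts i))
  inj {i} {j} eq with i ≟ j
  ... | yes i≡j = i≡j
  ... | no i≢j = ⊥-elim (dis i j i≢j (proj₂ (firsts i) , subst (_∈ˡ Path.edges (P j)) (sym eq) (proj₂ (firsts j))))

module Realise (em : ExcludedMiddle 0ℓ) {V E : Set} (G : Multigraph V E)
  (vs : List V) (vs-unique : Unique vs) (ρs : List (Walks.Route G))
  (proper : ∀ {ρ} → ρ ∈ˡ ρs → Walks.Route.src ρ ∈ˡ vs × Walks.Route.dst ρ ∈ˡ vs × Walks.Route.src ρ ≢ Walks.Route.dst ρ)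
  (disjoint : AllPairs (Walks.DisjointRoutes G) ρs) where
  open Walks G

  n m : ℕ
  n = length vs
  m = length ρs

  at : Fin m → Route
  at = lookup ρs

  at-src : ∀ f → Route.src (at f) ∈ˡ vs
  at-src f = proj₁ (proper (∈-lookup f))

  at-dst : ∀ f → Route.dst (at f) ∈ˡ vs
  at-dst f = proj₁ (proj₂ (proper (∈-lookup f)))

  H : Multigraph (Fin n) (Fin m)
  H = record
    { end₁ = λ f → index (at-src f)
    ; end₂ = λ f → index (at-dst f)
    ; loopless = λ f eq → proj₂ (proj₂ (proper (∈-lookup f)))
        (trans (lookup-index (at-src f)) (trans (cong (lookup vs) eq) (sym (lookup-index (at-dst f))))) }

  open Multigraph H

  branch-injective : Injective _≡_ _≡_ (lookup vs)
  branch-injective {i} {j} eq with i ≟ j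
  ... | yes i≡j = i≡j
  ... | no i≢j = ⊥-elim (AllPairs-lookup (λ ne → ne ∘ sym) vs-unique i j i≢j eq)

  transport : ∀ {u v u′ v′} → u ≡ u′ → v ≡ v′ → Path G u v → Path G u′ v′
  transport refl refl p = p

  transport-edges : ∀ {u v u′ v′} (a : u ≡ u′) (b : v ≡ v′) (p : Path G u v) → Path.edges (transport a b p) ≡ Path.edges p
  transport-edges refl refl p = refl

  path : ∀ f → Path G (lookup vs (end₁ f)) (lookup vs (end₂ f))
  path f = transport (lookup-index (at-src f)) (lookup-index (at-dst f)) (Route.path (at f))

  path-edges : ∀ f → Path.edges (path f) ≡ Route.edges (at f)
  path-edges f = transport-edges (lookup-index (at-src f)) (lookup-index (at-dst f)) (Route.path (at f))

  immersion : Immersion H G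
  immersion = record
    { branch = lookup vs ; distinct = branch-injective ; route = path
    ; edgeDisjoint = λ f g ne → subst₂ Disjoint (sym (path-edges f)) (sym (path-edges g))
        (AllPairs-lookup (λ {ρ} {σ} → DisjointRoutes-sym {ρ} {σ}) disjoint f g ne) }

  open Immersion immersion using (branch; BranchSet)

  branchSet : BranchSet ≐ (_∈ˡ vs)
  branchSet = (λ { (x , refl) → ∈-lookup x }) , λ v∈ → index v∈ , sym (lookup-index v∈)

  touches? : ∀ v ρ → Dec (Route.src ρ ≡ v ⊎ Route.dst ρ ≡ v)
  touches? v ρ = em

  degree-count : ∀ x → degree H x ≡ count (λ ρ → does (touches? (branch x) ρ)) ρs
  degree-count x = trans (length-filter (incident? H x) (allFin m)) (trans
    (count-cong (allFin m) λ {f} _ → does-⇔ (mk⇔ (to f) (from f)) (incident? H x f) (touches? (branch x) (at f)))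
    (count-lookup _ ρs))
    where
    to : ∀ f → end₁ f ≡ x ⊎ end₂ f ≡ x → Route.src (at f) ≡ branch x ⊎ Route.dst (at f) ≡ branch x
    to f (inj₁ refl) = inj₁ (lookup-index (at-src f))
    to f (inj₂ refl) = inj₂ (lookup-index (at-dst f))
    from : ∀ f → Route.src (at f) ≡ branch x ⊎ Route.dst (at f) ≡ branch x → end₁ f ≡ x ⊎ end₂ f ≡ x
    from f (inj₁ eq) = inj₁ (branch-injective (trans (sym (lookup-index (at-src f))) eq))
    from f (inj₂ eq) = inj₂ (branch-injective (trans (sym (lookup-index (at-dst f))) eq))

  module _ (S : Fin n → Bool) where

    extended : ∀ v → Dec (v ∈ˡ vs) → Bool
    extended v (yes v∈) = S (index v∈)
    -- The value off the branch vertices does not affect any count, since routes have both ends in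
    -- `vs`.
    extended v (no _)   = false

    extend : V → Bool
    extend v = extended v em

    extend-index : ∀ {v} (v∈ : v ∈ˡ vs) → extend v ≡ S (index v∈)
    extend-index {v} v∈ = go em
      where
      go : (dec : Dec (v ∈ˡ vs)) → extended v dec ≡ S (index v∈)
      go (yes v∈′) = cong S (branch-injective (trans (sym (lookup-index v∈′)) (lookup-index v∈)))
      go (no v∉)   = ⊥-elim (v∉ v∈)

    extend-branch : ∀ x → extend (branch x) ≡ S x
    extend-branch x = trans (extend-index (∈-lookup x)) (cong S (branch-injective (sym (lookup-index (∈-lookup {xs = vs} x)))))

    boundary-count : ℕ
    boundary-count = count (λ f → S (end₁ f) xor S (end₂ f)) (allFin m)

    boundary-extend : boundary-count ≡ count (λ ρ → extend (Route.src ρ) xor extend (Route.dst ρ)) ρs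
    boundary-extend = trans (count-cong (allFin m) λ {f} _ → sym (cong₂ _xor_ (extend-index (at-src f)) (extend-index (at-dst f))))
      (count-lookup _ ρs)

  boundary-co : ∀ S → boundary-count (not ∘ S) ≡ boundary-count S
  boundary-co S = count-cong (allFin m) λ {f} _ → Sets.crosses-co (Fin n) S (end₁ f , end₂ f)

  -- If `F` separated `u` from `v`, all boundary edges of the set reachable from `u` without `F`
  -- would belong to `F`.
  boundary≥⇒connected : ∀ ℓ → (∀ S u v → S u ≡ true → S v ≡ false → ℓ ≤ boundary-count S) → EdgeConnected H ℓ
  boundary≥⇒connected ℓ cuts F F<ℓ u v with em {∃ λ (w : Walk H u v) → Disjoint (walkEdges H w) F}
  ... | yes (w , d) with Walks.simplify H em w
  ...   | p , sub , _ = p , λ { (x , y) → d (sub x , y) }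
  boundary≥⇒connected ℓ cuts F F<ℓ u v | no unreachable = ⊥-elim (<⇒≱ F<ℓ (≤-trans
    (cuts S u v (dec-true (dec u) (stop , λ ())) (dec-false (dec v) unreachable))
    (count≤cover _ F (allFin⁺ m) λ {f} _ → crossing f)))
    where
    Reach : Fin n → Set
    Reach w = ∃ λ (q : Walk H u w) → Disjoint (walkEdges H q) F
    dec : ∀ w → Dec (Reach w)
    dec w = em
    S : Fin n → Bool
    S w = does (dec w)
    S⁻ : ∀ {w} → S w ≡ true → Reach w
    S⁻ {w} e with dec w
    ... | yes r = r
    extendR : ∀ {f w w′} → Joins H f w w′ → ¬ (f ∈ˡ F) → Reach w → Reach w′
    extendR {f} j f∉ (q , d) = Walks._⊙_ H q (step f j stop) , λ { (x , y) → off (Walks.⊙-edges H q _ x) y }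
      where
      off : ∀ {e} → e ∈ˡ walkEdges H q ⊎ e ∈ˡ f ∷ [] → e ∈ˡ F → ⊥
      off (inj₁ x) y = d (x , y)
      off (inj₂ (here refl)) y = f∉ y
    crossing : ∀ f → S (end₁ f) xor S (end₂ f) ≡ true → f ∈ˡ F
    crossing f c with em {f ∈ˡ F}
    ... | yes f∈ = f∈
    ... | no f∉ with S (end₁ f) in e₁ | S (end₂ f) in e₂
    ...   | true  | false = ⊥-elim (true≢false (dec-true (dec (end₂ f)) (extendR (inj₁ (refl , refl)) f∉ (S⁻ e₁))) e₂)
    ...   | false | true  = ⊥-elim (true≢false (dec-true (dec (end₁ f)) (extendR (inj₂ (refl , refl)) f∉ (S⁻ e₂))) e₁)

-- Gluing the pieces of different components

module Hubs (em : ExcludedMiddle 0ℓ) (k : ℕ) {V E : Set} (G : Multigraph V E)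
  (connected : EdgeConnected G (2 * k)) (lf : LocallyFinite G) (A : Pred V 0ℓ) (finA : Finite A)
  (linked : ∀ v → v ∉ A → BoundaryLinked G (SameComponent G A v)) where
  open Multigraph G
  open Walks G
  open Components em G lf A finA
  open Assembly em k G connected lf A finA linked

  hubs : ∀ {B ρs} → Pieces.Spokes G A B ρs → List V
  hubs Pieces.none                        = []
  hubs (Pieces.three {x = x} _ _ _ _ _ _ _) = x ∷ []

  hub∈B : ∀ {B ρs} (s : Pieces.Spokes G A B ρs) {x} → x ∈ˡ hubs s → x ∈ B
  hub∈B (Pieces.three x∈ _ _ _ _ _ _) (here refl) = x∈

  hubs-unique : ∀ {B ρs} (s : Pieces.Spokes G A B ρs) → Unique (hubs s)
  hubs-unique Pieces.none                    = []
  hubs-unique (Pieces.three _ _ _ _ _ _ _) = [] ∷ []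

  pieceHubs : ∀ {r} → PieceAt r → List V
  pieceHubs p = hubs (Pieces.Piece.isSpokes p)

  allHubs : ∀ {rs} → All PieceAt rs → List V
  allHubs []       = []
  allHubs (p ∷ ps) = pieceHubs p ++ allHubs ps

  hub-component : ∀ {rs} (ps : All PieceAt rs) {x} → x ∈ˡ allHubs ps → ∃ λ r → r ∈ˡ rs × Same r x
  hub-component (_∷_ {r} p ps) x∈ with ∈-++⁻ (pieceHubs p) x∈
  ... | inj₁ i = r , here refl , hub∈B (Pieces.Piece.isSpokes p) i
  ... | inj₂ i with hub-component ps i
  ...   | r′ , r′∈ , s = r′ , there r′∈ , s

  Apart : List V → Set
  Apart = AllPairs (λ r r′ → ¬ Same r r′)

  hub-apart : ∀ {r rs} → All (λ r′ → ¬ Same r r′) rs → (ps : All PieceAt rs) → ∀ {x y} → Same r x → y ∈ˡ allHubs ps → ¬ Same x y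
  hub-apart r# ps sx y∈ xy with hub-component ps y∈
  ... | r′ , r′∈ , sy = All.lookup r# r′∈ (same-trans sx (same-trans xy (same-sym sy)))

  one-hub : ∀ {B ρs} (s : Pieces.Spokes G A B ρs) {x y} → x ∈ˡ hubs s → y ∈ˡ hubs s → x ≡ y
  one-hub (Pieces.three _ _ _ _ _ _ _) (here refl) (here refl) = refl

  hubs-separate : ∀ {rs} → Apart rs → (ps : All PieceAt rs) → ∀ {x y} → x ∈ˡ allHubs ps → y ∈ˡ allHubs ps → Same x y → x ≡ y
  hubs-separate (r# ∷ ap) (p ∷ ps) x∈ y∈ s with ∈-++⁻ (pieceHubs p) x∈ | ∈-++⁻ (pieceHubs p) y∈
  ... | inj₁ i | inj₁ j = one-hub (Pieces.Piece.isSpokes p) i j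
  ... | inj₁ i | inj₂ j = ⊥-elim (hub-apart r# ps (hub∈B (Pieces.Piece.isSpokes p) i) j s)
  ... | inj₂ i | inj₁ j = ⊥-elim (hub-apart r# ps (hub∈B (Pieces.Piece.isSpokes p) j) i (same-sym s))
  ... | inj₂ i | inj₂ j = hubs-separate ap ps i j s

  allHubs-unique : ∀ {rs} → Apart rs → (ps : All PieceAt rs) → Unique (allHubs ps)
  allHubs-unique [] [] = []
  allHubs-unique (r# ∷ ap) (p ∷ ps) = Unique-++⁺ (hubs-unique (Pieces.Piece.isSpokes p)) (allHubs-unique ap ps)
    λ { {x} (i , j) → hub-apart r# ps (hub∈B (Pieces.Piece.isSpokes p) i) j (same-refl (same-end (hub∈B (Pieces.Piece.isSpokes p) i))) }

  Placed : List V → Route → Set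
  Placed xs ρ = Route.src ρ ∈ A × (Route.dst ρ ∈ A ⊎ Route.dst ρ ∈ˡ xs) × Route.src ρ ≢ Route.dst ρ

  piece-placed : ∀ {r} (p : PieceAt r) → All (Placed (pieceHubs p)) (Pieces.Piece.routes p)
  piece-placed p = All-++⁺ (spokes-placed (Pieces.Piece.isSpokes p))
      (All.map (λ { (a , b , ne) → a , inj₁ b , ne }) (Pieces.Piece.isLinks p))
    where
    spokes-placed : ∀ {ρs} (s : Pieces.Spokes G A (Same _) ρs) → All (Placed (hubs s)) ρs
    spokes-placed Pieces.none = []
    spokes-placed (Pieces.three {x = x} x∈ a b c _ _ _) = spoke a ∷ spoke b ∷ spoke c ∷ []
      where
      spoke : ∀ {a} → a ∈ A → a ∈ A × (x ∈ A ⊎ x ∈ˡ x ∷ []) × a ≢ x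
      spoke a∈ = a∈ , inj₂ (here refl) , λ { refl → same-end x∈ a∈ }

  placed-mono : ∀ {xs ys} → (∀ {x} → x ∈ˡ xs → x ∈ˡ ys) → ∀ {ρ} → Placed xs ρ → Placed ys ρ
  placed-mono sub (a , inj₁ b , ne) = a , inj₁ b , ne
  placed-mono sub (a , inj₂ x , ne) = a , inj₂ (sub x) , ne

  all-placed : ∀ {rs} (ps : All PieceAt rs) → All (Placed (allHubs ps)) (allRoutes ps)
  all-placed []       = []
  all-placed (p ∷ ps) = All-++⁺ (All.map (λ {ρ} → placed-mono ∈-++⁺ˡ {ρ}) (piece-placed p))
                                (All.map (λ {ρ} → placed-mono (∈-++⁺ʳ (pieceHubs p)) {ρ}) (all-placed ps))

  Touching : V → E → Set
  Touching r e = Same r (end₁ e) ⊎ Same r (end₂ e)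

  -- An edge with both ends outside A stays in one component. This makes routes of different pieces
  -- edge-disjoint, as each of their edges has an end in its own component.
  touch-one : ∀ {r r′ e} → ¬ Same r r′ → Touching r e → Touching r′ e → ⊥
  touch-one n (inj₁ x) (inj₁ y) = n (same-trans x (same-sym y))
  touch-one n (inj₂ x) (inj₂ y) = n (same-trans x (same-sym y))
  touch-one n (inj₁ x) (inj₂ y) = n (same-trans x (same-trans (same-step (inj₁ (refl , refl)) (same-end x) (same-end y)) (same-sym y)))
  touch-one n (inj₂ x) (inj₁ y) = n (same-trans x (same-trans (same-step (inj₂ (refl , refl)) (same-end x) (same-end y)) (same-sym y)))

  all-touching : ∀ {rs} (ps : All PieceAt rs) {ρ e} → ρ ∈ˡ allRoutes ps → e ∈ˡ Route.edges ρ → ∃ λ r → r ∈ˡ rs × Touching r e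
  all-touching (_∷_ {r} p ps) ρ∈ e∈ with ∈-++⁻ (Pieces.Piece.routes p) ρ∈
  ... | inj₁ i = r , here refl , All.lookup (Pieces.Piece.touching p) i e∈
  ... | inj₂ i with all-touching ps i e∈
  ...   | r′ , r′∈ , t = r′ , there r′∈ , t

  all-disjoint : ∀ {rs} → Apart rs → (ps : All PieceAt rs) → AllPairs DisjointRoutes (allRoutes ps)
  all-disjoint [] [] = []
  all-disjoint (r# ∷ ap) (p ∷ ps) = AllPairs-++⁺ (Pieces.Piece.disjoint p) (all-disjoint ap ps)
      (All.tabulate λ {ρ} ρ∈ → All.tabulate λ {σ} σ∈ → apart ρ σ ρ∈ σ∈)
    where
    apart : ∀ ρ σ → ρ ∈ˡ Pieces.Piece.routes p → σ ∈ˡ allRoutes ps → DisjointRoutes ρ σ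
    apart ρ σ ρ∈ σ∈ (x , y) with all-touching ps σ∈ y
    ... | r′ , r′∈ , t = touch-one (All.lookup r# r′∈) (All.lookup (Pieces.Piece.touching p) ρ∈ x) t

  AtHub : V → Route → Set
  AtHub x ρ = Route.src ρ ≡ x ⊎ Route.dst ρ ≡ x

  atHub : V → Route → Bool
  atHub x ρ = does (em {AtHub x ρ})

  off-hub : ∀ {x xs ρ} → x ∉ A → x ∉ˡ xs → Placed xs ρ → atHub x ρ ≡ false
  off-hub {x} {xs} {ρ} x∉A x∉ (a , d , _) = dec-false em (no′ d)
    where
    no′ : Route.dst ρ ∈ A ⊎ Route.dst ρ ∈ˡ xs → ¬ AtHub x ρ
    no′ _        (inj₁ refl) = x∉A a
    no′ (inj₁ b) (inj₂ refl) = x∉A b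
    no′ (inj₂ i) (inj₂ refl) = x∉ i

  -- Apart from the three spokes, the routes of the same piece end in A, and those of other pieces
  -- end in A or at hubs of other components.
  hub-degree : ∀ {rs} → Apart rs → (ps : All PieceAt rs) → ∀ {x} → x ∈ˡ allHubs ps → count (atHub x) (allRoutes ps) ≡ 3
  hub-degree {r ∷ _} (r# ∷ ap) (p ∷ ps) {x} x∈ with ∈-++⁻ (pieceHubs p) x∈
  ... | inj₁ i = trans (count-++ (atHub x) (Pieces.Piece.routes p) (allRoutes ps)) (cong₂ _+_
        (trans (count-++ (atHub x) (Pieces.Piece.spokes p) (Pieces.Piece.links p)) (cong₂ _+_ (spokes-at (Pieces.Piece.isSpokes p) i)
          (count-none (atHub x) (Pieces.Piece.links p) λ {ρ} ρ∈ → off-hub {xs = []} {ρ = ρ} x∉A (λ ()) (link-placed {ρ} (All.lookup (Pieces.Piece.isLinks p) ρ∈)))))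
        (count-none (atHub x) (allRoutes ps) λ {ρ} ρ∈ → off-hub {ρ = ρ} x∉A
          (λ j → hub-apart r# ps x∈B j (same-refl x∉A)) (All.lookup (all-placed ps) ρ∈)))
    where
    x∈B = hub∈B (Pieces.Piece.isSpokes p) i
    x∉A : x ∉ A
    x∉A = same-end x∈B
    link-placed : ∀ {ρ} → Pieces.Linking G A (Same r) ρ → Placed [] ρ
    link-placed (a , b , ne) = a , inj₁ b , ne
    spokes-at : ∀ {ρs} (s : Pieces.Spokes G A (Same r) ρs) → x ∈ˡ hubs s → count (atHub x) ρs ≡ 3
    spokes-at (Pieces.three _ _ _ _ p q r) (here refl) = count-full (atHub x) (route p ∷ route q ∷ route r ∷ [])
      λ { (here refl) → dec-true em (inj₂ refl) ; (there (here refl)) → dec-true em (inj₂ refl) ; (there (there (here refl))) → dec-true em (inj₂ refl) }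
  ... | inj₂ i = trans (count-++ (atHub x) (Pieces.Piece.routes p) (allRoutes ps)) (cong₂ _+_
        (count-none (atHub x) (Pieces.Piece.routes p) λ {ρ} ρ∈ → off-hub {ρ = ρ} x∉A
          (λ j → hub-apart r# ps (hub∈B (Pieces.Piece.isSpokes p) j) i (same-refl x∉A)) (All.lookup (piece-placed p) ρ∈))
        (hub-degree ap ps i))
    where
    x∉A : x ∉ A
    x∉A = same-end (proj₂ (proj₂ (hub-component ps i)))

-- Degrees and connectivity of the immersed multigraph

module Conclusion (em : ExcludedMiddle 0ℓ) (k : ℕ) (2≤k : 2 ≤ k) {V E : Set} (G : Multigraph V E)
  (connected : EdgeConnected G (2 * k)) (lf : LocallyFinite G) (A : Pred V 0ℓ) (finA : Finite A)
  (linked : ∀ v → v ∉ A → BoundaryLinked G (SameComponent G A v))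
  {reps : List V} (reps-apart : Hubs.Apart em k G connected lf A finA linked reps)
  (pieces : All (Assembly.PieceAt em k G connected lf A finA linked) reps)
  (well-cut : WellCut em A k (map (Walks.ends G)
    (Assembly.allRoutes em k G connected lf A finA linked pieces ++ Assembly.insideRoutes em k G connected lf A finA linked))) where
  open Multigraph G
  open Walks G
  open Components em G lf A finA
  open Assembly em k G connected lf A finA linked using (allRoutes; selected; insideRoutes; insideEdges-complete)
  open Hubs em k G connected lf A finA linked

  X : List V
  X = allHubs pieces

  X∉A : ∀ {x} → x ∈ˡ X → x ∉ A
  X∉A x∈ = same-end (proj₂ (proj₂ (hub-component pieces x∈)))

  selectedA = select em A (proj₁ finA)

  vertices : List V
  vertices = proj₁ selectedA ++ X

  A⇒vertex : ∀ {v} → v ∈ A → v ∈ˡ vertices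
  A⇒vertex v∈ = ∈-++⁺ˡ (proj₂ (proj₂ (proj₂ selectedA)) (proj₁ (proj₂ finA) v∈) v∈)

  vertex⁻ : ∀ {v} → v ∈ˡ vertices → v ∈ A ⊎ v ∈ˡ X
  vertex⁻ v∈ with ∈-++⁻ (proj₁ selectedA) v∈
  ... | inj₁ i = inj₁ (proj₁ (proj₂ (proj₂ selectedA)) i)
  ... | inj₂ i = inj₂ i

  vertices-unique : Unique vertices
  vertices-unique = Unique-++⁺ (proj₁ (proj₂ selectedA)) (allHubs-unique reps-apart pieces)
    λ (i , j) → X∉A j (proj₁ (proj₂ (proj₂ selectedA)) i)

  inside⁻ : ∀ {ρ} → ρ ∈ˡ insideRoutes → ∃ λ e → e ∈ Inside G A × ρ ≡ single e
  inside⁻ ρ∈ with ∈-map⁻ single ρ∈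
  ... | e , e∈ , eq = e , proj₁ (proj₂ (proj₂ selected)) e∈ , eq

  routes : List Route
  routes = allRoutes pieces ++ insideRoutes

  routes-placed : ∀ {ρ} → ρ ∈ˡ routes → Placed X ρ
  routes-placed {ρ} ρ∈ with ∈-++⁻ (allRoutes pieces) ρ∈
  ... | inj₁ i = All.lookup (all-placed pieces) i
  ... | inj₂ i with inside⁻ i
  ...   | e , (a , b) , refl = a , inj₁ b , loopless e

  routes-proper : ∀ {ρ} → ρ ∈ˡ routes → Route.src ρ ∈ˡ vertices × Route.dst ρ ∈ˡ vertices × Route.src ρ ≢ Route.dst ρ
  routes-proper ρ∈ with routes-placed ρ∈
  ... | a , inj₁ b , ne = A⇒vertex a , A⇒vertex b , ne
  ... | a , inj₂ x , ne = A⇒vertex a , ∈-++⁺ʳ (proj₁ selectedA) x , ne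

  routes-disjoint : AllPairs DisjointRoutes routes
  routes-disjoint = AllPairs-++⁺ (all-disjoint reps-apart pieces)
      (AllPairs-map⁺ (AllPairs.map single-disjoint (proj₁ (proj₂ selected))))
      (All.tabulate λ {ρ} ρ∈ → All.tabulate λ {σ} σ∈ → apart ρ σ ρ∈ σ∈)
    where
    apart : ∀ ρ σ → ρ ∈ˡ allRoutes pieces → σ ∈ˡ insideRoutes → DisjointRoutes ρ σ
    apart ρ σ ρ∈ σ∈ (x , y) with inside⁻ σ∈ | all-touching pieces ρ∈ x
    apart ρ σ ρ∈ σ∈ (x , here refl) | e , (a , b) , refl | r , _ , inj₁ t = same-end t a
    apart ρ σ ρ∈ σ∈ (x , here refl) | e , (a , b) , refl | r , _ , inj₂ t = same-end t b

  open Realise em G vertices vertices-unique routes routes-proper routes-disjoint public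
  open Immersion immersion using (branch; BranchSet) public

  degree-at : ∀ {x} → x ∈ˡ X → count (atHub x) routes ≡ 3
  degree-at {x} x∈ = trans (count-++ (atHub x) (allRoutes pieces) insideRoutes)
    (cong₂ _+_ (hub-degree reps-apart pieces x∈) (count-none (atHub x) insideRoutes λ {ρ} ρ∈ → off-hub {xs = []} {ρ = ρ} (X∉A x∈) (λ ()) (only ρ∈)))
    where
    only : ∀ {ρ} → ρ ∈ˡ insideRoutes → Placed [] ρ
    only ρ∈ with inside⁻ ρ∈
    ... | e , (a , b) , refl = a , inj₁ b , loopless e

  degree-3 : ∀ x → branch x ∈ˡ X → degree H x ≡ 3
  degree-3 x x∈ = trans (degree-count x) (degree-at x∈)

  branchSet-A∪X : BranchSet ≐ A ∪ (_∈ˡ X)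
  branchSet-A∪X = (λ v∈ → vertex⁻ (proj₁ branchSet v∈)) , λ
    { (inj₁ a) → proj₂ branchSet (A⇒vertex a) ; (inj₂ x) → proj₂ branchSet (∈-++⁺ʳ (proj₁ selectedA) x) }

  2k≤boundary : ∀ S {a b} → branch a ∈ A → branch b ∈ A → S a ≡ true → S b ≡ false → k + k ≤ boundary-count S
  2k≤boundary S {a} {b} αa αb sa sb = ≤-trans (well-cut tagged
      ((inj₁ (branch a) , αa , trans (extend-branch S a) sa) , (inj₁ (branch b) , αb , trans (extend-branch S b) sb)))
    (≤-reflexive (trans (count-map ends _ routes) (sym (boundary-extend S))))
    where
    tagged : V ⊎ V → Bool
    tagged (inj₁ v) = extend S v
    tagged (inj₂ _) = false

  -- Every route starts in A, so the three routes at the hub `branch u` all leave `S`.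
  3≤boundary : ∀ S u → S u ≡ true → (∀ {a} → branch a ∈ A → S a ≡ false) → 3 ≤ boundary-count S
  3≤boundary S u su outA with vertex⁻ (∈-lookup u)
  ... | inj₁ α = ⊥-elim (true≢false su (outA α))
  ... | inj₂ x∈ = ≤-trans (≤-reflexive (sym (degree-at x∈)))
        (≤-trans (count-mono-∈ _ _ λ {ρ} ρ∈ → crosses-at ρ ρ∈) (≤-reflexive (sym (boundary-extend S))))
    where
    x : V
    x = branch u
    A-false : ∀ {v} → v ∈ A → extend S v ≡ false
    A-false v∈ = trans (extend-index S (A⇒vertex v∈)) (outA (subst A (lookup-index (A⇒vertex v∈)) v∈))
    crosses-at : ∀ ρ → ρ ∈ˡ routes → atHub x ρ ≡ true → extend S (Route.src ρ) xor extend S (Route.dst ρ) ≡ true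
    crosses-at ρ ρ∈ at with em {AtHub x ρ} | routes-placed ρ∈
    ... | yes (inj₁ eq) | a , _ = ⊥-elim (X∉A x∈ (subst A eq a))
    ... | yes (inj₂ eq) | a , _ = cong₂ _xor_ (A-false a) (trans (cong (extend S) eq) (trans (extend-branch S u) su))

  3-connected : EdgeConnected H 3
  3-connected = boundary≥⇒connected 3 cuts
    where
    cuts : ∀ S u v → S u ≡ true → S v ≡ false → 3 ≤ boundary-count S
    cuts S u v su sv with em {∃ λ a → branch a ∈ A × S a ≡ true} | em {∃ λ b → branch b ∈ A × S b ≡ false}
    -- A cut separating A has at least 2k ≥ 4 edges. Otherwise `S` or its complement misses A and
    -- contains a hub.
    ... | yes (a , αa , sa) | yes (b , αb , sb) = ≤-trans (≤-trans (n≤1+n 3) (+-mono-≤ 2≤k 2≤k)) (2k≤boundary S αa αb sa sb)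
    ... | no none | _ = 3≤boundary S u su (λ α → ≢true (λ t → none (_ , α , t)))
    ... | yes _ | no none = ≤-trans (3≤boundary (not ∘ S) v (not-true sv) (λ {a} α → not-false (≢false (λ f → none (a , α , f)))))
          (≤-reflexive (boundary-co S))
      where
      ≢false : ∀ {b} → ¬ (b ≡ false) → b ≡ true
      ≢false {true}  n = refl
      ≢false {false} n = ⊥-elim (n refl)

  -- The maximum exists because edge-disjoint paths between distinct vertices have distinct first
  -- edges, so there are at most `m` of them; `menger` supplies 2k to start from.
  local-connectivity : ∀ a b → a ≢ b → branch a ∈ A → branch b ∈ A → ∃[ l ] (IsLocalEdgeConnectivity H a b l × 2 * k ≤ l)
  local-connectivity a b a≢b αa αb = conclude
      (maximum em (EdgeDisjointPaths H a b) id m (edge-disjoint-bound H a≢b) (k + k) paths)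
    where
    open Menger em k H a b a≢b using (Endpoint; menger)
    terminal : ∀ {x} → Endpoint x → branch x ∈ A
    terminal (inj₁ refl) = αa
    terminal (inj₂ refl) = αb
    paths : EdgeDisjointPaths H a b (k + k)
    paths = menger (allFin n) ∈-allFin (allFin m) (allFin⁺ m)
      λ S ((x , tx , sx) , (y , ty , sy)) → 2k≤boundary S (terminal tx) (terminal ty) sx sy
    conclude : (∃ λ l → EdgeDisjointPaths H a b l × (∀ n → EdgeDisjointPaths H a b n → n ≤ l)) →
      ∃[ l ] (IsLocalEdgeConnectivity H a b l × 2 * k ≤ l)
    conclude (l , ps , max) = l , (ps , max) , ≤-trans (≤-reflexive (cong (k +_) (+-identityʳ k))) (max (k + k) paths)

  inside-kept : ∀ e → e ∈ Inside G A → ∃[ f ] Path.edges (path f) ≡ e ∷ []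
  inside-kept e ins = index ρ∈ , trans (path-edges (index ρ∈)) (cong Route.edges (sym (lookup-index ρ∈)))
    where
    ρ∈ : single e ∈ˡ routes
    ρ∈ = ∈-++⁺ʳ (allRoutes pieces) (∈-map⁺ single (insideEdges-complete ins))

theorem3p2 : ExcludedMiddle 0ℓ →
    (k : ℕ) → 2 ≤ k →
    (V E : Set) (G : Multigraph V E) →
    EdgeConnected G (2 * k) → LocallyFinite G →
    (A : Pred V 0ℓ) → Finite A →
    (∀ v → v ∉ A → BoundaryLinked G (SameComponent G A v)) →
    Σ[ X ∈ Pred V 0ℓ ]
    X ⊆ ∁ A ×
    (∀ x y → x ∈ X → y ∈ X → SameComponent G A x y → x ≡ y) ×
    (Σ[ n ∈ ℕ ] Σ[ m ∈ ℕ ] Σ[ H ∈ Multigraph (Fin n) (Fin m) ]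
    Σ[ I ∈ Immersion H G ]
    let open Immersion I in
    BranchSet ≐ A ∪ X ×
    EdgeConnected H 3 ×
    (∀ x → branch x ∈ X → degree H x ≡ 3) ×
    (∀ a b → a ≢ b → branch a ∈ A → branch b ∈ A →
    ∃[ l ] (IsLocalEdgeConnectivity H a b l × 2 * k ≤ l)) ×
    (∀ e → e ∈ Inside G A → ∃[ f ] Path.edges (route f) ≡ e ∷ []))
theorem3p2 em k 2≤k V E G connected lf A finA linked =
  (_∈ˡ X) , (λ x∈ → X∉A x∈) , (λ x y x∈ y∈ s → hubs-separate reps-apart (proj₁ solution) x∈ y∈ s) ,
  n , m , H , immersion , branchSet-A∪X , 3-connected , degree-3 , local-connectivity , inside-kept
  where
  open Assembly em k G connected lf A finA linked using (reps-apart; solution)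
  open Hubs em k G connected lf A finA linked using (hubs-separate)
  open Conclusion em k 2≤k G connected lf A finA linked reps-apart (proj₁ solution) (proj₂ solution)
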